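{- Let $q$ be a prime power, let $2\le e\le 6$, let $r$ be a positive integer, let $a\in\mathbb{F}_{q^e}$ with $a\neq 0$, let $f(x)=x^r(x^{q-1}+a)\in\mathbb{F}_{q^e}[x]$, and let $\ell=q^{e-1}+\cdots+q+1$. (i) If $e\in\{2,3,4\}$, then $f(x)$ permutes $\mathbb{F}_{q^e}$ if and only if $(-a)^{\ell}\neq 1$, $\gcd(r,q-1)=1$, and $r \bmod \ell\in\{1,\ell-q\}$. (ii) If $e=5$ and $q$ is an odd prime, then $f(x)$ permutes $\mathbb{F}_{q^5}$ if and only if $(-a)^{\ell}\neq 1$, $\gcd(r,q-1)=1$, and $r\bmod \ell\in\{1,\ell-q,q^3+1,q^4+q^2+1\}$. (iii) If $e=6$ and $q$ is an odd prime, then $f(x)$ permutes $\mathbb{F}_{q^6}$ if and only if $(-a)^{\ell}\neq 1$, $\gcd(r,q-1)=1$, and $r\bmod \ell\in\{1,\ell-q\}$.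
   Context: A polynomial permutes $\mathbb{F}_{q^e}$ if the map $x\mapsto f(x)$ is a bijection of $\mathbb{F}_{q^e}$. For integers $r$ and $\ell\ge 1$, $r\bmod \ell$ denotes the least nonnegative residue of $r$ modulo $\ell$. -}

module Defs where

open import Algebra.Apartness.Bundles using (HeytingField; HeytingCommutativeRing)
open import Algebra.Bundles using (CommutativeRing)
import Algebra.Properties.Semiring.Exp as Exp
open import Data.Fin.Base using (Fin)
open import Data.List.Base using (applyUpTo; sum)
open import Data.Nat.Base using (ℕ; suc; _∸_; _≤_; NonZero)
import Data.Nat.Base as ℕ
open import Data.Nat.Primality using (Prime)
open import Data.Product.Base using (∃₂; _×_)
open import Function.Bundles using (Inverse)
open import Function.Definitions using (Bijective)
open import Level using (_⊔_)
open import Relation.Binary.PropositionalEquality using (_≡_; setoid)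

IsPrimePower : ℕ → Set
IsPrimePower q = ∃₂ λ p k → Prime p × 1 ≤ k × q ≡ p ℕ.^ k

-- 1 + q + ⋯ + q^(e-1)
ℓ : ℕ → ℕ → ℕ
ℓ q e = sum (applyUpTo (q ℕ.^_) e)

ℓ-nonZero : ∀ q {e} → 2 ≤ e → NonZero (ℓ q e)
ℓ-nonZero q {suc e} _ = _

-- Once `HasOrder n` holds, _≈_ is decidable, hence so is invertibility; the
-- apartness _#_ is then the negation of _≈_, and F is a field in the
-- classical sense: every x with ¬ x ≈ 0# is invertible, and ¬ 1# ≈ 0#.
module FieldNotions {c ℓ₁ ℓ₂} (F : HeytingField c ℓ₁ ℓ₂) where

  commutativeRing : CommutativeRing c ℓ₁
  commutativeRing =
    HeytingCommutativeRing.commutativeRing (HeytingField.heytingCommutativeRing F)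

  open CommutativeRing commutativeRing public
    using (Carrier; _≈_; _+_; _*_; -_; 0#; 1#)
  open Exp (CommutativeRing.semiring commutativeRing) public
    using (_^_)

  HasOrder : ℕ → Set (c ⊔ ℓ₁)
  HasOrder n = Inverse (CommutativeRing.setoid commutativeRing) (setoid (Fin n))

  -- Applied to the map x ↦ f(x) induced by a polynomial f.
  Permutes : (Carrier → Carrier) → Set (c ⊔ ℓ₁)
  Permutes f = Bijective _≈_ _≈_ f

  -- x^r (x^(q-1) + a); the truncated subtraction is exact as q ≥ 1.
  f : (q r : ℕ) (a : Carrier) → Carrier → Carrier
  f q r a x = x ^ r * (x ^ (q ∸ 1) + a)

{-# OPTIONS --safe #-}
-- Put γ = -1/a, so that f(x) = a x^r (1 - η) with η = γ x^(q-1).  If f permutes the field, then for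
-- 0 < M < ℓ Hermite's criterion gives ∑ₓ x^((q-1)rM) (1 - η)^((q-1)M) = 0.  In this sum a monomial
-- η^m contributes -γ^m if ℓ ∣ rM + m and 0 otherwise, so that only very few coefficients of
-- (1 - η)^((q-1)M) survive.  They are explicit in two cases: for (q-1)M = q^d - 1 all are 1, and for
-- (q-1)M = 2 q^(e-1) - q^i - 1 those of η^m with m < q^(e-1) are ⌊m/q^i⌋ + 1.  The first case bounds
-- residues of multiples of r modulo ℓ, the second one yields congruences modulo p between digits of
-- r mod ℓ, and for e ≤ 6 (with one further M when e = 4) the listed residues are all that is left.
--
-- Conversely, for these residues f(x) = x^(κℓ) (w^(q^i) + a w^(q^j)) with w a power of x.  The linearized
-- binomial is injective as (-a)^ℓ ≠ 1, and x^(κℓ) has order dividing q - 1, so f determines x^(q-1),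
-- hence also x^r, and finally x because gcd(r, q - 1) = 1.
module Submission where

open import Defs
open import Algebra.Apartness.Bundles using (HeytingField)
open import Data.List.Base using (_∷_; [])
open import Data.List.Membership.Propositional using (_∈_)
open import Data.Nat.Base using (ℕ; _≤_; _∸_; _%_) renaming (_+_ to _+ℕ_; _^_ to _^ℕ_)
open import Data.Nat.Divisibility using (_∣_)
open import Data.Nat.GCD using (gcd)
open import Data.Nat.Primality using (Prime)
open import Data.Product.Base using (_×_; _,_)
open import Function.Bundles using (_⇔_)
open import Relation.Binary.PropositionalEquality using (_≡_)
open import Relation.Nullary.Negation.Core using (¬_)
import Data.Nat.Base as ℕ

-- The exponents M are those for which (1 - η)^((q-1)M) expands without binomial coefficients:
-- Frobenius turns (1 - η)^(p^i) into 1 - η^(p^i), and division by 1 - η or by (1 - η)^(1 + q^i)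
-- leaves geometric sums or derivatives of such. The expansions are identities of functions on the
-- field, obtained by cancelling powers of 1 - η; the point η = 1 is treated apart.
--
-- What a vanishing sum yields depends on the number of surviving exponents. A single one has a
-- coefficient divisible by p. Two of them differ by ℓ, and their relation contains the unknown γ^ℓ;
-- a previously obtained congruence p ∣ 2t decides it, together with γ^ℓ ≠ 1 when 2t = q.
--
-- For e = 5 and e = 6 a whole base-q digit has to vanish. A congruence modulo p gives this when q =
-- p, and oddness removes the factor 2.
--
-- Modulo ℓ the listed residues are m q^j with m = ±1 and, for e = 5, also m = ±(q² + 1), which is
-- invertible because (q² + 1)(q² + q) = ℓ - 1.

-- Decidability and cancellation in a finite field.

module FieldArithmetic {c ℓ₁ ℓ₂} (F : HeytingField c ℓ₁ ℓ₂) where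
  open import Algebra.Bundles using (CommutativeRing)
  open import Data.Nat.Base as ℕ using (ℕ; zero; suc)
  import Data.Nat.Properties as ℕ
  import Data.Fin.Properties as Fin
  open import Data.Product.Base using (∃; _,_; proj₁; proj₂; _×_)
  open import Function.Bundles using (Inverse)
  open import Relation.Binary.PropositionalEquality as ≡ using (_≡_)
  open import Relation.Nullary using (Dec; yes; no; ¬_; contradiction)
  open import Relation.Nullary.Decidable using (map′)
  open FieldNotions F public
  open CommutativeRing commutativeRing public
    hiding (Carrier; _≈_; _+_; _*_; -_; 0#; 1#; zero)
  open import Algebra.Properties.Ring ring public
  open import Algebra.Properties.CommutativeSemiring.Exp commutativeSemiring public
    using (^-congˡ; ^-congʳ; ^-homo-*; ^-assocʳ; ^-distrib-*)
  open import Algebra.Properties.Semiring.Mult semiring public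
    using (×-homo-+; ×-assoc-*; ×-comm-*; ×-congʳ; ×-congˡ; ×-assocˡ; ×1-homo-*; ×-homo-1)
    renaming (_×_ to _·_)
  open import Relation.Binary.Reasoning.Setoid setoid

  ^-one : ∀ n → 1# ^ n ≈ 1#
  ^-one zero    = refl
  ^-one (suc n) = trans (*-identityˡ _) (^-one n)

  ^-zero : ∀ n → .{{_ : ℕ.NonZero n}} → 0# ^ n ≈ 0#
  ^-zero (suc n) = zeroˡ _

  ^-comm : ∀ x m n → (x ^ m) ^ n ≈ (x ^ n) ^ m
  ^-comm x m n = begin
    (x ^ m) ^ n    ≈⟨ ^-assocʳ x m n ⟩
    x ^ (m ℕ.* n)  ≈⟨ ^-congʳ x (ℕ.*-comm m n) ⟩
    x ^ (n ℕ.* m)  ≈⟨ ^-assocʳ x n m ⟨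
    (x ^ n) ^ m    ∎

  ^≈1-* : ∀ {x} m n → x ^ m ≈ 1# → x ^ (m ℕ.* n) ≈ 1#
  ^≈1-* {x} m n xᵐ≈1 = begin
    x ^ (m ℕ.* n) ≈⟨ ^-assocʳ x m n ⟨
    (x ^ m) ^ n   ≈⟨ ^-congˡ n xᵐ≈1 ⟩
    1# ^ n        ≈⟨ ^-one n ⟩
    1#            ∎

  ×1-* : ∀ n x → (n · 1#) * x ≈ n · x
  ×1-* n x = trans (×-assoc-* n 1# x) (×-congʳ n (*-identityˡ x))

  ×1-^ : ∀ p n → (p ℕ.^ n) · 1# ≈ (p · 1#) ^ n
  ×1-^ p zero    = ×-homo-1 1#
  ×1-^ p (suc n) = trans (×1-homo-* p (p ℕ.^ n)) (*-congˡ (×1-^ p n))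

  *≈0 : ∀ {x} y → x ≈ 0# → x * y ≈ 0#
  *≈0 y x≈0 = trans (*-congʳ x≈0) (zeroˡ y)

  -‿one-* : ∀ x y → (1# - x) * y ≈ y - x * y
  -‿one-* x y = trans ([y-z]x≈yx-zx y 1# x) (+-congʳ (*-identityˡ y))

  x-y+y≈x : ∀ x y → x - y + y ≈ x
  x-y+y≈x x y = trans (+-assoc x (- y) y) (trans (+-congˡ (-‿inverseˡ y)) (+-identityʳ x))

  module Decidable {Q} (order : HasOrder Q) where
    open Inverse order public using (to; from; to-cong; strictlyInverseʳ; strictlyInverseˡ)
    private
      module F = HeytingField F

    infix 4 _≈?_
    _≈?_ : ∀ x y → Dec (x ≈ y)
    x ≈? y = map′ (λ eq → trans (sym (strictlyInverseʳ x)) (trans (reflexive (≡.cong from eq)) (strictlyInverseʳ y)))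
                  to-cong (to x Fin.≟ to y)

    -- Exhaustive search over the index set. `P` has to respect `_≈_` because `from (to x)` is equal
    -- to x only up to `_≈_`.
    search : ∀ {p} {P : Carrier → Set p} → (∀ {x y} → x ≈ y → P x → P y) →
             (∀ x → Dec (P x)) → Dec (∃ P)
    search resp P? = map′ (λ (i , Pi) → from i , Pi)
      (λ (x , Px) → to x , resp (sym (strictlyInverseʳ x)) Px) (Fin.any? (λ i → P? (from i)))

    -- If the search finds no inverse, then x cannot be apart from 0, and tightness of the apartness
    -- gives x ≈ 0.
    inv : ∀ {x} → ¬ x ≈ 0# → ∃ λ y → x * y ≈ 1#
    inv {x} x≉0 with search (λ y≈z → trans (*-congˡ (sym y≈z))) (λ y → x * y ≈? 1#)
    ... | yes p = p
    ... | no ¬p = contradiction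
      (proj₁ (F.tight x 0#) λ x#0 → let y , _ , e = F.#⇒invertible x#0 in
        ¬p (y , trans (*-congʳ (sym (trans (+-congˡ -0#≈0#) (+-identityʳ x)))) e))
      x≉0

    *-cancelˡ : ∀ {x y z} → ¬ x ≈ 0# → x * y ≈ x * z → y ≈ z
    *-cancelˡ {x} {y} {z} x≉0 e = let x⁻¹ , xx⁻¹ = inv x≉0 in begin
      y              ≈⟨ *-identityˡ y ⟨
      1# * y         ≈⟨ *-congʳ (trans (*-comm _ _) xx⁻¹) ⟨
      (x⁻¹ * x) * y  ≈⟨ *-assoc _ _ _ ⟩
      x⁻¹ * (x * y)  ≈⟨ *-congˡ e ⟩
      x⁻¹ * (x * z)  ≈⟨ *-assoc _ _ _ ⟨
      (x⁻¹ * x) * z  ≈⟨ *-congʳ (trans (*-comm _ _) xx⁻¹) ⟩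
      1# * z         ≈⟨ *-identityˡ z ⟩
      z              ∎

    xy≈0⇒y≈0 : ∀ {x y} → ¬ x ≈ 0# → x * y ≈ 0# → y ≈ 0#
    xy≈0⇒y≈0 x≉0 e = *-cancelˡ x≉0 (trans e (sym (zeroʳ _)))

    *-≉0 : ∀ {x y} → ¬ x ≈ 0# → ¬ y ≈ 0# → ¬ x * y ≈ 0#
    *-≉0 x≉0 y≉0 e = y≉0 (xy≈0⇒y≈0 x≉0 e)

    1≉0 : ¬ 1# ≈ 0#
    1≉0 e = proj₂ (F.tight 1# 0#) e (F.invertible⇒# (1# , p , trans (*-comm _ _) p))
      where p = trans (*-identityˡ _) (trans (+-congˡ -0#≈0#) (+-identityʳ 1#))

    ^-≉0 : ∀ {x} n → ¬ x ≈ 0# → ¬ x ^ n ≈ 0#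
    ^-≉0 zero    x≉0 = 1≉0
    ^-≉0 (suc n) x≉0 = *-≉0 x≉0 (^-≉0 n x≉0)

    ^≈0⇒≈0 : ∀ {x} n → x ^ n ≈ 0# → x ≈ 0#
    ^≈0⇒≈0 {x} n e with x ≈? 0#
    ... | yes p = p
    ... | no ¬p = contradiction e (^-≉0 n ¬p)

-- Repunits in base q and uniqueness of residues.

module RepunitArithmetic where
  open import Defs using (ℓ)
  open import Data.Nat.Base
  open import Data.Nat.Properties
  open import Data.Nat.Divisibility
  open import Data.Nat.DivMod using ([m+kn]%n≡m%n; m<n⇒m%n≡m)
  open import Data.Product.Base using (_×_; _,_)
  open import Data.List.Base using (applyUpTo)
  open import Data.Nat.ListAction using (sum)
  open import Data.Nat.Tactic.RingSolver using (solve-∀)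
  open import Function.Base using (_∘_)
  open import Relation.Binary.PropositionalEquality
  open import Relation.Nullary using (¬_)
  open ≤-Reasoning

  ℓ-suc : ∀ q e → ℓ q (suc e) ≡ 1 + q * ℓ q e
  ℓ-suc q e = cong suc (scale (q ^_) e)
    where
    scale : ∀ f e → sum (applyUpTo (λ i → q * f i) e) ≡ q * sum (applyUpTo f e)
    scale f zero    = sym (*-zeroʳ q)
    scale f (suc e) = trans (cong (q * f 0 +_) (scale (f ∘ suc) e)) (sym (*-distribˡ-+ q (f 0) _))

  ℓ-snoc : ∀ q e → ℓ q (suc e) ≡ ℓ q e + q ^ e
  ℓ-snoc q zero    = refl
  ℓ-snoc q (suc e) = begin-equality
    ℓ q (suc (suc e))           ≡⟨ ℓ-suc q (suc e) ⟩
    1 + q * ℓ q (suc e)         ≡⟨ cong (λ x → 1 + q * x) (ℓ-snoc q e) ⟩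
    1 + q * (ℓ q e + q ^ e)     ≡⟨ cong suc (*-distribˡ-+ q (ℓ q e) _) ⟩
    1 + q * ℓ q e + q * q ^ e   ≡⟨ cong (_+ q * q ^ e) (ℓ-suc q e) ⟨
    ℓ q (suc e) + q ^ suc e     ∎

  q^e≡1+sℓ : ∀ s e → suc s ^ e ≡ suc (s * ℓ (suc s) e)
  q^e≡1+sℓ s zero    = cong suc (sym (*-zeroʳ s))
  q^e≡1+sℓ s (suc e) = begin-equality
    suc s * suc s ^ e                     ≡⟨ cong (suc s *_) (q^e≡1+sℓ s e) ⟩
    suc s * suc (s * ℓ (suc s) e)         ≡⟨ lemma s (ℓ (suc s) e) ⟩
    suc (s * (1 + suc s * ℓ (suc s) e))   ≡⟨ cong (λ x → suc (s * x)) (ℓ-suc (suc s) e) ⟨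
    suc (s * ℓ (suc s) (suc e))           ∎
    where
    lemma : ∀ s l → suc s * suc (s * l) ≡ suc (s * (1 + suc s * l))
    lemma = solve-∀

  -- Two members of one residue class modulo L are at least L apart. This is how a surviving
  -- exponent is shown to be the only one in its range.
  ∣-gap : ∀ {L x a b} → L ∣ x + a → L ∣ x + b → a < b → ¬ b < a + L
  ∣-gap {L} {x} {a} {b} L∣x+a L∣x+b a<b b<a+L = <⇒≱ b<a+L (begin
    a + L           ≤⟨ +-monoʳ-≤ a (∣⇒≤ {{>-nonZero (m<n⇒0<n∸m a<b)}} L∣b∸a) ⟩
    a + (b ∸ a)     ≡⟨ m+[n∸m]≡n (<⇒≤ a<b) ⟩
    b               ∎)
    where
    L∣b∸a : L ∣ b ∸ a
    L∣b∸a = ∣m+n∣m⇒∣n (subst (L ∣_) (trans (cong (x +_) (sym (m+[n∸m]≡n (<⇒≤ a<b)))) (sym (+-assoc x a _))) L∣x+b)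
          L∣x+a

  ℓ-mono-≤ : ∀ q {d e} → d ≤ e → ℓ q d ≤ ℓ q e
  ℓ-mono-≤ q {d} d≤e = go (≤⇒≤′ d≤e)
    where
    go : ∀ {e} → d ≤′ e → ℓ q d ≤ ℓ q e
    go ≤′-refl             = ≤-refl
    go (≤′-step {n = e} p) = ≤-trans (go p) (≤-trans (m≤m+n (ℓ q e) (q ^ e)) (≤-reflexive (sym (ℓ-snoc q e))))

  ℓ>0 : ∀ q e → 0 < e → 0 < ℓ q e
  ℓ>0 q (suc e) _ = s≤s z≤n

  divMod-unique : ∀ P .{{_ : NonZero P}} {x x′ y y′} → x < P → x′ < P → x + y * P ≡ x′ + y′ * P → x ≡ x′ × y ≡ y′
  divMod-unique P {x} {x′} {y} {y′} x<P x′<P e = x≡x′ , *-cancelʳ-≡ y y′ P (+-cancelˡ-≡ x _ _ (trans e (cong (_+ y′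
        * P) (sym x≡x′))))
    where
    mod : ∀ {x} y → x < P → (x + y * P) % P ≡ x
    mod {x} y x<P = trans ([m+kn]%n≡m%n x y P) (m<n⇒m%n≡m x<P)
    x≡x′ : x ≡ x′
    x≡x′ = trans (sym (mod y x<P)) (trans (cong (_% P) e) (mod y′ x′<P))

-- Inversion modulo ℓ and prime divisors.

module ResidueArithmetic where
  open import Data.Nat.Base
  open import Data.Nat.Properties
  open import Data.Nat.Divisibility
  open import Data.Nat.DivMod
  open import Data.Nat.Primality using (Prime; prime⇒irreducible; prime[2]; euclidsLemma; prime⇒nonTrivial)
  open import Data.Nat.Tactic.RingSolver using (solve-∀)
  open import Data.Product.Base using (∃; _,_)
  open import Data.Sum.Base using (_⊎_; inj₁; inj₂)
  open import Relation.Binary.PropositionalEquality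
  open import Relation.Nullary using (contradiction)
  open RepunitArithmetic
  open import Defs using (ℓ)

  <-witness : ∀ {m n} d → suc (m + d) ≡ n → m < n
  <-witness {m} d refl = s≤s (m≤m+n m d)

  ≤⇒+ : ∀ {m n} → m ≤ n → ∃ λ d → m + d ≡ n
  ≤⇒+ {m} {n} m≤n = n ∸ m , m+[n∸m]≡n m≤n

  ∣m+n∣n⇒∣m : ∀ {d m n} → d ∣ m + n → d ∣ n → d ∣ m
  ∣m+n∣n⇒∣m {d} {m} {n} d∣m+n = ∣m+n∣m⇒∣n (subst (d ∣_) (+-comm m n) d∣m+n)

  /-unique : ∀ {P n x y} .{{_ : NonZero P}} → n ≡ x + y * P → x < P → n / P ≡ y
  /-unique {P} {n} {x} {y} n≡ x<P with divMod-unique P {n % P} {x} {n / P} {y} (m%n<n n P) x<P (trans (sym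
        (m≡m%n+[m/n]*n n P)) n≡)
  ... | _ , e = e

  -- Multiply r m + H + w ≡ 0 (mod L) by q: since q m ≡ -1 and q H ≡ 1, this says r ≡ 1 + q w.
  residue-invert : ∀ {r q s m w H L} .{{_ : NonZero L}} → q ≡ suc s → L ≡ suc (q * m) → q * H ≡ suc (s * L) →
                   w < m → L ∣ r * m + (H + w) → r % L ≡ 1 + q * w
  residue-invert {r} {q} {s} {m} {w} {H} {L} q≡ L≡ qH≡ w<m (divides κ eq) = begin-equality
    r % L                           ≡⟨ [m+kn]%n≡m%n r (q * κ) L ⟨
    (r + q * κ * L) % L             ≡⟨ cong (_% L) key ⟩
    (1 + q * w + (r + s) * L) % L   ≡⟨ [m+kn]%n≡m%n (1 + q * w) (r + s) L ⟩
    (1 + q * w) % L                 ≡⟨ m<n⇒m%n≡m (≤-trans (s≤s (s≤s (*-monoʳ-≤ q (<⇒≤pred w<m)))) (≤-trans (qm m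
          w<m) (≤-reflexive (sym L≡)))) ⟩
    1 + q * w                       ∎
    where
    open ≤-Reasoning
    qm : ∀ m → w < m → suc (suc (q * pred m)) ≤ suc (q * m)
    qm (suc m) _ = s≤s (≤-trans (s≤s (m≤n+m (q * m) s)) (≤-reflexive (trans (cong (_+ q * m) (sym q≡)) (sym (*-suc
          q m)))))
    key : r + q * κ * L ≡ 1 + q * w + (r + s) * L
    key = begin-equality
      r + q * κ * L                      ≡⟨ cong (r +_) (*-assoc q κ L) ⟩
      r + q * (κ * L)                    ≡⟨ cong (λ x → r + q * x) eq ⟨
      r + q * (r * m + (H + w))          ≡⟨ l₁ r q m H w ⟩
      r * suc (q * m) + (q * H + q * w)  ≡⟨ cong₂ (λ x y → r * x + (y + q * w)) (sym L≡) qH≡ ⟩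
      r * L + (suc (s * L) + q * w)      ≡⟨ l₂ r L s (q * w) ⟩
      1 + q * w + (r + s) * L            ∎
      where
      l₁ : ∀ r q m H w → r + q * (r * m + (H + w)) ≡ r * suc (q * m) + (q * H + q * w)
      l₁ = solve-∀
      l₂ : ∀ r L s x → r * L + (suc (s * L) + x) ≡ 1 + x + (r + s) * L
      l₂ = solve-∀

  prime∣prime^⇒≡ : ∀ {p p′} k → Prime p → Prime p′ → p ∣ p′ ^ k → p ≡ p′
  prime∣prime^⇒≡ zero    pr pr′ p∣1 = contradiction (∣1⇒≡1 p∣1) (nonTrivial⇒≢1 {{prime⇒nonTrivial pr}})
  prime∣prime^⇒≡ {p} {p′} (suc k) pr pr′ p∣ with euclidsLemma p′ (p′ ^ k) pr p∣
  ... | inj₂ p∣′ = prime∣prime^⇒≡ k pr pr′ p∣′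
  ... | inj₁ p∣p′ with prime⇒irreducible pr′ p∣p′
  ...   | inj₁ p≡1  = contradiction p≡1 (nonTrivial⇒≢1 {{prime⇒nonTrivial pr}})
  ...   | inj₂ p≡p′ = p≡p′

  prime∣2x : ∀ {p x} → Prime p → p ∣ x + x → p ≡ 2 ⊎ p ∣ x
  prime∣2x {p} {x} pr d with euclidsLemma 2 x pr (subst (p ∣_) (cong (x +_) (sym (+-identityʳ x))) d)
  ... | inj₁ p∣2 = inj₁ (prime∣prime^⇒≡ 1 pr prime[2] p∣2)
  ... | inj₂ p∣x = inj₂ p∣x

  2∣n∨2∣1+n : ∀ n → 2 ∣ n ⊎ 2 ∣ suc n
  2∣n∨2∣1+n zero = inj₁ (divides 0 refl)
  2∣n∨2∣1+n (suc n) with 2∣n∨2∣1+n n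
  ... | inj₁ (divides t refl) = inj₂ (divides (suc t) refl)
  ... | inj₂ d = inj₁ d

  ℓ2 : ∀ q → ℓ q 2 ≡ 1 + q
  ℓ2 q = cong suc (trans (+-identityʳ (q * 1)) (*-identityʳ q))
  ℓ3 : ∀ q → ℓ q 3 ≡ 1 + q + q * q
  ℓ3 q = lemma q
    where
    lemma : ∀ q → 1 + (q * 1 + (q * (q * 1) + 0)) ≡ 1 + q + q * q
    lemma = solve-∀

-- Roots of polynomials, Fermat's theorem and power sums.

module PowerSums {c ℓ₁ ℓ₂} (F : HeytingField c ℓ₁ ℓ₂) {n} (order : FieldNotions.HasOrder F (ℕ.suc n)) where
  open import Data.Nat.Base as ℕ using (ℕ; zero; suc)
  import Data.Nat.Properties as ℕ
  import Data.Nat.DivMod as ℕ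
  open import Data.Nat.Divisibility as ℕ using (_∣_; divides)
  open import Data.Fin.Base using (Fin; zero; suc; punchIn; inject≤)
  import Data.Fin.Properties as Fin
  open import Data.Fin.Permutation using (Permutation; permutation; _⟨$⟩ʳ_)
  open import Data.Product.Base using (∃; _,_; proj₁; proj₂; _×_)
  open import Data.Vec.Base using (Vec; []; _∷_; replicate)
  open import Function.Base using (_∘_)
  open import Function.Definitions using (Bijective; Injective)
  open import Relation.Binary.Core using (_Preserves_⟶_)
  open import Relation.Binary.PropositionalEquality as ≡ using (_≡_)
  open import Relation.Nullary using (yes; no; ¬_; contradiction)
  open import Relation.Nullary.Decidable using (_×-dec_; ¬?; decidable-stable)
  open FieldArithmetic F
  open Decidable order
  import Algebra.Properties.CommutativeMonoid.Sum *-commutativeMonoid as Product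
  open import Algebra.Properties.Semiring.Sum semiring
    using (sum; sum-cong-≋; sum-permute; sum-remove; sum-replicate; ∑-distrib-+; *-distribˡ-sum)
  open import Relation.Binary.Reasoning.Setoid setoid

  -- Horner's scheme with the constant term first. The final `1#` is an implicit leading
  -- coefficient, so a vector of length k is a monic polynomial of degree k and is never the zero
  -- polynomial.
  eval : ∀ {k} → Vec Carrier k → Carrier → Carrier
  eval []       x = 1#
  eval (c ∷ cs) x = c + x * eval cs x

  -- Synthetic division by X - a: the coefficients of the quotient are the intermediate Horner
  -- values at a.
  quotient : ∀ {k} → Vec Carrier (suc k) → Carrier → Vec Carrier k
  quotient (c ∷ [])     a = []
  quotient (c ∷ d ∷ cs) a = eval (d ∷ cs) a ∷ quotient (d ∷ cs) a

  eval-quotient : ∀ {k} (cs : Vec Carrier (suc k)) a x →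
                  eval cs x ≈ eval cs a + (x - a) * eval (quotient cs a) x
  eval-quotient (c ∷ []) a x = begin
    c + x * 1#                        ≈⟨ +-congˡ (*-identityʳ x) ⟩
    c + x                             ≈⟨ +-congˡ (x≈a+[x-a]) ⟩
    c + (a + (x - a))                 ≈⟨ +-assoc c a _ ⟨
    c + a + (x - a)                   ≈⟨ +-cong (+-congˡ (*-identityʳ a)) (*-identityʳ _) ⟨
    c + a * 1# + (x - a) * 1#         ∎
    where
    x≈a+[x-a] : x ≈ a + (x - a)
    x≈a+[x-a] = sym (trans (+-comm a _) (x-y+y≈x x a))
  eval-quotient (c ∷ cs@(_ ∷ _)) a x = begin
    c + x * sx                                     ≈⟨ +-congˡ (*-congʳ x≈a+d) ⟩
    c + (a + d) * sx                               ≈⟨ +-congˡ (distribʳ sx a d) ⟩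
    c + (a * sx + d * sx)                          ≈⟨ +-congˡ (+-cong (*-congˡ ih) (*-congˡ ih)) ⟩
    c + (a * (sa + d * t) + d * (sa + d * t))      ≈⟨ +-congˡ (+-congʳ (distribˡ a sa _)) ⟩
    c + (a * sa + a * (d * t) + d * (sa + d * t))  ≈⟨ +-congˡ (+-assoc _ _ _) ⟩
    c + (a * sa + (a * (d * t) + d * (sa + d * t))) ≈⟨ +-assoc _ _ _ ⟨
    c + a * sa + (a * (d * t) + d * (sa + d * t))  ≈⟨ +-congˡ (+-congʳ (trans (sym (*-assoc a d t)) (trans (*-congʳ
          (*-comm a d)) (*-assoc d a t)))) ⟩
    c + a * sa + (d * (a * t) + d * (sa + d * t))  ≈⟨ +-congˡ (distribˡ d _ _) ⟨
    c + a * sa + d * (a * t + (sa + d * t))        ≈⟨ +-congˡ (*-congˡ rearr) ⟩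
    c + a * sa + d * (sa + x * t)                  ∎
    where
    d = x - a
    sx = eval cs x
    sa = eval cs a
    t = eval (quotient cs a) x
    ih = eval-quotient cs a x
    x≈a+d : x ≈ a + d
    x≈a+d = sym (trans (+-comm a _) (x-y+y≈x x a))
    rearr : a * t + (sa + d * t) ≈ sa + x * t
    rearr = begin
      a * t + (sa + d * t) ≈⟨ +-assoc _ _ _ ⟨
      a * t + sa + d * t   ≈⟨ +-congʳ (+-comm _ _) ⟩
      sa + a * t + d * t   ≈⟨ +-assoc _ _ _ ⟩
      sa + (a * t + d * t) ≈⟨ +-congˡ (distribʳ t a d) ⟨
      sa + (a + d) * t     ≈⟨ +-congˡ (*-congʳ x≈a+d) ⟨
      sa + x * t           ∎

  -- Divide by X - ρ₀. The other roots differ from ρ₀, so they are roots of the quotient; the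
  -- descent ends at the constant 1.
  tooManyRoots : ∀ {k} (cs : Vec Carrier k) (ρ : Fin (suc k) → Carrier) →
                 Injective _≡_ _≈_ ρ → ¬ (∀ i → eval cs (ρ i) ≈ 0#)
  tooManyRoots []            ρ inj vanish = 1≉0 (vanish zero)
  tooManyRoots cs@(_ ∷ _) ρ inj vanish =
    tooManyRoots (quotient cs a) (ρ ∘ suc) (Fin.suc-injective ∘ inj) λ i →
      xy≈0⇒y≈0 (λ d≈0 → Fin.0≢1+n (≡.sym (inj (x∙y⁻¹≈ε⇒x≈y _ _ d≈0)))) (begin
        (ρ (suc i) - a) * eval (quotient cs a) (ρ (suc i))               ≈⟨ +-identityˡ _ ⟨
        0# + (ρ (suc i) - a) * eval (quotient cs a) (ρ (suc i))          ≈⟨ +-congʳ (vanish zero) ⟨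
        eval cs a + (ρ (suc i) - a) * eval (quotient cs a) (ρ (suc i))   ≈⟨ eval-quotient cs a (ρ (suc i)) ⟨
        eval cs (ρ (suc i))                                              ≈⟨ vanish (suc i) ⟩
        0#                                                               ∎)
    where a = ρ zero

  nonzero : Fin n → Carrier
  nonzero = from ∘ punchIn (to 0#)

  from-injective : Injective _≡_ _≈_ from
  from-injective {i} {j} e = ≡.trans (≡.sym (strictlyInverseˡ i)) (≡.trans (to-cong e) (strictlyInverseˡ j))

  nonzero-≉0 : ∀ i → ¬ nonzero i ≈ 0#
  nonzero-≉0 i e = Fin.punchInᵢ≢i (to 0#) i (≡.trans (≡.sym (strictlyInverseˡ _)) (to-cong e))

  -- A substitute for a primitive element: X^k - 1 is monic of degree k and cannot vanish at all n >
  -- k nonzero elements.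
  ^≉1 : ∀ {k} → 0 ℕ.< k → k ℕ.< n → ∃ λ x → ¬ x ≈ 0# × ¬ x ^ k ≈ 1#
  ^≉1 {suc k} _ k<n
    with search (λ x≈y (x≉0 , p) → (λ y≈0 → x≉0 (trans x≈y y≈0)) , λ q → p (trans (^-congˡ (suc k) x≈y) q))
                (λ x → ¬? (x ≈? 0#) ×-dec ¬? (x ^ suc k ≈? 1#))
  ... | yes p = p
  ... | no ¬p = contradiction roots (tooManyRoots (- 1# ∷ replicate k 0#) ρ inj)
    where
    ρ : Fin (suc (suc k)) → Carrier
    ρ i = nonzero (inject≤ i k<n)
    inj : Injective _≡_ _≈_ ρ
    inj {i} {j} e = Fin.inject≤-injective k<n k<n i j (Fin.punchIn-injective (to 0#) _ _ (from-injective e))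
    eval-zeros : ∀ k x → eval (replicate k 0#) x ≈ x ^ k
    eval-zeros zero    x = refl
    eval-zeros (suc k) x = trans (+-identityˡ _) (*-congˡ (eval-zeros k x))
    roots : ∀ i → eval (- 1# ∷ replicate k 0#) (ρ i) ≈ 0#
    roots i = begin
      - 1# + ρ i * eval (replicate k 0#) (ρ i) ≈⟨ +-congˡ (*-congˡ (eval-zeros k _)) ⟩
      - 1# + ρ i ^ suc k ≈⟨ +-congˡ (decidable-stable (_ ≈? _) (λ q → ¬p (ρ i , nonzero-≉0 _ , q))) ⟩
      - 1# + 1#          ≈⟨ -‿inverseˡ 1# ⟩
      0#                 ∎

  toPermutation : ∀ {f : Carrier → Carrier} → f Preserves _≈_ ⟶ _≈_ → Bijective _≈_ _≈_ f →
                  ∃ λ (π : Permutation (suc n) (suc n)) → ∀ i → from (π ⟨$⟩ʳ i) ≈ f (from i)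
  toPermutation {f} f-cong (inj , surj) =
    permutation (to ∘ f ∘ from) (to ∘ f⁻¹ ∘ from)
      (λ i → ≡.trans (to-cong (trans (f-cong (strictlyInverseʳ _)) (proj₂ (surj (from i)) refl))) (strictlyInverseˡ
            i))
      (λ i → ≡.trans (to-cong (inj (trans (proj₂ (surj _) refl) (strictlyInverseʳ _)))) (strictlyInverseˡ i)) ,
    λ i → strictlyInverseʳ _
    where
    f⁻¹ : Carrier → Carrier
    f⁻¹ y = proj₁ (surj y)

  opaque
    ∑F : (Carrier → Carrier) → Carrier
    ∑F φ = sum (φ ∘ from)

  opaque
    unfolding ∑F

    ∑F-cong : ∀ {φ ψ} → (∀ x → φ x ≈ ψ x) → ∑F φ ≈ ∑F ψ
    ∑F-cong φ≈ψ = sum-cong-≋ (φ≈ψ ∘ from)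

    ∑F-+ : ∀ φ ψ → ∑F (λ x → φ x + ψ x) ≈ ∑F φ + ∑F ψ
    ∑F-+ φ ψ = ∑-distrib-+ (φ ∘ from) (ψ ∘ from)

    ∑F-* : ∀ a φ → ∑F (λ x → a * φ x) ≈ a * ∑F φ
    ∑F-* a φ = sym (*-distribˡ-sum a (φ ∘ from))

    ∑F-reindex : ∀ {f} → f Preserves _≈_ ⟶ _≈_ → Bijective _≈_ _≈_ f →
                 ∀ φ → φ Preserves _≈_ ⟶ _≈_ → ∑F (φ ∘ f) ≈ ∑F φ
    ∑F-reindex {f} f-cong f-bij φ φ-cong = let π , from-π = toPermutation f-cong f-bij in begin
      ∑F (φ ∘ f)                        ≈⟨ sum-cong-≋ (λ i → φ-cong (from-π i)) ⟨
      sum (λ i → φ (from (π ⟨$⟩ʳ i)))   ≈⟨ sum-permute (φ ∘ from) π ⟨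
      ∑F φ                              ∎

    ∑F-remove : ∀ φ → φ Preserves _≈_ ⟶ _≈_ → ∑F φ ≈ φ 0# + sum (φ ∘ nonzero)
    ∑F-remove φ φ-cong = trans (sum-remove {i = to 0#} (φ ∘ from)) (+-congʳ (φ-cong (strictlyInverseʳ 0#)))

    ∑F-1 : ∑F (λ _ → 1#) ≈ suc n · 1#
    ∑F-1 = sum-replicate (suc n)

  -- The translation x ↦ x + 1 permutes the field, so it leaves the sum of all elements unchanged
  -- while adding 1 once per element.
  |F|·1≈0 : suc n · 1# ≈ 0#
  |F|·1≈0 = +-cancelˡ (∑F (λ x → x)) _ _ (begin
    ∑F (λ x → x) + suc n · 1#          ≈⟨ +-congˡ ∑F-1 ⟨
    ∑F (λ x → x) + ∑F (λ _ → 1#)       ≈⟨ ∑F-+ (λ x → x) (λ _ → 1#) ⟨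
    ∑F (λ x → x + 1#)                  ≈⟨ ∑F-reindex +-congʳ (+-cancelʳ 1# _ _ , surj) (λ x → x) (λ e → e) ⟩
    ∑F (λ x → x)                       ≈⟨ +-identityʳ _ ⟨
    ∑F (λ x → x) + 0#                  ∎)
    where
    surj : ∀ y → ∃ λ x → ∀ {z} → z ≈ x → z + 1# ≈ y
    surj y = y - 1# , λ e → trans (+-congʳ e) (x-y+y≈x y 1#)

  *-bijective : ∀ {a} → ¬ a ≈ 0# → Bijective _≈_ _≈_ (a *_)
  *-bijective {a} a≉0 = *-cancelˡ a≉0 , λ y → let a⁻¹ , aa⁻¹ = inv a≉0 in
    a⁻¹ * y , λ e → trans (*-congˡ e) (trans (sym (*-assoc _ _ _)) (trans (*-congʳ aa⁻¹) (*-identityˡ y)))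

  private
    -- Replaces the factor belonging to x = 0 by 1. A product over the nonzero elements thereby
    -- becomes one over the full index set, where permutations act.
    orOne : Carrier → Carrier → Carrier
    orOne y x with x ≈? 0#
    ... | yes _ = 1#
    ... | no  _ = y

    orOne-cong : ∀ {y y′ x x′} → y ≈ y′ → x ≈ x′ → orOne y x ≈ orOne y′ x′
    orOne-cong {x = x} {x′} y≈ x≈ with x ≈? 0# | x′ ≈? 0#
    ... | yes _ | yes _ = refl
    ... | no _  | no _  = y≈
    ... | yes p | no q  = contradiction (trans (sym x≈) p) q
    ... | no p  | yes q = contradiction (trans x≈ q) p

    orOne-yes : ∀ {y x} → x ≈ 0# → orOne y x ≈ 1#
    orOne-yes {y} {x} x≈0 with x ≈? 0#
    ... | yes _ = refl
    ... | no p  = contradiction x≈0 p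

    orOne-no : ∀ {y x} → ¬ x ≈ 0# → orOne y x ≈ y
    orOne-no {y} {x} x≉0 with x ≈? 0#
    ... | no _  = refl
    ... | yes p = contradiction p x≉0

    orOne-≉0 : ∀ x → ¬ orOne x x ≈ 0#
    orOne-≉0 x with x ≈? 0#
    ... | yes _ = 1≉0
    ... | no p  = p

    product-≉0 : ∀ {k} (t : Fin k → Carrier) → (∀ i → ¬ t i ≈ 0#) → ¬ Product.sum t ≈ 0#
    product-≉0 {zero}  t t≉0 = 1≉0
    product-≉0 {suc k} t t≉0 = *-≉0 (t≉0 zero) (product-≉0 (t ∘ suc) (t≉0 ∘ suc))

  -- Multiplication by a permutes the field. It preserves the product of the nonzero elements and
  -- multiplies each of the n factors by a.
  fermat : ∀ {a} → ¬ a ≈ 0# → a ^ n ≈ 1#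
  fermat {a} a≉0 = begin
    a ^ n                          ≈⟨ Product.sum-replicate n ⟨
    Product.sum {n} (λ _ → a)      ≈⟨ Product.sum-cong-≋ (λ i → orOne-no (nonzero-≉0 i)) ⟨
    Product.sum (χ ∘ nonzero)      ≈⟨ *-identityˡ _ ⟨
    1# * Product.sum (χ ∘ nonzero) ≈⟨ *-congʳ (orOne-yes (strictlyInverseʳ 0#)) ⟨
    χ (from (to 0#)) * Product.sum (χ ∘ nonzero) ≈⟨ Product.sum-remove {i = to 0#} (χ ∘ from) ⟨
    Product.sum (χ ∘ from)         ≈⟨ *-cancelˡ (product-≉0 (ψ ∘ from) (λ i → orOne-≉0 (from i))) step ⟩
    1#                             ∎
    where
    χ ψ : Carrier → Carrier
    χ = orOne a
    ψ x = orOne x x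
    ψ-a : ∀ x → ψ (a * x) ≈ ψ x * χ x
    ψ-a x with x ≈? 0#
    ... | yes x≈0 = trans (orOne-yes (trans (*-congˡ x≈0) (zeroʳ a))) (sym (*-identityˡ 1#))
    ... | no  x≉0 = trans (orOne-no (*-≉0 a≉0 x≉0)) (*-comm a x)
    π∃ = toPermutation (*-congˡ {a}) (*-bijective a≉0)
    π = proj₁ π∃
    step : Product.sum (ψ ∘ from) * Product.sum (χ ∘ from) ≈ Product.sum (ψ ∘ from) * 1#
    step = begin
      Product.sum (ψ ∘ from) * Product.sum (χ ∘ from)      ≈⟨ Product.∑-distrib-+ (ψ ∘ from) (χ ∘ from) ⟨
      Product.sum (λ i → ψ (from i) * χ (from i))          ≈⟨ Product.sum-cong-≋ (λ i → ψ-a (from i)) ⟨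
      Product.sum (λ i → ψ (a * from i))                   ≈⟨ Product.sum-cong-≋ (λ i → orOne-cong (proj₂ π∃ i)
            (proj₂ π∃ i)) ⟨
      Product.sum (λ i → ψ (from (π ⟨$⟩ʳ i)))              ≈⟨ Product.sum-permute (ψ ∘ from) π ⟨
      Product.sum (ψ ∘ from)                               ≈⟨ *-identityʳ _ ⟨
      Product.sum (ψ ∘ from) * 1#                          ∎

  fermat-∣ : ∀ {a k} → ¬ a ≈ 0# → n ∣ k → a ^ k ≈ 1#
  fermat-∣ {a} a≉0 (divides t ≡.refl) = trans (^-congʳ a (ℕ.*-comm t n)) (^≈1-* n t (fermat a≉0))

  -- Each nonzero element contributes 1, and n · 1 = -1. Positivity of k matters for x = 0, since
  -- 0^0 = 1.
  powerSum-∣ : ∀ {k} → 0 ℕ.< k → n ∣ k → ∑F (_^ k) ≈ - 1#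
  powerSum-∣ {suc k} _ n∣k = begin
    ∑F (_^ suc k)                              ≈⟨ ∑F-remove _ (^-congˡ (suc k)) ⟩
    0# ^ suc k + sum (λ i → nonzero i ^ suc k) ≈⟨ +-cong (zeroˡ _) (sum-cong-≋ (λ i → fermat-∣ (nonzero-≉0 i) n∣k)) ⟩
    0# + sum {n} (λ _ → 1#)                    ≈⟨ +-congˡ (sum-replicate n) ⟩
    0# + n · 1#                                ≈⟨ +-identityˡ _ ⟩
    n · 1#                                     ≈⟨ +-inverseʳ-unique 1# _ |F|·1≈0 ⟩
    - 1#                                       ∎

  -- Substituting b x for x multiplies the sum by b^k, and some b has b^k ≠ 1.
  powerSum-∤ : ∀ {k} → .{{_ : ℕ.NonZero n}} → ¬ n ∣ k → ∑F (_^ k) ≈ 0#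
  powerSum-∤ {k} n∤k with ^≉1 {k ℕ.% n} (ℕ.n≢0⇒n>0 (λ e → n∤k (ℕ.m%n≡0⇒n∣m k n e))) (ℕ.m%n<n k n)
  ... | b , b≉0 , bᵏ≉1 = xy≈0⇒y≈0 {b ^ k - 1#} (λ e → bᵏ≉1 (trans (sym bᵏ) (x∙y⁻¹≈ε⇒x≈y _ _ e))) (begin
    (b ^ k - 1#) * S            ≈⟨ [y-z]x≈yx-zx S (b ^ k) 1# ⟩
    b ^ k * S - 1# * S          ≈⟨ +-cong (∑F-* _ (_^ k)) (-‿cong (sym (*-identityˡ S))) ⟨
    ∑F (λ x → b ^ k * x ^ k) - S ≈⟨ +-congʳ (∑F-cong (λ x → ^-distrib-* b x k)) ⟨
    ∑F (λ x → (b * x) ^ k) - S  ≈⟨ +-congʳ (∑F-reindex *-congˡ (*-bijective b≉0) (_^ k) (^-congˡ k)) ⟩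
    S - S                       ≈⟨ -‿inverseʳ S ⟩
    0#                          ∎)
    where
    S = ∑F (_^ k)
    bᵏ : b ^ k ≈ b ^ (k ℕ.% n)
    bᵏ = begin
      b ^ k                                        ≈⟨ ^-congʳ b (ℕ.m≡m%n+[m/n]*n k n) ⟩
      b ^ (k ℕ.% n ℕ.+ k ℕ./ n ℕ.* n)              ≈⟨ ^-homo-* b (k ℕ.% n) _ ⟩
      b ^ (k ℕ.% n) * b ^ (k ℕ./ n ℕ.* n)          ≈⟨ *-congˡ (fermat-∣ b≉0 (ℕ.n∣m*n (k ℕ./ n))) ⟩
      b ^ (k ℕ.% n) * 1#                           ≈⟨ *-identityʳ _ ⟩
      b ^ (k ℕ.% n)                                ∎

  -- A value y that is missed could be punched out of the codomain, giving an injection from n + 1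
  -- indices into n.
  injective⇒bijective : ∀ {f : Carrier → Carrier} → f Preserves _≈_ ⟶ _≈_ →
                        Injective _≈_ _≈_ f → Bijective _≈_ _≈_ f
  injective⇒bijective {f} f-cong inj = inj , surj
    where
    surj : ∀ y → ∃ λ x → ∀ {z} → z ≈ x → f z ≈ y
    surj y with search (λ x≈z → trans (f-cong (sym x≈z))) (λ x → f x ≈? y)
    ... | yes (x , e) = x , λ z≈x → trans (f-cong z≈x) e
    ... | no ¬e = contradiction (Fin.pigeonhole (ℕ.n<1+n n) g) λ (i , j , i<j , gi≡gj) →
      Fin.<⇒≢ i<j (from-injective (inj (to-inj (Fin.punchOut-injective (out i) (out j) gi≡gj))))
      where
      to-inj : ∀ {x z} → to x ≡ to z → x ≈ z
      to-inj e = trans (sym (strictlyInverseʳ _)) (trans (reflexive (≡.cong from e)) (strictlyInverseʳ _))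
      out : ∀ i → ¬ to y ≡ to (f (from i))
      out i e = ¬e (from i , to-inj (≡.sym e))
      g : Fin (suc n) → Fin n
      g i = Data.Fin.Base.punchOut (out i)
        where import Data.Fin.Base

-- Binomial coefficients divisible by p.

module BinomialDivisibility where
  open import Data.Nat.Base
  open import Data.Nat.Properties
  open import Data.Nat.Divisibility
  open import Data.Nat.DivMod using (m/n*n≡m)
  open import Data.Nat.Combinatorics using (_C_; nCk≡n!/k![n-k]!; k![n∸k]!∣n!)
  open import Data.Nat.Primality using (prime⇒nonTrivial; euclidsLemma)
  open import Data.Sum.Base using (inj₁; inj₂)
  open import Relation.Binary.PropositionalEquality
  open import Relation.Nullary using (¬_; contradiction)

  prime∤! : ∀ {p} m → Prime p → m < p → ¬ p ∣ m !
  prime∤! zero    pr m<p p∣1 = nonTrivial⇒≢1 {{prime⇒nonTrivial pr}} (∣1⇒≡1 p∣1)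
  prime∤! (suc m) pr m<p p∣m! with euclidsLemma (suc m) (m !) pr p∣m!
  ... | inj₁ p∣m = contradiction (∣⇒≤ p∣m) (<⇒≱ m<p)
  ... | inj₂ p∣m! = prime∤! m pr (<-trans (n<1+n m) m<p) p∣m!

  C*k!*[n∸k]!≡n! : ∀ {n k} → k ≤ n → (n C k) * (k ! * (n ∸ k) !) ≡ n !
  C*k!*[n∸k]!≡n! {n} {k} k≤n = trans (cong (_* (k ! * (n ∸ k) !)) (nCk≡n!/k![n-k]! k≤n))
                                     (m/n*n≡m (k![n∸k]!∣n! k≤n))
    where instance _ = k !* (n ∸ k) !≢0

  -- p divides p!, the product of the binomial coefficient with two factorials of numbers below p,
  -- and divides neither of these.
  prime∣C : ∀ {p k} → Prime p → 0 < k → k < p → p ∣ p C k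
  prime∣C {p@(suc _)} {k} pr 0<k k<p
    with euclidsLemma (p C k) (k ! * (p ∸ k) !) pr (subst (p ∣_) (sym (C*k!*[n∸k]!≡n! (<⇒≤ k<p))) (m∣m*n _))
  ... | inj₁ p∣C = p∣C
  ... | inj₂ p∣k!*[p∸k]! with euclidsLemma (k !) _ pr p∣k!*[p∸k]!
  ...   | inj₁ p∣k! = contradiction p∣k! (prime∤! k pr k<p)
  ...   | inj₂ p∣[p∸k]! = contradiction p∣[p∸k]! (prime∤! (p ∸ k) pr (∸-monoʳ-< 0<k (<⇒≤ k<p)))
  prime∣C {zero} pr _ ()

-- Characteristic p and the Frobenius map.

module Frobenius {c ℓ₁ ℓ₂} (F : HeytingField c ℓ₁ ℓ₂) {n} (order : FieldNotions.HasOrder F (ℕ.suc n))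
                 {p s} (p-prime : Prime p) (n+1≡pˢ : ℕ.suc n ≡ p ℕ.^ s) where
  open import Data.Nat.Base as ℕ using (ℕ; zero; suc)
  import Data.Nat.Properties as ℕ
  open import Data.Nat.Divisibility as ℕ using (_∣_; divides)
  open import Data.Nat.Combinatorics using (_C_; nCn≡1)
  open import Data.Nat.Primality using (prime⇒nonZero; prime⇒nonTrivial; prime⇒irreducible)
  open import Data.Nat.GCD using (gcd[m,n]∣m; gcd[m,n]∣n; gcd-GCD; module Bézout)
  open import Data.Fin.Base using (Fin; zero; suc; toℕ; fromℕ; inject₁)
  import Data.Fin.Properties as Fin
  open import Data.Sum.Base using (inj₁; inj₂)
  import Relation.Binary.PropositionalEquality as ≡
  open import Relation.Nullary using (contradiction)
  open BinomialDivisibility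
  open FieldArithmetic F
  open Decidable order
  open PowerSums F order
  open import Algebra.Properties.Semiring.Sum semiring using (sum; sum-init-last; sum-cong-≋; sum-replicate-zero)
  import Algebra.Properties.CommutativeSemiring.Binomial commutativeSemiring as Binomial
  open import Relation.Binary.Reasoning.Setoid setoid

  instance
    p≢0 : ℕ.NonZero p
    p≢0 = prime⇒nonZero p-prime

  -- The power (p · 1)^s is |F| · 1 = 0, and a field has no nilpotents.
  p·1≈0 : p · 1# ≈ 0#
  p·1≈0 = ^≈0⇒≈0 s (trans (sym (×1-^ p s)) (trans (×-congˡ (≡.sym n+1≡pˢ)) |F|·1≈0))

  ∣⇒·≈0 : ∀ {m} x → p ∣ m → m · x ≈ 0#
  ∣⇒·≈0 x (divides t ≡.refl) = begin
    (t ℕ.* p) · x        ≈⟨ ×-congˡ (ℕ.*-comm t p) ⟩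
    (p ℕ.* t) · x        ≈⟨ ×-assocˡ x p t ⟨
    p · (t · x)          ≈⟨ ×1-* p _ ⟨
    (p · 1#) * (t · x)   ≈⟨ *≈0 _ p·1≈0 ⟩
    0#                   ∎

  -- Otherwise gcd(m, p) = 1, and a Bézout identity would write 1 as a combination of m · 1 and p ·
  -- 1, both zero. This carries vanishing coefficients back to congruences in ℕ.
  ·1≈0⇒∣ : ∀ m → m · 1# ≈ 0# → p ∣ m
  ·1≈0⇒∣ m m·1≈0 with prime⇒irreducible p-prime (gcd[m,n]∣n m p)
  ... | inj₂ g≡p = ≡.subst (_∣ m) g≡p (gcd[m,n]∣m m p)
  ... | inj₁ g≡1 with ≡.subst (λ d → Bézout.Identity d m p) g≡1 (Bézout.identity (gcd-GCD m p))
  ...   | Bézout.+- x y eq = contradiction (begin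
          1#                     ≈⟨ ×-homo-1 1# ⟨
          1 · 1#                 ≈⟨ +-identityʳ _ ⟨
          1 · 1# + 0#            ≈⟨ +-congˡ (∣⇒·≈0 1# (divides y ≡.refl)) ⟨
          1 · 1# + (y ℕ.* p) · 1# ≈⟨ ×-homo-+ 1# 1 (y ℕ.* p) ⟨
          (1 ℕ.+ y ℕ.* p) · 1#   ≈⟨ ×-congˡ eq ⟩
          (x ℕ.* m) · 1#         ≈⟨ ×1-homo-* x m ⟩
          (x · 1#) * (m · 1#)    ≈⟨ *-congˡ m·1≈0 ⟩
          (x · 1#) * 0#          ≈⟨ zeroʳ _ ⟩
          0#                     ∎) 1≉0
  ...   | Bézout.-+ x y eq = contradiction (begin
          1#                     ≈⟨ ×-homo-1 1# ⟨
          1 · 1#                 ≈⟨ +-identityʳ _ ⟨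
          1 · 1# + 0#            ≈⟨ +-congˡ (trans (×1-homo-* x m) (trans (*-congˡ m·1≈0) (zeroʳ _))) ⟨
          1 · 1# + (x ℕ.* m) · 1# ≈⟨ ×-homo-+ 1# 1 (x ℕ.* m) ⟨
          (1 ℕ.+ x ℕ.* m) · 1#   ≈⟨ ×-congˡ eq ⟩
          (y ℕ.* p) · 1#         ≈⟨ ∣⇒·≈0 1# (divides y ≡.refl) ⟩
          0#                     ∎) 1≉0

  private
    frobenius-suc : ∀ {m} x y → p ≡.≡ suc (suc m) → (x + y) ^ p ≈ x ^ p + y ^ p
    frobenius-suc {m} x y ≡.refl = begin
      (x + y) ^ p                                   ≈⟨ Binomial.theorem p x y ⟩
      sum term                                      ≈⟨ +-congˡ (sum-init-last (λ i → term (suc i))) ⟩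
      term zero + (sum (λ i → term (suc (inject₁ i))) + term (fromℕ p))
                                                    ≈⟨ +-cong first (+-cong (trans (sum-cong-≋ middle)
                                                          (sum-replicate-zero (suc m))) last) ⟩
      y ^ p + (0# + x ^ p)                          ≈⟨ +-congˡ (+-identityˡ _) ⟩
      y ^ p + x ^ p                                 ≈⟨ +-comm _ _ ⟩
      x ^ p + y ^ p                                 ∎
      where
      term = Binomial.binomialTerm x y p
      first : term zero ≈ y ^ p
      first = trans (×-homo-1 _) (*-identityˡ _)
      middle : ∀ i → term (suc (inject₁ i)) ≈ 0#
      middle i = ∣⇒·≈0 _ (prime∣C p-prime (ℕ.s≤s ℕ.z≤n)
        (ℕ.s≤s (≡.subst (ℕ._< suc m) (≡.sym (Fin.toℕ-inject₁ i)) (Fin.toℕ<n i))))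
      last : term (fromℕ p) ≈ x ^ p
      last = begin
        (p C toℕ (fromℕ p)) · (x ^ toℕ (fromℕ p) * y ^ (p ℕ.∸ toℕ (fromℕ p)))
          ≈⟨ reflexive (≡.cong (λ k → (p C k) · (x ^ k * y ^ (p ℕ.∸ k))) (Fin.toℕ-fromℕ p)) ⟩
        (p C p) · (x ^ p * y ^ (p ℕ.∸ p))  ≈⟨ reflexive (≡.cong₂ (λ d k → d · (x ^ p * y ^ k)) (nCn≡1 p) (ℕ.n∸n≡0
              p)) ⟩
        1 · (x ^ p * 1#)                   ≈⟨ ×-homo-1 _ ⟩
        x ^ p * 1#                         ≈⟨ *-identityʳ _ ⟩
        x ^ p                              ∎

    2+pred : ∀ m → .{{ℕ.NonTrivial m}} → m ≡.≡ suc (suc (m ℕ.∸ 2))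
    2+pred (suc (suc m)) = ≡.refl

  frobenius : ∀ i x y → (x + y) ^ (p ℕ.^ i) ≈ x ^ (p ℕ.^ i) + y ^ (p ℕ.^ i)
  frobenius zero    x y = trans (*-identityʳ _) (sym (+-cong (*-identityʳ x) (*-identityʳ y)))
  frobenius (suc i) x y = begin
    (x + y) ^ (p ℕ.* p ℕ.^ i)                      ≈⟨ ^-assocʳ _ p _ ⟨
    ((x + y) ^ p) ^ (p ℕ.^ i)                      ≈⟨ ^-congˡ (p ℕ.^ i) (frobenius-suc x y (2+pred p
          {{prime⇒nonTrivial p-prime}})) ⟩
    (x ^ p + y ^ p) ^ (p ℕ.^ i)                    ≈⟨ frobenius i _ _ ⟩
    (x ^ p) ^ (p ℕ.^ i) + (y ^ p) ^ (p ℕ.^ i)      ≈⟨ +-cong (^-assocʳ x p _) (^-assocʳ y p _) ⟩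
    x ^ (p ℕ.* p ℕ.^ i) + y ^ (p ℕ.* p ℕ.^ i)      ∎

  -- Deduced from additivity by adding y back, which avoids the sign (-1)^(p^i) and a separate case
  -- p = 2.
  frobenius-sub : ∀ i x y → (x - y) ^ (p ℕ.^ i) ≈ x ^ (p ℕ.^ i) - y ^ (p ℕ.^ i)
  frobenius-sub i x y = +-cancelʳ (y ^ P) _ _ (begin
    (x - y) ^ P + y ^ P         ≈⟨ frobenius i _ _ ⟨
    (x - y + y) ^ P             ≈⟨ ^-congˡ P (x-y+y≈x x y) ⟩
    x ^ P                       ≈⟨ x-y+y≈x _ _ ⟨
    x ^ P - y ^ P + y ^ P       ∎)
    where
    P = p ℕ.^ i

-- Sums over initial segments of ℕ.

module RangeSums {c ℓ₁ ℓ₂} (F : HeytingField c ℓ₁ ℓ₂) where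
  open import Data.Nat.Base as ℕ using (ℕ; zero; suc)
  import Data.Nat.Properties as ℕ
  import Data.Nat.DivMod as ℕ
  import Relation.Binary.PropositionalEquality as ≡
  open import Relation.Nullary using (¬_; yes; no)
  open FieldArithmetic F
  open import Algebra.Properties.CommutativeSemigroup +-commutativeSemigroup using (interchange)
  open import Relation.Binary.Reasoning.Setoid setoid

  ∑< : ℕ → (ℕ → Carrier) → Carrier
  ∑< zero    φ = 0#
  ∑< (suc k) φ = ∑< k φ + φ k

  ∑<-cong : ∀ k {φ ψ} → (∀ {i} → i ℕ.< k → φ i ≈ ψ i) → ∑< k φ ≈ ∑< k ψ
  ∑<-cong zero    φ≈ψ = refl
  ∑<-cong (suc k) φ≈ψ = +-cong (∑<-cong k (λ i<k → φ≈ψ (ℕ.m<n⇒m<1+n i<k))) (φ≈ψ ℕ.≤-refl)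

  ∑<-zero : ∀ k {φ} → (∀ {i} → i ℕ.< k → φ i ≈ 0#) → ∑< k φ ≈ 0#
  ∑<-zero zero    φ≈0 = refl
  ∑<-zero (suc k) φ≈0 = trans (+-cong (∑<-zero k (λ i<k → φ≈0 (ℕ.m<n⇒m<1+n i<k))) (φ≈0 ℕ.≤-refl)) (+-identityˡ 0#)

  ∑<-*ˡ : ∀ k x φ → ∑< k (λ i → x * φ i) ≈ x * ∑< k φ
  ∑<-*ˡ zero    x φ = sym (zeroʳ x)
  ∑<-*ˡ (suc k) x φ = trans (+-congʳ (∑<-*ˡ k x φ)) (sym (distribˡ x _ _))

  ∑<-*ʳ : ∀ k x φ → ∑< k (λ i → φ i * x) ≈ ∑< k φ * x
  ∑<-*ʳ zero    x φ = sym (zeroˡ x)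
  ∑<-*ʳ (suc k) x φ = trans (+-congʳ (∑<-*ʳ k x φ)) (sym (distribʳ x _ _))

  ∑<-single : ∀ k {i φ} → i ℕ.< k → (∀ {j} → j ℕ.< k → ¬ j ≡.≡ i → φ j ≈ 0#) → ∑< k φ ≈ φ i
  ∑<-single (suc k) {i} {φ} i<1+k φ≈0 with i ℕ.≟ k
  ... | yes ≡.refl = trans (+-congʳ (∑<-zero k (λ j<k → φ≈0 (ℕ.m<n⇒m<1+n j<k) (ℕ.<⇒≢ j<k)))) (+-identityˡ _)
  ... | no  i≢k    = trans
    (+-cong (∑<-single k (ℕ.≤∧≢⇒< (ℕ.s≤s⁻¹ i<1+k) i≢k) (λ j<k → φ≈0 (ℕ.m<n⇒m<1+n j<k)))
            (φ≈0 ℕ.≤-refl (λ k≡i → i≢k (≡.sym k≡i))))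
    (+-identityʳ _)

  ∑<-+ : ∀ m k φ → ∑< (m ℕ.+ k) φ ≈ ∑< m φ + ∑< k (λ i → φ (m ℕ.+ i))
  ∑<-+ m zero    φ = trans (reflexive (≡.cong (λ j → ∑< j φ) (ℕ.+-identityʳ m))) (sym (+-identityʳ _))
  ∑<-+ m (suc k) φ = begin
    ∑< (m ℕ.+ suc k) φ                                          ≡⟨ ≡.cong (λ j → ∑< j φ) (ℕ.+-suc m k) ⟩
    ∑< (m ℕ.+ k) φ + φ (m ℕ.+ k)                                ≈⟨ +-congʳ (∑<-+ m k φ) ⟩
    ∑< m φ + ∑< k (λ i → φ (m ℕ.+ i)) + φ (m ℕ.+ k)             ≈⟨ +-assoc _ _ _ ⟩
    ∑< m φ + ∑< (suc k) (λ i → φ (m ℕ.+ i))                     ∎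

  -- The map j ↦ (j mod P, j div P) enumerates all pairs, so a sum over j is a product of two sums.
  ∑<-blocks : ∀ A P .{{_ : ℕ.NonZero P}} φ ψ →
              ∑< (A ℕ.* P) (λ j → φ (j ℕ.% P) * ψ (j ℕ./ P)) ≈ ∑< P φ * ∑< A ψ
  ∑<-blocks zero    P φ ψ = sym (zeroʳ _)
  ∑<-blocks (suc A) P φ ψ = begin
    ∑< (P ℕ.+ A ℕ.* P) χ                             ≡⟨ ≡.cong (λ j → ∑< j χ) (ℕ.+-comm P (A ℕ.* P)) ⟩
    ∑< (A ℕ.* P ℕ.+ P) χ                             ≈⟨ ∑<-+ (A ℕ.* P) P χ ⟩
    ∑< (A ℕ.* P) χ + ∑< P (λ i → χ (A ℕ.* P ℕ.+ i))  ≈⟨ +-cong (∑<-blocks A P φ ψ) (∑<-cong P (λ {i} i<P →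
       reflexive (≡.cong₂ (λ u v → φ u * ψ v) (mod i<P) (div i<P)))) ⟩
    ∑< P φ * ∑< A ψ + ∑< P (λ i → φ i * ψ A)         ≈⟨ +-congˡ (∑<-*ʳ P (ψ A) φ) ⟩
    ∑< P φ * ∑< A ψ + ∑< P φ * ψ A                   ≈⟨ distribˡ _ _ _ ⟨
    ∑< P φ * ∑< (suc A) ψ                            ∎
    where
    χ : ℕ → Carrier
    χ j = φ (j ℕ.% P) * ψ (j ℕ./ P)
    mod : ∀ {i} → i ℕ.< P → (A ℕ.* P ℕ.+ i) ℕ.% P ≡.≡ i
    mod {i} i<P = ≡.trans (≡.cong (ℕ._% P) (ℕ.+-comm (A ℕ.* P) i))
      (≡.trans (ℕ.[m+kn]%n≡m%n i A P) (ℕ.m<n⇒m%n≡m i<P))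
    div : ∀ {i} → i ℕ.< P → (A ℕ.* P ℕ.+ i) ℕ./ P ≡.≡ A
    div {i} i<P = ≡.trans (ℕ.+-distrib-/-∣ˡ i (ℕ.n∣m*n A))
      (≡.trans (≡.cong₂ ℕ._+_ (ℕ.m*n/n≡m A P) (ℕ.m<n⇒m/n≡0 i<P)) (ℕ.+-identityʳ A))
      where import Data.Nat.Divisibility as ℕ

  geometricSum : ∀ k z → (1# - z) * ∑< k (z ^_) ≈ 1# - z ^ k
  geometricSum zero    z = trans (zeroʳ _) (sym (-‿inverseʳ 1#))
  geometricSum (suc k) z = begin
    (1# - z) * (∑< k (z ^_) + z ^ k)             ≈⟨ distribˡ _ _ _ ⟩
    (1# - z) * ∑< k (z ^_) + (1# - z) * z ^ k    ≈⟨ +-cong (geometricSum k z) (-‿one-* z (z ^ k)) ⟩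
    1# - z ^ k + (z ^ k - z * z ^ k)             ≈⟨ +-assoc _ _ _ ⟩
    1# + (- z ^ k + (z ^ k - z * z ^ k))         ≈⟨ +-congˡ (+-assoc _ _ _) ⟨
    1# + (- z ^ k + z ^ k - z * z ^ k)           ≈⟨ +-congˡ (+-congʳ (-‿inverseˡ _)) ⟩
    1# + (0# - z * z ^ k)                        ≈⟨ +-congˡ (+-identityˡ _) ⟩
    1# - z * z ^ k                               ∎

  -- A truncation of ∑ (i + 1) z^i = (1 - z)^(-2), multiplied by 1 - z. The boundary term
  -- `k · z ^ k` vanishes when p ∣ k, as it does in `twoBlocks`.
  geometricDerivative : ∀ k z → (1# - z) * ∑< k (λ i → suc i · z ^ i) ≈ ∑< k (z ^_) - k · z ^ k
  geometricDerivative zero    z = trans (zeroʳ _) (sym (-‿inverseʳ 0#))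
  geometricDerivative (suc k) z = begin
    (1# - z) * (S + suc k · zᵏ)                        ≈⟨ distribˡ _ _ _ ⟩
    (1# - z) * S + (1# - z) * (suc k · zᵏ)             ≈⟨ +-cong (geometricDerivative k z) (-‿one-* z _) ⟩
    (G - k · zᵏ) + ((zᵏ + k · zᵏ) - z * (suc k · zᵏ))  ≈⟨ +-assoc _ _ _ ⟨
    (G - k · zᵏ) + (zᵏ + k · zᵏ) - z * (suc k · zᵏ)    ≈⟨ +-cong (cancel G (k · zᵏ) zᵏ) (-‿cong (×-comm-* (suc k) z
          zᵏ)) ⟩
    G + zᵏ - suc k · (z * zᵏ)                          ∎
    where
    zᵏ = z ^ k
    S = ∑< k (λ i → suc i · z ^ i)
    G = ∑< k (z ^_)
    cancel : ∀ g x y → (g - x) + (y + x) ≈ g + y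
    cancel g x y = trans (interchange g (- x) y x) (trans (+-congˡ (-‿inverseˡ x)) (+-identityʳ _))

-- Explicit expansions of powers of 1 - η.

module BlockExpansions {c ℓ₁ ℓ₂} (F : HeytingField c ℓ₁ ℓ₂) {n} (order : FieldNotions.HasOrder F (ℕ.suc n))
                 {p s} (p-prime : Prime p) (n+1≡pˢ : ℕ.suc n ≡ p ℕ.^ s) where
  open import Data.Nat.Base as ℕ using (ℕ; zero; suc)
  import Data.Nat.Properties as ℕ
  import Data.Nat.DivMod as ℕ
  open import Data.Nat.Divisibility using (m∣m*n)
  import Relation.Binary.PropositionalEquality as ≡
  open import Relation.Nullary using (yes; no)
  open FieldArithmetic F
  open Decidable order
  open Frobenius F order {s = s} p-prime n+1≡pˢ
  open RangeSums F
  open import Relation.Binary.Reasoning.Setoid setoid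

  frobenius-1-‿ : ∀ i η → (1# - η) ^ (p ℕ.^ i) ≈ 1# - η ^ (p ℕ.^ i)
  frobenius-1-‿ i η = trans (frobenius-sub i 1# η) (+-congʳ (^-one (p ℕ.^ i)))

  pˢ⁺¹·x≈0 : ∀ i x → (p ℕ.^ suc i) · x ≈ 0#
  pˢ⁺¹·x≈0 i x = ∣⇒·≈0 x (m∣m*n (p ℕ.^ i))

  ∑<-1 : ∀ k → ∑< k (λ _ → 1#) ≈ k · 1#
  ∑<-1 zero    = refl
  ∑<-1 (suc k) = trans (+-congʳ (∑<-1 k)) (+-comm _ _)

  -- Divide (1 - η)^Q = 1 - η^Q by 1 - η. At η = 1 the left side is zero because N > 0, and the
  -- right side is Q · 1 = 0.
  oneBlock : ∀ i {Q N} → Q ≡ p ℕ.^ suc i → suc N ≡ Q → ∀ η → (1# - η) ^ N ≈ ∑< Q (η ^_)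
  oneBlock i {N = N} ≡.refl N+1≡Q η with η ≈? 1#
  ... | yes η≈1 = begin
    (1# - η) ^ N               ≈⟨ ^-congˡ N (trans (+-congˡ (-‿cong η≈1)) (-‿inverseʳ 1#)) ⟩
    0# ^ N                     ≈⟨ ^-zero N {{ℕ.>-nonZero 0<N}} ⟩
    0#                         ≈⟨ pˢ⁺¹·x≈0 i 1# ⟨
    (p ℕ.^ suc i) · 1#         ≈⟨ ∑<-1 (p ℕ.^ suc i) ⟨
    ∑< (p ℕ.^ suc i) (λ _ → 1#) ≈⟨ ∑<-cong (p ℕ.^ suc i) (λ {j} _ → trans (^-congˡ j η≈1) (^-one j)) ⟨
    ∑< (p ℕ.^ suc i) (η ^_)    ∎
    where
    open import Data.Nat.Primality using (prime⇒nonTrivial)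
    0<N : 0 ℕ.< N
    0<N = ℕ.s<s⁻¹ (≡.subst (1 ℕ.<_) (≡.sym N+1≡Q)
      (ℕ.<-≤-trans (ℕ.nonTrivial⇒n>1 p {{prime⇒nonTrivial p-prime}}) (ℕ.m≤m*n p (p ℕ.^ i) {{ℕ.m^n≢0 p i}})))
  ... | no η≉1 = *-cancelˡ (λ e → η≉1 (sym (x∙y⁻¹≈ε⇒x≈y 1# η e))) (begin
    (1# - η) ^ suc N                     ≈⟨ ^-congʳ (1# - η) N+1≡Q ⟩
    (1# - η) ^ (p ℕ.^ suc i)             ≈⟨ frobenius-1-‿ (suc i) η ⟩
    1# - η ^ (p ℕ.^ suc i)               ≈⟨ geometricSum (p ℕ.^ suc i) η ⟨
    (1# - η) * ∑< (p ℕ.^ suc i) (η ^_)   ∎)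

  private
    unblock : ∀ P .{{_ : ℕ.NonZero P}} η j → η ^ (j ℕ.% P) * (η ^ P) ^ (j ℕ./ P) ≈ η ^ j
    unblock P η j = begin
      η ^ (j ℕ.% P) * (η ^ P) ^ (j ℕ./ P)   ≈⟨ *-congˡ (trans (^-assocʳ η P (j ℕ./ P)) (^-congʳ η (ℕ.*-comm P (j
            ℕ./ P)))) ⟩
      η ^ (j ℕ.% P) * η ^ (j ℕ./ P ℕ.* P)   ≈⟨ ^-homo-* η (j ℕ.% P) _ ⟨
      η ^ (j ℕ.% P ℕ.+ j ℕ./ P ℕ.* P)       ≈⟨ ^-congʳ η (ℕ.m≡m%n+[m/n]*n j P) ⟨
      η ^ j                                 ∎

  -- The formal identity (1 - η)^(-1-P) = ∑ⱼ (⌊j/P⌋ + 1) η^j, truncated by (1 - η)^(AP) = 1 - η^(AP).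
  twoBlocks : ∀ i j {P A N} .{{_ : ℕ.NonZero P}} → P ≡ p ℕ.^ i → A ≡ p ℕ.^ suc j → 0 ℕ.< N → suc (N ℕ.+ P) ≡ A ℕ.*
        P ℕ.+ A ℕ.* P →
              ∀ η → (1# - η) ^ N ≈ (1# - η ^ (A ℕ.* P)) * ∑< (A ℕ.* P) (λ j → suc (j ℕ./ P) · η ^ j)
  twoBlocks i j {P} {A} {N} ≡.refl ≡.refl 0<N N≡ η with η ≈? 1#
  ... | yes η≈1 = begin
    (1# - η) ^ N               ≈⟨ ^-congˡ N (trans (+-congˡ (-‿cong η≈1)) (-‿inverseʳ 1#)) ⟩
    0# ^ N                     ≈⟨ ^-zero N {{ℕ.>-nonZero 0<N}} ⟩
    0#                         ≈⟨ *≈0 _ (trans (+-congˡ (-‿cong (trans (^-congˡ (A ℕ.* P) η≈1) (^-one (A ℕ.* P)))))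
          (-‿inverseʳ 1#)) ⟨
    _                          ∎
  ... | no η≉1 = *-cancelˡ (^-≉0 (suc P) (λ e → η≉1 (sym (x∙y⁻¹≈ε⇒x≈y 1# η e)))) (begin
    (1# - η) ^ suc P * (1# - η) ^ N                   ≈⟨ ^-homo-* (1# - η) (suc P) N ⟨
    (1# - η) ^ (suc P ℕ.+ N)                          ≈⟨ ^-congʳ (1# - η) (≡.trans (≡.cong suc (ℕ.+-comm P N)) N≡) ⟩
    (1# - η) ^ (A ℕ.* P ℕ.+ A ℕ.* P)                  ≈⟨ ^-homo-* (1# - η) (A ℕ.* P) (A ℕ.* P) ⟩
    (1# - η) ^ (A ℕ.* P) * (1# - η) ^ (A ℕ.* P)       ≈⟨ *-cong frobAP frobAP ⟩
    D * D                                             ≈⟨ *-congˡ inner ⟨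
    D * ((1# - η) ^ suc P * S)                        ≈⟨ *-assoc _ _ _ ⟨
    D * (1# - η) ^ suc P * S                          ≈⟨ *-congʳ (*-comm _ _) ⟩
    (1# - η) ^ suc P * D * S                          ≈⟨ *-assoc _ _ _ ⟩
    (1# - η) ^ suc P * (D * S)                        ∎)
    where
    D = 1# - η ^ (A ℕ.* P)
    S = ∑< (A ℕ.* P) (λ j → suc (j ℕ./ P) · η ^ j)
    z = η ^ P
    G = ∑< P (η ^_)
    H = ∑< A (λ i → suc i · z ^ i)
    frobAP : (1# - η) ^ (A ℕ.* P) ≈ D
    frobAP = trans (^-congʳ (1# - η) AP≡) (trans (frobenius-1-‿ (suc j ℕ.+ i) η) (+-congˡ (-‿cong (^-congʳ η (≡.sym
          AP≡)))))
      where AP≡ = ≡.sym (ℕ.^-distribˡ-+-* p (suc j) i)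
    S≈ : S ≈ G * H
    S≈ = begin
      S                                                                    ≈⟨ ∑<-cong (A ℕ.* P) (λ {j} _ → trans
            (×-comm-* (suc (j ℕ./ P)) _ _) (×-congʳ (suc (j ℕ./ P)) (unblock P η j))) ⟨
      ∑< (A ℕ.* P) (λ j → η ^ (j ℕ.% P) * (suc (j ℕ./ P) · z ^ (j ℕ./ P))) ≈⟨ ∑<-blocks A P (η ^_) _ ⟩
      G * H                                                                ∎
    -- By Frobenius (1 - η)^(1+P) = (1 - η)(1 - z). The factor 1 - η turns G into 1 - z, and the
    -- factor 1 - z turns H into a plain geometric sum because A · 1 = 0.
    inner : (1# - η) ^ suc P * S ≈ D
    inner = begin
      (1# - η) * (1# - η) ^ P * S          ≈⟨ *-cong (*-congˡ (frobenius-1-‿ i η)) S≈ ⟩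
      (1# - η) * (1# - z) * (G * H)        ≈⟨ interchange _ _ _ _ ⟩
      (1# - η) * G * ((1# - z) * H)        ≈⟨ *-cong (geometricSum P η) (geometricDerivative A z) ⟩
      (1# - z) * (∑< A (z ^_) - A · z ^ A) ≈⟨ *-congˡ (trans (+-congˡ (trans (-‿cong (pˢ⁺¹·x≈0 j _)) -0#≈0#))
            (+-identityʳ _)) ⟩
      (1# - z) * ∑< A (z ^_)               ≈⟨ geometricSum A z ⟩
      1# - z ^ A                           ≈⟨ +-congˡ (-‿cong (trans (^-assocʳ η P A) (^-congʳ η (ℕ.*-comm P A)))) ⟩
      D                                    ∎
      where open import Algebra.Properties.CommutativeSemigroup *-commutativeSemigroup using (interchange)

-- Hermite's criterion for the binomial, and the conditions on a and on gcd(r, q - 1).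

-- From here on the field has q^(e+1) elements with q = s + 1, so e is one less than in the theorem.
module BinomialMoments {c ℓ₁ ℓ₂} (F : HeytingField c ℓ₁ ℓ₂) {p k s e} (p-prime : Prime p)
                       (q≡p^k : ℕ.suc s ≡ p ℕ.^ ℕ.suc k) (1≤e : 1 ℕ.≤ e)
                       (order : FieldNotions.HasOrder F (ℕ.suc (s ℕ.* ℓ (ℕ.suc s) (ℕ.suc e)))) where
  open import Data.Nat.Base as ℕ using (ℕ; zero; suc)
  import Data.Nat.Properties as ℕ
  open import Data.Nat.Divisibility as ℕ using (_∣_; divides)
  open import Data.Nat.GCD using (gcd; gcd[m,n]∣m; gcd[m,n]∣n)
  open import Data.Nat.Primality using (prime⇒nonTrivial)
  open import Data.Nat.Tactic.RingSolver using (solve-∀)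
  open import Data.Product.Base using (_,_; proj₁; proj₂)
  open import Relation.Binary.Core using (_Preserves_⟶_)
  import Relation.Binary.PropositionalEquality as ≡
  open import Relation.Nullary using (¬_; yes; no; contradiction)
  open RepunitArithmetic

  q L H : ℕ
  q = suc s
  L = ℓ q (suc e)
  H = q ℕ.^ e

  |F|≡ : suc (s ℕ.* L) ≡ p ℕ.^ (suc k ℕ.* suc e)
  |F|≡ = ≡.trans (≡.sym (q^e≡1+sℓ s (suc e)))
    (≡.trans (≡.cong (ℕ._^ suc e) q≡p^k) (ℕ.^-*-assoc p (suc k) (suc e)))

  open FieldArithmetic F
  open Decidable order
  open PowerSums F order
  open Frobenius F order {s = suc k ℕ.* suc e} p-prime |F|≡
  open RangeSums F
  open import Relation.Binary.Reasoning.Setoid setoid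

  2≤q : 2 ℕ.≤ q
  2≤q = ≡.subst (2 ℕ.≤_) (≡.sym q≡p^k)
    (ℕ.≤-trans (ℕ.nonTrivial⇒n>1 p {{prime⇒nonTrivial p-prime}}) (ℕ.m≤m*n p (p ℕ.^ k) {{ℕ.m^n≢0 p k}}))

  instance
    s≢0 : ℕ.NonZero s
    s≢0 = ℕ.>-nonZero (ℕ.s≤s⁻¹ 2≤q)

    n≢0 : ℕ.NonZero (s ℕ.* L)
    n≢0 = ℕ.m*n≢0 s L

  H≤L : H ℕ.≤ L
  H≤L = ≡.subst (H ℕ.≤_) (≡.sym (ℓ-snoc q e)) (ℕ.m≤n+m H (ℓ q e))

  q^≡ : ∀ u → q ℕ.^ u ≡ p ℕ.^ (suc k ℕ.* u)
  q^≡ u = ≡.trans (≡.cong (ℕ._^ u) q≡p^k) (ℕ.^-*-assoc p (suc k) u)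

  module Moments {a} (a≉0 : ¬ a ≈ 0#) where

    -a≉0 : ¬ - a ≈ 0#
    -a≉0 e = a≉0 (trans (sym (-‿involutive a)) (trans (-‿cong e) -0#≈0#))

    γ : Carrier
    γ = proj₁ (inv -a≉0)

    -aγ≈1 : - a * γ ≈ 1#
    -aγ≈1 = proj₂ (inv -a≉0)

    γ≉0 : ¬ γ ≈ 0#
    γ≉0 e = 1≉0 (trans (sym -aγ≈1) (trans (*-congˡ e) (zeroʳ _)))

    η : Carrier → Carrier
    η x = γ * x ^ s

    f-η : ∀ r x → f q r a x ≈ x ^ r * (a * (1# - η x))
    f-η r x = *-congˡ (begin
      x ^ s + a                     ≈⟨ +-comm _ _ ⟩
      a + x ^ s                     ≈⟨ +-cong (*-identityʳ a) (*-identityˡ _) ⟨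
      a * 1# + 1# * x ^ s           ≈⟨ +-congˡ (*-congʳ -aγ≈1) ⟨
      a * 1# + - a * γ * x ^ s      ≈⟨ +-congˡ (*-assoc _ _ _) ⟩
      a * 1# + - a * η x            ≈⟨ +-congˡ (trans (sym (-‿distribˡ-* _ _)) (-‿distribʳ-* _ _)) ⟩
      a * 1# + a * - η x            ≈⟨ distribˡ _ _ _ ⟨
      a * (1# - η x)                ∎)

    f-cong : ∀ r → f q r a Preserves _≈_ ⟶ _≈_
    f-cong r e = *-cong (^-congˡ r e) (+-congʳ (^-congˡ s e))

    opaque
      -- For R = rM and φ(y) = (1 - y)^(sM) this is ∑ f(x)^(sM) up to the factor a^(sM). With the
      -- exponent of x a multiple of s, divisibility by n = sL becomes divisibility of R + m by L.
      moment : ℕ → (Carrier → Carrier) → Carrier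
      moment R φ = ∑F (λ x → x ^ (s ℕ.* R) * φ (η x))

    opaque
      unfolding moment

      moment-cong : ∀ R {φ ψ} → (∀ y → φ y ≈ ψ y) → moment R φ ≈ moment R ψ
      moment-cong R φ≈ψ = ∑F-cong (λ x → *-congˡ (φ≈ψ (η x)))

      moment-+ : ∀ R φ ψ → moment R (λ y → φ y + ψ y) ≈ moment R φ + moment R ψ
      moment-+ R φ ψ = trans (∑F-cong (λ x → distribˡ (x ^ (s ℕ.* R)) _ _)) (∑F-+ _ (λ x → x ^ (s ℕ.* R) * ψ (η x)))

      moment-* : ∀ R b φ → moment R (λ y → b * φ y) ≈ b * moment R φ
      moment-* R b φ = trans (∑F-cong (λ x → x∙yz≈y∙xz (x ^ (s ℕ.* R)) b _)) (∑F-* b (λ x → x ^ (s ℕ.* R) * φ (η x)))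
        where open import Algebra.Properties.CommutativeSemigroup *-commutativeSemigroup using (x∙yz≈y∙xz)

      moment-^ : ∀ R m → moment R (_^ m) ≈ γ ^ m * ∑F (_^ (s ℕ.* (R ℕ.+ m)))
      moment-^ R m = trans (∑F-cong (λ x → begin
        x ^ (s ℕ.* R) * (γ * x ^ s) ^ m           ≈⟨ *-congˡ (^-distrib-* γ (x ^ s) m) ⟩
        x ^ (s ℕ.* R) * (γ ^ m * (x ^ s) ^ m)     ≈⟨ x∙yz≈y∙xz _ _ _ ⟩
        γ ^ m * (x ^ (s ℕ.* R) * (x ^ s) ^ m)     ≈⟨ *-congˡ (*-congˡ (^-assocʳ x s m)) ⟩
        γ ^ m * (x ^ (s ℕ.* R) * x ^ (s ℕ.* m))   ≈⟨ *-congˡ (^-homo-* x (s ℕ.* R) _) ⟨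
        γ ^ m * x ^ (s ℕ.* R ℕ.+ s ℕ.* m)         ≈⟨ *-congˡ (^-congʳ x (ℕ.*-distribˡ-+ s R m)) ⟨
        γ ^ m * x ^ (s ℕ.* (R ℕ.+ m))             ∎)) (∑F-* (γ ^ m) (_^ (s ℕ.* (R ℕ.+ m))))
        where open import Algebra.Properties.CommutativeSemigroup *-commutativeSemigroup using (x∙yz≈y∙xz)

      moment-zero : ∀ R {φ} → (∀ x → x ^ (s ℕ.* R) * φ (η x) ≈ 0#) → moment R φ ≈ 0#
      moment-zero R {φ} φ≈0 = begin
        ∑F (λ x → x ^ (s ℕ.* R) * φ (η x)) ≈⟨ ∑F-cong (λ x → trans (φ≈0 x) (sym (zeroˡ 0#))) ⟩
        ∑F (λ x → 0# * 0#)            ≈⟨ ∑F-* 0# (λ _ → 0#) ⟩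
        0# * ∑F (λ _ → 0#)            ≈⟨ zeroˡ _ ⟩
        0#                            ∎

    moment-∑< : ∀ R K (b : ℕ → Carrier) (φ : ℕ → Carrier → Carrier) →
                moment R (λ y → ∑< K (λ j → b j * φ j y)) ≈ ∑< K (λ j → b j * moment R (φ j))
    moment-∑< R zero    b φ = moment-zero R (λ x → zeroʳ _)
    moment-∑< R (suc K) b φ =
      trans (moment-+ R (λ y → ∑< K (λ j → b j * φ j y)) (λ y → b K * φ K y)) (+-cong (moment-∑< R K b φ) (moment-*
            R (b K) (φ K)))

    moment-∣ : ∀ {R m} → 0 ℕ.< R → L ∣ R ℕ.+ m → moment R (_^ m) ≈ - γ ^ m
    moment-∣ {R} {m} 0<R L∣ = begin
      moment R (_^ m)                           ≈⟨ moment-^ R m ⟩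
      γ ^ m * ∑F (_^ (s ℕ.* (R ℕ.+ m)))         ≈⟨ *-congˡ (powerSum-∣ (ℕ.*-mono-≤ (ℕ.s≤s⁻¹ 2≤q) (ℕ.≤-trans 0<R
            (ℕ.m≤m+n R m))) (ℕ.*-monoʳ-∣ s L∣)) ⟩
      γ ^ m * - 1#                              ≈⟨ -‿distribʳ-* _ _ ⟨
      - (γ ^ m * 1#)                            ≈⟨ -‿cong (*-identityʳ _) ⟩
      - γ ^ m                                   ∎

    moment-∤ : ∀ {R m} → ¬ L ∣ R ℕ.+ m → moment R (_^ m) ≈ 0#
    moment-∤ {R} {m} L∤ = begin
      moment R (_^ m)                           ≈⟨ moment-^ R m ⟩
      γ ^ m * ∑F (_^ (s ℕ.* (R ℕ.+ m)))         ≈⟨ *-congˡ (powerSum-∤ (λ d → L∤ (ℕ.*-cancelˡ-∣ s d))) ⟩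
      γ ^ m * 0#                                ≈⟨ zeroʳ _ ⟩
      0#                                        ∎

    moment-single : ∀ {R} (b : ℕ → Carrier) (ε : ℕ → ℕ) {K i} → 0 ℕ.< R → i ℕ.< K → L ∣ R ℕ.+ ε i →
                    (∀ {j} → j ℕ.< K → L ∣ R ℕ.+ ε j → j ≡ i) →
                    moment R (λ y → ∑< K (λ j → b j * y ^ ε j)) ≈ - (b i * γ ^ ε i)
    moment-single {R} b ε {K} {i} 0<R i<K L∣ unique = begin
      moment R (λ y → ∑< K (λ j → b j * y ^ ε j))    ≈⟨ moment-∑< R K b (λ j y → y ^ ε j) ⟩
      ∑< K (λ j → b j * moment R (_^ ε j))           ≈⟨ ∑<-single K i<K (λ j<K j≢i →
                                                          trans (*-congˡ (moment-∤ (λ d → j≢i (unique j<K d))))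
                                                                (zeroʳ _)) ⟩
      b i * moment R (_^ ε i)                        ≈⟨ *-congˡ (moment-∣ 0<R L∣) ⟩
      b i * - γ ^ ε i                                ≈⟨ -‿distribʳ-* _ _ ⟨
      - (b i * γ ^ ε i)                              ∎

    moment-none : ∀ {R} (b : ℕ → Carrier) (ε : ℕ → ℕ) {K} → (∀ {j} → j ℕ.< K → ¬ L ∣ R ℕ.+ ε j) →
                  moment R (λ y → ∑< K (λ j → b j * y ^ ε j)) ≈ 0#
    moment-none {R} b ε {K} none = trans (moment-∑< R K b (λ j y → y ^ ε j))
      (∑<-zero K (λ j<K → trans (*-congˡ (moment-∤ (none j<K))) (zeroʳ _)))

    module _ {r} (1≤r : 1 ℕ.≤ r) (permutes : Permutes (f q r a)) where

      f0≈0 : f q r a 0# ≈ 0#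
      f0≈0 = *≈0 _ (^-zero r {{ℕ.>-nonZero 1≤r}})

      opaque
        unfolding moment

        -- Since f permutes the field, ∑ f(x)^(sM) is the power sum with exponent sM, which lies
        -- strictly between 0 and n. The factor a^(sM) is then cancelled.
        hermite : ∀ {M} → 0 ℕ.< M → M ℕ.< L → moment (r ℕ.* M) (λ y → (1# - y) ^ (s ℕ.* M)) ≈ 0#
        hermite {M} 0<M M<L = xy≈0⇒y≈0 (^-≉0 N a≉0) (begin
          a ^ N * moment (r ℕ.* M) (λ y → (1# - y) ^ N)  ≈⟨ ∑F-* (a ^ N) (λ x → x ^ (s ℕ.* (r ℕ.* M)) * (1# - η x)
                ^ N) ⟨
          ∑F (λ x → a ^ N * (x ^ (s ℕ.* (r ℕ.* M)) * (1# - η x) ^ N)) ≈⟨ ∑F-cong fᴺ ⟨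
          ∑F (λ x → f q r a x ^ N)                       ≈⟨ ∑F-reindex (f-cong r) permutes (_^ N) (^-congˡ N) ⟩
          ∑F (_^ N)                                      ≈⟨ powerSum-∤ (λ d → ℕ.<⇒≱ (ℕ.*-monoʳ-< s M<L) (ℕ.∣⇒≤
                {{ℕ.m*n≢0 s M {{s≢0}} {{ℕ.>-nonZero 0<M}}}} d)) ⟩
          0#                                             ∎)
          where
          N : ℕ
          N = s ℕ.* M
          exponent : ∀ r s M → r ℕ.* (s ℕ.* M) ≡ s ℕ.* (r ℕ.* M)
          exponent = solve-∀
          fᴺ : ∀ x → f q r a x ^ N ≈ a ^ N * (x ^ (s ℕ.* (r ℕ.* M)) * (1# - η x) ^ N)
          fᴺ x = begin
            f q r a x ^ N                             ≈⟨ ^-congˡ N (f-η r x) ⟩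
            (x ^ r * (a * (1# - η x))) ^ N            ≈⟨ ^-distrib-* _ _ N ⟩
            (x ^ r) ^ N * (a * (1# - η x)) ^ N        ≈⟨ *-cong (trans (^-assocʳ x r N) (^-congʳ x (exponent r s
                  M))) (^-distrib-* a _ N) ⟩
            x ^ (s ℕ.* (r ℕ.* M)) * (a ^ N * (1# - η x) ^ N) ≈⟨ x∙yz≈y∙xz _ _ _ ⟩
            a ^ N * (x ^ (s ℕ.* (r ℕ.* M)) * (1# - η x) ^ N) ∎
            where open import Algebra.Properties.CommutativeSemigroup *-commutativeSemigroup using (x∙yz≈y∙xz)

      0<r*M : ∀ {M} → 0 ℕ.< M → 0 ℕ.< r ℕ.* M
      0<r*M = ℕ.*-mono-≤ 1≤r

      -- If η = γ x^(q-1) ≠ 1 for all x, then ∑_{j<L} η^j vanishes for x ≠ 0 as soon as γ^L = 1,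
      -- but its sum over all x ≠ 0 is -1.
      γ^L≉1 : ¬ γ ^ L ≈ 1#
      γ^L≉1 γᴸ≈1 = 1≉0 (begin
        1#                                                   ≈⟨ -‿involutive 1# ⟨
        - (- 1#)                                             ≈⟨ -‿cong (-‿cong (*-identityˡ 1#)) ⟨
        - (- (1# * γ ^ 0))                                   ≈⟨ -‿cong (moment-single (λ _ → 1#) (λ j → j) {i = 0}
              0<L 0<L
                                                                  (divides 1 (≡.trans (ℕ.+-identityʳ L) (≡.sym
                                                                        (ℕ.+-identityʳ L)))) unique) ⟨
        - moment L (λ y → ∑< L (λ j → 1# * y ^ j))           ≈⟨ -‿cong (moment-zero L vanish) ⟩
        - 0#                                                 ≈⟨ -0#≈0# ⟩
        0#                                                   ∎)
        where
        0<L : 0 ℕ.< L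
        0<L = ℕ.s≤s ℕ.z≤n
        unique : ∀ {j} → j ℕ.< L → L ∣ L ℕ.+ j → j ≡ 0
        unique {zero}  _   _ = ≡.refl
        unique {suc j} j<L d = contradiction (ℕ.∣⇒≤ (ℕ.∣m+n∣m⇒∣n d ℕ.∣-refl)) (ℕ.<⇒≱ j<L)
        vanish : ∀ x → x ^ (s ℕ.* L) * ∑< L (λ j → 1# * η x ^ j) ≈ 0#
        vanish x with x ≈? 0#
        ... | yes x≈0 = (*≈0 _ (trans (^-congˡ (s ℕ.* L) x≈0) (^-zero (s ℕ.* L))))
        ... | no x≉0 = begin
          x ^ (s ℕ.* L) * ∑< L (λ j → 1# * η x ^ j)  ≈⟨ *-congˡ (∑<-cong L (λ _ → *-identityˡ _)) ⟩
          x ^ (s ℕ.* L) * ∑< L (η x ^_)              ≈⟨ *-congˡ (xy≈0⇒y≈0 1-η≉0 (begin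
            (1# - η x) * ∑< L (η x ^_)                  ≈⟨ geometricSum L (η x) ⟩
            1# - η x ^ L                                ≈⟨ +-congˡ (-‿cong ηᴸ≈1) ⟩
            1# - 1#                                     ≈⟨ -‿inverseʳ 1# ⟩
            0#                                          ∎)) ⟩
          x ^ (s ℕ.* L) * 0#                         ≈⟨ zeroʳ _ ⟩
          0#                                         ∎
          where
          ηᴸ≈1 : η x ^ L ≈ 1#
          ηᴸ≈1 = begin
            (γ * x ^ s) ^ L          ≈⟨ ^-distrib-* γ _ L ⟩
            γ ^ L * (x ^ s) ^ L      ≈⟨ *-cong γᴸ≈1 (trans (^-assocʳ x s L) (fermat x≉0)) ⟩
            1# * 1#                  ≈⟨ *-identityˡ 1# ⟩
            1#                       ∎
          1-η≉0 : ¬ 1# - η x ≈ 0#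
          1-η≉0 e = x≉0 (proj₁ permutes (trans (trans (f-η r x) (trans (*-congˡ (trans (*-congˡ e) (zeroʳ a)))
                (zeroʳ _))) (sym f0≈0)))

      [-a]^L≉1 : ¬ (- a) ^ L ≈ 1#
      [-a]^L≉1 αᴸ≈1 = γ^L≉1 (begin
        γ ^ L                 ≈⟨ *-identityˡ _ ⟨
        1# * γ ^ L            ≈⟨ *-congʳ αᴸ≈1 ⟨
        (- a) ^ L * γ ^ L     ≈⟨ ^-distrib-* _ _ L ⟨
        (- a * γ) ^ L         ≈⟨ ^-congˡ L -aγ≈1 ⟩
        1# ^ L                ≈⟨ ^-one L ⟩
        1#                    ∎)

      -- A common divisor d ≥ 2 would give ζ = b^(n/d) ≠ 1 with ζ^d = 1. Then ζ^r = ζ^s = 1, so f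
      -- takes the same value at ζ and at 1.
      gcd≡1 : gcd r s ≡ 1
      gcd≡1 with gcd r s in d≡ | gcd[m,n]∣m r s | gcd[m,n]∣n r s
      ... | 0 | _ | divides t s≡ = contradiction (≡.trans s≡ (ℕ.*-zeroʳ t)) (ℕ.≢-nonZero⁻¹ s)
      ... | 1 | _ | _ = ≡.refl
      ... | d@(suc (suc _)) | divides u r≡ud | divides t s≡td = contradiction ζ≈1 ζ≉1
        where
        t≢0 : ¬ t ≡ 0
        t≢0 t≡0 = ℕ.≢-nonZero⁻¹ s (≡.trans s≡td (≡.cong (ℕ._* d) t≡0))
        m = t ℕ.* L
        instance
          m≢0 : ℕ.NonZero m
          m≢0 = ℕ.m*n≢0 t L {{ℕ.≢-nonZero t≢0}}
        md≡n : m ℕ.* d ≡ s ℕ.* L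
        md≡n = ≡.trans (lemma t L d) (≡.cong (ℕ._* L) (≡.sym s≡td))
          where
          lemma : ∀ t L d → t ℕ.* L ℕ.* d ≡ t ℕ.* d ℕ.* L
          lemma = solve-∀
        witness = ^≉1 {m} (ℕ.>-nonZero⁻¹ m) (≡.subst (m ℕ.<_) md≡n (ℕ.m<m*n m d (ℕ.s≤s (ℕ.s≤s ℕ.z≤n))))
        b = proj₁ witness
        ζ = b ^ m
        ζ≉1 : ¬ ζ ≈ 1#
        ζ≉1 = proj₂ (proj₂ witness)
        ζᵈ≈1 : ζ ^ d ≈ 1#
        ζᵈ≈1 = trans (^-assocʳ b m d) (trans (^-congʳ b md≡n) (fermat (proj₁ (proj₂ witness))))
        ζ^≈1 : ∀ {v m} → m ≡ v ℕ.* d → ζ ^ m ≈ 1# ^ m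
        ζ^≈1 {v} {m} m≡ = trans (^-congʳ ζ (≡.trans m≡ (ℕ.*-comm v d))) (trans (^≈1-* d v ζᵈ≈1) (sym (^-one m)))
        ζ≈1 : ζ ≈ 1#
        ζ≈1 = proj₁ permutes (*-cong (ζ^≈1 {u} r≡ud) (+-congʳ (ζ^≈1 {t} s≡td)))

-- Coefficients that a permutation forces to vanish.

module VanishingCoefficients {c ℓ₁ ℓ₂} (F : HeytingField c ℓ₁ ℓ₂) {p k s e} (p-prime : Prime p)
         (q≡p^k : ℕ.suc s ≡ p ℕ.^ ℕ.suc k) (1≤e : 1 ℕ.≤ e)
         (order : FieldNotions.HasOrder F (ℕ.suc (s ℕ.* ℓ (ℕ.suc s) (ℕ.suc e))))
         {a : HeytingField.Carrier F} (a≉0 : ¬ HeytingField._≈_ F a (HeytingField.0# F)) {r} (1≤r : 1 ℕ.≤ r)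
         (permutes : FieldNotions.Permutes F (FieldNotions.f F (ℕ.suc s) r a)) where
  open import Data.Nat.Base as ℕ using (ℕ; suc)
  import Data.Nat.Properties as ℕ
  import Data.Nat.DivMod as ℕ
  open import Data.Nat.Divisibility as ℕ using (_∣_; divides)
  open import Data.Nat.Tactic.RingSolver using (solve-∀)
  open import Data.Product.Base using (_,_; proj₂)
  open import Relation.Binary.Definitions using (tri<; tri≈; tri>)
  import Relation.Binary.PropositionalEquality as ≡
  open import Relation.Nullary using (yes; no; contradiction)
  open RepunitArithmetic
  open BinomialMoments F {k = k} {e = e} p-prime q≡p^k 1≤e order
  open FieldArithmetic F
  open Decidable order
  open BlockExpansions F order {s = suc k ℕ.* suc e} p-prime |F|≡
  open RangeSums F
  open Moments a≉0
  open import Relation.Binary.Reasoning.Setoid setoid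

  1≤ℓ : ∀ {d} → 1 ℕ.≤ d → 1 ℕ.≤ ℓ q d
  1≤ℓ {d} = ℓ>0 q d

  0<H : 0 ℕ.< H
  0<H = ℕ.m^n>0 q e

  ℓ<L : ∀ {d} → d ℕ.≤ e → ℓ q d ℕ.< L
  ℓ<L {d} d≤e = ℕ.<-≤-trans (ℕ.m<m+n (ℓ q d) 0<H)
    (ℕ.≤-trans (ℕ.+-monoˡ-≤ H (ℓ-mono-≤ q d≤e)) (ℕ.≤-reflexive (≡.sym (ℓ-snoc q e))))

  q^-mono : ∀ {d} → d ℕ.≤ e → q ℕ.^ d ℕ.≤ H
  q^-mono = ℕ.^-monoʳ-≤ q

  -x≈0⇒x≈0 : ∀ {x} → - x ≈ 0# → x ≈ 0#
  -x≈0⇒x≈0 e = trans (sym (-‿involutive _)) (trans (-‿cong e) -0#≈0#)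

  coefficient≈0 : ∀ {M K} (b : ℕ → Carrier) (ε : ℕ → ℕ) → 0 ℕ.< M → M ℕ.< L →
                  (∀ y → (1# - y) ^ (s ℕ.* M) ≈ ∑< K (λ j → b j * y ^ ε j)) →
                  ∀ {i} → i ℕ.< K → L ∣ r ℕ.* M ℕ.+ ε i →
                  (∀ {j} → j ℕ.< K → L ∣ r ℕ.* M ℕ.+ ε j → j ≡ i) → b i ≈ 0#
  coefficient≈0 {M} {K} b ε 0<M M<L expansion {i} i<K L∣ unique =
    xy≈0⇒y≈0 (^-≉0 (ε i) γ≉0) (trans (*-comm _ _) (-x≈0⇒x≈0 (begin
      - (b i * γ ^ ε i)                                      ≈⟨ moment-single b ε (0<r*M 1≤r permutes 0<M) i<K L∣
            unique ⟨
      moment (r ℕ.* M) (λ y → ∑< K (λ j → b j * y ^ ε j))    ≈⟨ moment-cong (r ℕ.* M) expansion ⟨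
      moment (r ℕ.* M) (λ y → (1# - y) ^ (s ℕ.* M))          ≈⟨ hermite 1≤r permutes 0<M M<L ⟩
      0#                                                     ∎)))

  private
    close : ∀ x {i j} → i ℕ.< j ℕ.+ L → j ℕ.< i ℕ.+ L → L ∣ x ℕ.+ i → L ∣ x ℕ.+ j → j ≡ i
    close x {i} {j} i<j+L j<i+L L∣i L∣j with ℕ.<-cmp i j
    ... | tri< i<j _ _ = contradiction j<i+L (∣-gap L∣i L∣j i<j)
    ... | tri≈ _ i≡j _ = ≡.sym i≡j
    ... | tri> _ _ j<i = contradiction i<j+L (∣-gap L∣j L∣i j<i)

  -- Here sM = q^d - 1. As q^d ≤ L, at most one of the exponents below q^d survives; it would have
  -- coefficient 1, which cannot vanish.
  noSmallResidue : ∀ {d m} → 1 ℕ.≤ d → d ℕ.≤ e → m ℕ.< q ℕ.^ d → ¬ L ∣ r ℕ.* ℓ q d ℕ.+ m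
  noSmallResidue {suc d} {m} 1≤d d≤e m<Q L∣ =
    1≉0 (coefficient≈0 (λ _ → 1#) (λ j → j) (1≤ℓ 1≤d) (ℓ<L d≤e)
      (λ y → trans (oneBlock (d ℕ.+ k ℕ.* suc d) (q^≡ (suc d)) (≡.sym (q^e≡1+sℓ s (suc d))) y)
                   (∑<-cong (q ℕ.^ suc d) (λ _ → sym (*-identityˡ _))))
      m<Q L∣ (λ j<Q → close (r ℕ.* ℓ q (suc d)) (near m<Q) (near j<Q) L∣))
    where
    near : ∀ {i j} → i ℕ.< q ℕ.^ suc d → i ℕ.< j ℕ.+ L
    near {i} {j} i<Q = ℕ.<-≤-trans i<Q (ℕ.≤-trans (q^-mono d≤e) (ℕ.≤-trans H≤L (ℕ.m≤n+m L j)))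

  -- M is the solution of (q - 1) M = 2 q^e - q^u - 1, written without subtraction.
  module TwoBlocks (u v : ℕ) (u+1+v≡e : u ℕ.+ suc v ≡ e) {M} (M≡ : M ℕ.+ ℓ q u ≡ ℓ q e ℕ.+ ℓ q e) where
    P A R : ℕ
    P = q ℕ.^ u
    A = q ℕ.^ suc v
    R = r ℕ.* M

    instance
      P≢0 : ℕ.NonZero P
      P≢0 = ℕ.m^n≢0 q u

    coeff : ℕ → Carrier
    coeff j = suc (j ℕ./ P) · 1#

    private
      AP≡H : A ℕ.* P ≡ H
      AP≡H = ≡.trans (≡.sym (ℕ.^-distribˡ-+-* q (suc v) u)) (≡.cong (q ℕ.^_) (≡.trans (ℕ.+-comm (suc v) u) u+1+v≡e))

      u≤e : u ℕ.≤ e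
      u≤e = ℕ.≤-trans (ℕ.m≤m+n u (suc v)) (ℕ.≤-reflexive u+1+v≡e)

      ℓe≤M : ℓ q e ℕ.≤ M
      ℓe≤M = ℕ.+-cancelʳ-≤ (ℓ q u) (ℓ q e) M
        (ℕ.≤-trans (ℕ.+-monoʳ-≤ (ℓ q e) (ℓ-mono-≤ q u≤e)) (ℕ.≤-reflexive (≡.sym M≡)))

      0<M : 0 ℕ.< M
      0<M = ℕ.≤-trans (1≤ℓ 1≤e) ℓe≤M

      M<L : M ℕ.< L
      M<L = ℕ.≤-trans (ℕ.s≤s (ℕ.≤-trans (ℕ.m≤m+n M (ℓ q u)) (ℕ.≤-trans (ℕ.≤-reflexive M≡)
        (ℕ.≤-trans (ℕ.≤-reflexive (≡.cong (ℓ q e ℕ.+_) (≡.sym (ℕ.+-identityʳ (ℓ q e))))) (ℕ.*-monoˡ-≤ (ℓ q e) 2≤q)))))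
        (ℕ.≤-reflexive (≡.sym (ℓ-suc q e)))

      N≡ : suc (s ℕ.* M ℕ.+ P) ≡ A ℕ.* P ℕ.+ A ℕ.* P
      N≡ = ≡.trans (≡.cong (λ x → suc (s ℕ.* M ℕ.+ x)) (q^e≡1+sℓ s u)) (≡.trans (≡.trans (lemma s M (ℓ q u))
        (≡.trans (≡.cong (λ x → 2 ℕ.+ s ℕ.* x) M≡) (lemma′ s (ℓ q e))))
        (≡.cong₂ ℕ._+_ (≡.trans (≡.sym (q^e≡1+sℓ s e)) (≡.sym AP≡H)) (≡.trans (≡.sym (q^e≡1+sℓ s e)) (≡.sym AP≡H))))
        where
        lemma : ∀ s M l → suc (s ℕ.* M ℕ.+ suc (s ℕ.* l)) ≡ 2 ℕ.+ s ℕ.* (M ℕ.+ l)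
        lemma = solve-∀
        lemma′ : ∀ s l → 2 ℕ.+ s ℕ.* (l ℕ.+ l) ≡ suc (s ℕ.* l) ℕ.+ suc (s ℕ.* l)
        lemma′ = solve-∀

    lowMoment highMoment : Carrier
    lowMoment  = moment R (λ y → ∑< H (λ j → coeff j * y ^ j))
    highMoment = moment R (λ y → ∑< H (λ j → coeff j * y ^ (H ℕ.+ j)))

    -- The expansion is low(y) - y^H low(y), and Hermite's criterion annihilates its moment. The two
    -- halves are compared as an equation so that their opposite signs disappear.
    low≈high : lowMoment ≈ highMoment
    low≈high = begin
      lowMoment                                             ≈⟨ moment-cong R split ⟩
      moment R (λ y → (1# - y) ^ N + high y)                ≈⟨ moment-+ R (λ y → (1# - y) ^ N) high ⟩
      moment R (λ y → (1# - y) ^ N) + highMoment            ≈⟨ +-congʳ (hermite 1≤r permutes 0<M M<L) ⟩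
      0# + highMoment                                       ≈⟨ +-identityˡ _ ⟩
      highMoment                                            ∎
      where
      N = s ℕ.* M
      low high : Carrier → Carrier
      low  y = ∑< H (λ j → coeff j * y ^ j)
      high y = ∑< H (λ j → coeff j * y ^ (H ℕ.+ j))
      high≈ : ∀ y → high y ≈ y ^ H * low y
      high≈ y = trans (∑<-cong H (λ {j} _ → trans (*-congˡ (^-homo-* y H j)) (x∙yz≈y∙xz (coeff j) _ _))) (∑<-*ˡ H
            (y ^ H) _)
        where open import Algebra.Properties.CommutativeSemigroup *-commutativeSemigroup using (x∙yz≈y∙xz)
      expansion : ∀ y → (1# - y) ^ N ≈ (1# - y ^ H) * low y
      expansion y = trans
        (≡.subst (λ h → (1# - y) ^ N ≈ (1# - y ^ h) * ∑< h (λ j → suc (j ℕ./ P) · y ^ j)) AP≡H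
          (twoBlocks (suc k ℕ.* u) (v ℕ.+ k ℕ.* suc v) (q^≡ u) (q^≡ (suc v)) (ℕ.*-mono-≤ (ℕ.s≤s⁻¹ 2≤q) 0<M) N≡ y))
        (*-congˡ (∑<-cong H (λ {j} _ → sym (×1-* (suc (j ℕ./ P)) (y ^ j)))))
      split : ∀ y → low y ≈ (1# - y) ^ N + high y
      split y = sym (begin
        (1# - y) ^ N + high y                       ≈⟨ +-cong (trans (expansion y) (-‿one-* _ _)) (high≈ y) ⟩
        low y - y ^ H * low y + y ^ H * low y       ≈⟨ +-assoc _ _ _ ⟩
        low y + (- (y ^ H * low y) + y ^ H * low y) ≈⟨ +-congˡ (-‿inverseˡ _) ⟩
        low y + 0#                                  ≈⟨ +-identityʳ _ ⟩
        low y                                       ∎)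

    private
      0<R : 0 ℕ.< R
      0<R = 0<r*M 1≤r permutes 0<M

      single : ∀ o {i} → i ℕ.< H → L ∣ R ℕ.+ (o ℕ.+ i) →
               moment R (λ y → ∑< H (λ j → coeff j * y ^ (o ℕ.+ j))) ≈ - (coeff i * γ ^ (o ℕ.+ i))
      single o {i} i<H L∣ = moment-single coeff (o ℕ.+_) 0<R i<H L∣ λ {j} j<H L∣j →
        ℕ.+-cancelˡ-≡ o j i (close R (near i<H) (near j<H) L∣ L∣j)
        where
        near : ∀ {i j} → i ℕ.< H → o ℕ.+ i ℕ.< o ℕ.+ j ℕ.+ L
        near {i} {j} i<H = ≡.subst (o ℕ.+ i ℕ.<_) (≡.sym (ℕ.+-assoc o j L))
          (ℕ.+-monoʳ-< o (ℕ.<-≤-trans i<H (ℕ.≤-trans H≤L (ℕ.m≤n+m L j))))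

      -- Adding H = AP to j adds A to the quotient, and p ∣ A. So `coeff` also describes, up to
      -- sign, the coefficients of the upper half.
      coeff-H+ : ∀ i → coeff (H ℕ.+ i) ≈ coeff i
      coeff-H+ i = begin
        suc ((H ℕ.+ i) ℕ./ P) · 1#                ≈⟨ ×-congˡ (≡.cong suc div) ⟩
        (suc (A ℕ.+ i ℕ./ P)) · 1#                ≈⟨ +-congˡ (×-homo-+ 1# A (i ℕ./ P)) ⟩
        1# + (A · 1# + (i ℕ./ P) · 1#)            ≈⟨ +-congˡ (+-congʳ (trans (×-congˡ (q^≡ (suc v))) (pˢ⁺¹·x≈0 (v
              ℕ.+ k ℕ.* suc v) 1#))) ⟩
        1# + (0# + (i ℕ./ P) · 1#)                ≈⟨ +-congˡ (+-identityˡ _) ⟩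
        coeff i                                   ∎
        where
        div : (H ℕ.+ i) ℕ./ P ≡ A ℕ.+ i ℕ./ P
        div = ≡.trans (ℕ.+-distrib-/-∣ˡ i (divides A (≡.sym AP≡H)))
          (≡.cong (ℕ._+ i ℕ./ P) (≡.trans (≡.cong (ℕ._/ P) (≡.sym AP≡H)) (ℕ.m*n/n≡m A P)))

    -- The exponents occurring lie below 2H. The bounds m < L and 2H ≤ m + L rule out every other
    -- member of the residue class of m, so one of the two moments is zero and the other is a single
    -- term.
    uniqueResidue : ∀ {m} → m ℕ.< H ℕ.+ H → m ℕ.< L → H ℕ.+ H ℕ.≤ m ℕ.+ L → L ∣ R ℕ.+ m → coeff m ≈ 0#
    uniqueResidue {m} m<2H m<L 2H≤m+L L∣ with m ℕ.<? H
    ... | yes m<H = xy≈0⇒y≈0 (^-≉0 m γ≉0) (trans (*-comm _ _) (-x≈0⇒x≈0 (begin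
      - (coeff m * γ ^ m) ≈⟨ single 0 m<H L∣ ⟨
      lowMoment           ≈⟨ low≈high ⟩
      highMoment          ≈⟨ moment-none coeff (H ℕ.+_) (λ {j} j<H d → ∣-gap L∣ d
                               (ℕ.<-≤-trans m<H (ℕ.m≤m+n H j)) (ℕ.<-≤-trans (ℕ.+-monoʳ-< H j<H) 2H≤m+L)) ⟩
      0#                  ∎)))
    ... | no m≮H = trans (trans (reflexive (≡.cong coeff m≡)) (coeff-H+ i))
      (xy≈0⇒y≈0 (^-≉0 (H ℕ.+ i) γ≉0) (trans (*-comm _ _) (-x≈0⇒x≈0 (begin
      - (coeff i * γ ^ (H ℕ.+ i)) ≈⟨ single H i<H (≡.subst (λ x → L ∣ R ℕ.+ x) m≡ L∣) ⟨
      highMoment                  ≈⟨ low≈high ⟨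
      lowMoment                   ≈⟨ moment-none coeff (λ j → j) (λ {j} j<H d → ∣-gap d L∣ (ℕ.<-≤-trans j<H H≤m)
            (ℕ.<-≤-trans m<L (ℕ.m≤n+m L j))) ⟩
      0#                          ∎))))
      where
      H≤m = ℕ.≮⇒≥ m≮H
      i = m ℕ.∸ H
      m≡ : m ≡ H ℕ.+ i
      m≡ = ≡.sym (ℕ.m+[n∸m]≡n H≤m)
      i<H : i ℕ.< H
      i<H = ℕ.+-cancelˡ-< H i H (≡.subst (ℕ._< H ℕ.+ H) m≡ m<2H)

    -- Here m lies in the lower half and m + L in the upper half, since H ≤ L. Both moments are
    -- single terms, and cancelling γ^m leaves the factor γ^L.
    twoResidues : ∀ {m} → m ℕ.< H → m ℕ.+ L ℕ.< H ℕ.+ H → L ∣ R ℕ.+ m → coeff m ≈ coeff (m ℕ.+ L) * γ ^ L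
    twoResidues {m} m<H m+L<2H L∣ = *-cancelˡ (^-≉0 m γ≉0) (begin
      γ ^ m * coeff m                       ≈⟨ *-comm _ _ ⟩
      coeff m * γ ^ m                       ≈⟨ -‿injective (begin
        - (coeff m * γ ^ m)                   ≈⟨ single 0 m<H L∣ ⟨
        lowMoment                             ≈⟨ low≈high ⟩
        highMoment                            ≈⟨ single H i<H L∣′ ⟩
        - (coeff i * γ ^ (H ℕ.+ i))           ∎) ⟩
      coeff i * γ ^ (H ℕ.+ i)               ≈⟨ *-cong (sym (coeff-H+ i)) (^-congʳ γ (≡.sym m+L≡)) ⟩
      coeff (H ℕ.+ i) * γ ^ (m ℕ.+ L)       ≈⟨ *-cong (reflexive (≡.cong coeff (≡.sym m+L≡))) (^-homo-* γ m L) ⟩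
      coeff (m ℕ.+ L) * (γ ^ m * γ ^ L)     ≈⟨ x∙yz≈y∙xz _ _ _ ⟩
      γ ^ m * (coeff (m ℕ.+ L) * γ ^ L)     ∎)
      where
      open import Algebra.Properties.CommutativeSemigroup *-commutativeSemigroup using (x∙yz≈y∙xz)
      i = (m ℕ.+ L) ℕ.∸ H
      m+L≡ : m ℕ.+ L ≡ H ℕ.+ i
      m+L≡ = ≡.sym (ℕ.m+[n∸m]≡n (ℕ.≤-trans H≤L (ℕ.m≤n+m L m)))
      i<H : i ℕ.< H
      i<H = ℕ.+-cancelˡ-< H i H (≡.subst (ℕ._< H ℕ.+ H) m+L≡ m+L<2H)
      L∣′ : L ∣ R ℕ.+ (H ℕ.+ i)
      L∣′ = ≡.subst (L ∣_) (≡.trans (ℕ.+-assoc R m L) (≡.cong (R ℕ.+_) m+L≡)) (ℕ.∣m∣n⇒∣m+n L∣ ℕ.∣-refl)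

  -- With M = 1 + q^t the power (1 - y)^(sM) is the product of two geometric sums, in y and in
  -- y^(q^t). Its exponents i + j q^t with i, j < q are distinct and at most sM < L, and all
  -- coefficients are 1.
  noDiagonalResidue : ∀ {t D} → 0 ℕ.< t → s ℕ.* suc (q ℕ.^ t) ℕ.< L → D ℕ.< q → ¬ L ∣ r ℕ.* suc (q ℕ.^ t) ℕ.+ (D
        ℕ.+ D ℕ.* q ℕ.^ t)
  noDiagonalResidue {t} {D} 0<t M<L D<q L∣ = 1≉0 (coefficient≈0 {K = q ℕ.* q} (λ _ → 1#) ε (ℕ.s≤s ℕ.z≤n)
      (ℕ.≤-<-trans (ℕ.m≤n*m (suc P) s) M<L) expansion {i} i<q² (≡.subst (λ x → L ∣ r ℕ.* suc P ℕ.+ x) (≡.sym ε-i) L∣)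
      (λ {j} j<q² L∣j → unique {j} (close (r ℕ.* suc P) (near j i<q²) (near i j<q²) (≡.subst (λ x → L ∣ r ℕ.* suc P
            ℕ.+ x) (≡.sym ε-i) L∣) L∣j)))
    where
    P i : ℕ
    P = q ℕ.^ t
    -- The position of the pair (D, D) in the enumeration by `∑<-blocks`.
    i = D ℕ.+ D ℕ.* q
    instance
      P≢0 : ℕ.NonZero P
      P≢0 = ℕ.m^n≢0 q t
    ε : ℕ → ℕ
    ε j = j ℕ.% q ℕ.+ j ℕ./ q ℕ.* P
    q≤P : q ℕ.≤ P
    q≤P = ≡.subst (ℕ._≤ P) (ℕ.*-identityʳ q) (ℕ.^-monoʳ-≤ q 0<t)
    i%q : i ℕ.% q ≡ D
    i%q = ≡.trans (ℕ.[m+kn]%n≡m%n D D q) (ℕ.m<n⇒m%n≡m D<q)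
    i/q : i ℕ./ q ≡ D
    i/q = proj₂ (divMod-unique q {y = i ℕ./ q} {y′ = D} (ℕ.m%n<n i q) D<q (≡.sym (ℕ.m≡m%n+[m/n]*n i q)))
    ε-i : ε i ≡ D ℕ.+ D ℕ.* P
    ε-i = ≡.cong₂ (λ x y → x ℕ.+ y ℕ.* P) i%q i/q
    i<q² : i ℕ.< q ℕ.* q
    i<q² = ℕ.<-≤-trans (ℕ.+-monoˡ-< (D ℕ.* q) D<q) (ℕ.*-monoˡ-≤ q D<q)
    unique : ∀ {j} → ε j ≡ ε i → j ≡ i
    unique {j} e = let x , y = divMod-unique P {y = j ℕ./ q} {y′ = i ℕ./ q} (ℕ.<-≤-trans (ℕ.m%n<n j q) q≤P) (ℕ.<-≤-trans (ℕ.m%n<n i q) q≤P) e in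
      ≡.trans (ℕ.m≡m%n+[m/n]*n j q) (≡.trans (≡.cong₂ (λ x y → x ℕ.+ y ℕ.* q) x y) (≡.sym (ℕ.m≡m%n+[m/n]*n i q)))
    near : ∀ {i} j → i ℕ.< q ℕ.* q → ε i ℕ.< ε j ℕ.+ L
    near {i} j i<q² = ℕ.<-≤-trans (ℕ.≤-<-trans (ℕ.+-mono-≤ (ℕ.s≤s⁻¹ (ℕ.m%n<n i q))
      (ℕ.*-monoˡ-≤ P {i ℕ./ q} {s} (ℕ.s≤s⁻¹ (ℕ.m<n*o⇒m/o<n i<q²)))) (≡.subst (ℕ._< L) (ℕ.*-suc s P) M<L)) (ℕ.m≤n+m
            L (ε j))
    oneBlockq : ∀ y → (1# - y) ^ s ≈ ∑< q (y ^_)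
    oneBlockq = oneBlock k q≡p^k ≡.refl
    expansion : ∀ y → (1# - y) ^ (s ℕ.* suc P) ≈ ∑< (q ℕ.* q) (λ j → 1# * y ^ ε j)
    expansion y = begin
      (1# - y) ^ (s ℕ.* suc P)                ≈⟨ ^-congʳ (1# - y) (≡.trans (ℕ.*-suc s P) (≡.cong (s ℕ.+_) (ℕ.*-comm
            s P))) ⟩
      (1# - y) ^ (s ℕ.+ P ℕ.* s)              ≈⟨ ^-homo-* (1# - y) s (P ℕ.* s) ⟩
      (1# - y) ^ s * (1# - y) ^ (P ℕ.* s)     ≈⟨ *-congˡ (^-assocʳ (1# - y) P s) ⟨
      (1# - y) ^ s * ((1# - y) ^ P) ^ s       ≈⟨ *-congˡ (^-congˡ s frob) ⟩
      (1# - y) ^ s * (1# - y ^ P) ^ s         ≈⟨ *-cong (oneBlockq y) (oneBlockq (y ^ P)) ⟩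
      ∑< q (y ^_) * ∑< q ((y ^ P) ^_)           ≈⟨ ∑<-blocks q q (y ^_) ((y ^ P) ^_) ⟨
      ∑< (q ℕ.* q) (λ j → y ^ (j ℕ.% q) * (y ^ P) ^ (j ℕ./ q)) ≈⟨ ∑<-cong (q ℕ.* q) (λ {j} _ → begin
        y ^ (j ℕ.% q) * (y ^ P) ^ (j ℕ./ q)     ≈⟨ *-congˡ (trans (^-assocʳ y P (j ℕ./ q)) (^-congʳ y (ℕ.*-comm P
              (j ℕ./ q)))) ⟩
        y ^ (j ℕ.% q) * y ^ (j ℕ./ q ℕ.* P)     ≈⟨ ^-homo-* y (j ℕ.% q) _ ⟨
        y ^ ε j                                 ≈⟨ *-identityˡ _ ⟨
        1# * y ^ ε j                            ∎) ⟩
      ∑< (q ℕ.* q) (λ j → 1# * y ^ ε j)       ∎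
      where
      frob : (1# - y) ^ P ≈ 1# - y ^ P
      frob = ≡.subst (λ Q → (1# - y) ^ Q ≈ 1# - y ^ Q) (≡.sym (q^≡ t)) (frobenius-1-‿ (suc k ℕ.* t) y)

-- Necessary conditions shared by all degrees.

module GeneralNecessity {c ℓ₁ ℓ₂} (F : HeytingField c ℓ₁ ℓ₂) {p k s e} (p-prime : Prime p)
         (q≡p^k : ℕ.suc s ≡ p ℕ.^ ℕ.suc k) (1≤e : 1 ℕ.≤ e)
         (order : FieldNotions.HasOrder F (ℕ.suc (s ℕ.* ℓ (ℕ.suc s) (ℕ.suc e))))
         {a : HeytingField.Carrier F} (a≉0 : ¬ HeytingField._≈_ F a (HeytingField.0# F)) {r} (1≤r : 1 ℕ.≤ r)
         (permutes : FieldNotions.Permutes F (FieldNotions.f F (ℕ.suc s) r a)) where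
  open import Data.Nat.Base
  open import Data.Nat.Properties
  open import Data.Nat.DivMod
  open import Data.Nat.Divisibility
  open import Data.Nat.Primality using (prime⇒nonTrivial)
  open import Data.Nat.Tactic.RingSolver using (solve-∀)
  open import Data.Product.Base using (∃₂; _×_; _,_)
  open import Data.List.Base using (_∷_)
  open import Data.List.Membership.Propositional using (_∈_)
  open import Data.List.Relation.Unary.Any using (here)
  open import Data.Sum.Base using ([_,_]′)
  open import Data.Empty using (⊥)
  open import Function.Base using (_∘_)
  open import Relation.Binary.Definitions using (tri<; tri≈; tri>)
  open import Relation.Binary.PropositionalEquality
  open import Relation.Nullary using (contradiction)
  open RepunitArithmetic
  open ResidueArithmetic
  open BinomialMoments F {k = k} {e = e} p-prime q≡p^k 1≤e order public
  open VanishingCoefficients F {k = k} {e = e} p-prime q≡p^k 1≤e order a≉0 1≤r permutes public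
  open FieldArithmetic F using (_·_; ×-homo-+; ×-congˡ; *-congʳ; +-congʳ; +-congˡ; *≈0)
    renaming (*-identityˡ to ✶-identityˡ; +-cancelʳ to ⊹-cancelʳ; +-identityˡ to ⊹-identityˡ; +-identityʳ to
          ⊹-identityʳ; _≈_ to _≋_; _*_ to _✶_; _+_ to _⊹_; _^_ to _↑_; 0# to 0F; 1# to 1F; trans to ≈-trans; sym to
          ≈-sym; refl to ≈-refl)
  open FieldArithmetic.Decidable F order using (xy≈0⇒y≈0; ^-≉0)
  open Frobenius F order {s = suc k * suc e} p-prime |F|≡ using (∣⇒·≈0; ·1≈0⇒∣)
  open Moments a≉0 using (γ; γ≉0; γ^L≉1)

  m h : ℕ
  m = ℓ q e
  h = H ∸ m

  m+h≡H : m + h ≡ H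
  m+h≡H = m+[n∸m]≡n (≤-trans (m≤n*m m s) (≤-trans (n≤1+n (s * m)) (≤-reflexive (sym (q^e≡1+sℓ s e)))))

  L≡1+qm : L ≡ suc (q * m)
  L≡1+qm = ℓ-suc q e

  L≡m+H : L ≡ m + H
  L≡m+H = ℓ-snoc q e

  p∣q : p ∣ q
  p∣q = divides (p ^ k) (trans q≡p^k (*-comm p (p ^ k)))

  p∤1 : ¬ p ∣ 1
  p∤1 d = nonTrivial⇒≢1 {{prime⇒nonTrivial p-prime}} (∣1⇒≡1 d)

  -- For M = m = ℓ q e the least j with L ∣ r m + j is at least H, hence j = H + w with w < m
  -- because L = H + m. As q m ≡ -1 and q H ≡ 1 modulo L, multiplying by q recovers r.
  residueForm : ∃₂ λ w κ → w < m × r ≡ 1 + q * w + κ * L × r % L ≡ 1 + q * w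
  residueForm with r * m % L in x%L
  ... | zero = contradiction
    (subst (L ∣_) (sym (+-identityʳ (r * m))) (m%n≡0⇒n∣m (r * m) L x%L)) (noSmallResidue 1≤e ≤-refl 0<H)
  ... | suc y = w , r / L , w<m , trans (m≡m%n+[m/n]*n r L) (cong (_+ r / L * L) r%L≡) , r%L≡
    where
    1+y<L : suc y < L
    1+y<L = subst (_< L) x%L (m%n<n (r * m) L)
    j : ℕ
    j = L ∸ suc y
    L∣ : L ∣ r * m + j
    L∣ = divides (suc (r * m / L)) (begin-equality
      r * m + j                                ≡⟨ cong (_+ j) (m≡m%n+[m/n]*n (r * m) L) ⟩
      r * m % L + r * m / L * L + j            ≡⟨ cong (λ x → x + r * m / L * L + j) x%L ⟩
      suc y + r * m / L * L + j                ≡⟨ lemma (suc y) (r * m / L * L) j ⟩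
      suc y + j + r * m / L * L                ≡⟨ cong (_+ r * m / L * L) (m+[n∸m]≡n (<⇒≤ 1+y<L)) ⟩
      L + r * m / L * L                        ∎)
      where
      open ≤-Reasoning
      lemma : ∀ a b c → a + b + c ≡ a + c + b
      lemma = solve-∀
    H≤j : H ≤ j
    H≤j = ≮⇒≥ (λ j<H → noSmallResidue 1≤e ≤-refl j<H L∣)
    w : ℕ
    w = j ∸ H
    H+w≡j : H + w ≡ j
    H+w≡j = m+[n∸m]≡n H≤j
    w<m : w < m
    w<m = +-cancelˡ-< H w m (subst₂ _<_ (sym H+w≡j) (trans L≡m+H (+-comm m H)) j<L)
      where
      j<L : j < L
      j<L = ∸-monoʳ-< z<s (<⇒≤ 1+y<L)
    r%L≡ : r % L ≡ 1 + q * w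
    r%L≡ = residue-invert {r} {q} {s} {m} {w} {H} refl L≡1+qm (q^e≡1+sℓ s (suc e)) w<m (subst (λ x → L ∣ r * m + x)
          (sym H+w≡j) L∣)

  module _ {w κ} (w<m : w < m) (r≡ : r ≡ 1 + q * w + κ * L) where

    -- The case u = 0, where the coefficient of η^j is j + 1 for j < H. From r · 2m ≡ 2m - 2w the
    -- only surviving exponent is n = 2w + h, and n + 1 ≡ 2w modulo p since m ≡ 1 and m + h = H ≡ 0.
    p∣2w : ∀ e′ → e ≡ 2 + e′ → p ∣ w + w
    p∣2w e′ refl = ∣m+n∣m⇒∣n (subst (p ∣_) eq p∣suc-n+qm′) p∣H
      where
      open TwoBlocks 0 (suc e′) refl {m + m} (+-identityʳ (m + m))
      m′ n : ℕ
      m′ = ℓ q (suc e′)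
      n = w + w + h
      m≡ : m ≡ 1 + q * m′
      m≡ = ℓ-suc q (suc e′)
      L≡2m+h : L ≡ m + (m + h)
      L≡2m+h = trans L≡m+H (cong (m +_) (sym m+h≡H))
      L∣ : L ∣ r * (m + m) + n
      L∣ = divides (1 + (w + w) + κ * (m + m)) (begin-equality
        r * (m + m) + n                                              ≡⟨ cong (λ r → r * (m + m) + n) r≡ ⟩
        (1 + q * w + κ * L) * (m + m) + (w + w + h)                  ≡⟨ lemma q w κ L m h ⟩
        (m + (m + h)) + (w + w) * suc (q * m) + κ * (m + m) * L      ≡⟨ cong₂ (λ x y → x + (w + w) * y + κ * (m +
              m) * L) (sym L≡2m+h) (sym L≡1+qm) ⟩
        L + (w + w) * L + κ * (m + m) * L                            ≡⟨ lemma′ L (w + w) (κ * (m + m)) ⟩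
        (1 + (w + w) + κ * (m + m)) * L                              ∎)
        where
        open ≤-Reasoning
        lemma : ∀ q w κ L m h → (1 + q * w + κ * L) * (m + m) + (w + w + h) ≡ (m + (m + h)) + (w + w) * suc (q * m)
              + κ * (m + m) * L
        lemma = solve-∀
        lemma′ : ∀ L x y → L + x * L + y * L ≡ (1 + x + y) * L
        lemma′ = solve-∀
      n<L : n < L
      n<L = <-≤-trans (+-monoˡ-< h (+-mono-< w<m w<m)) (≤-reflexive (trans (+-assoc m m h) (sym L≡2m+h)))
      n<2H : n < H + H
      n<2H = <-≤-trans n<L (≤-trans (≤-reflexive L≡m+H) (+-monoˡ-≤ H (≤-trans (m≤m+n m h) (≤-reflexive m+h≡H))))
      2H≤n+L : H + H ≤ n + L
      2H≤n+L = ≤-trans (≤-reflexive (trans (cong (_+ H) (trans (sym m+h≡H) (+-comm m h))) (trans (+-assoc h m H)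
            (cong (h +_) (sym L≡m+H)))))
        (+-monoˡ-≤ L (m≤n+m h (w + w)))
      p∣suc-n : p ∣ suc n
      p∣suc-n = ·1≈0⇒∣ (suc n) (subst (λ x → suc x · 1F ≋ 0F) (n/1≡n n) (uniqueResidue n<2H n<L 2H≤n+L L∣))
      p∣H : p ∣ H
      p∣H = ∣m⇒∣m*n (q ^ suc e′) p∣q
      p∣suc-n+qm′ : p ∣ suc n + q * m′
      p∣suc-n+qm′ = ∣m∣n⇒∣m+n p∣suc-n (∣m⇒∣m*n m′ p∣q)
      eq : suc n + q * m′ ≡ H + (w + w)
      eq = begin-equality
        suc (w + w + h) + q * m′     ≡⟨ lemma (w + w) h (q * m′) ⟩
        1 + q * m′ + h + (w + w)     ≡⟨ cong (λ x → x + h + (w + w)) m≡ ⟨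
        m + h + (w + w)              ≡⟨ cong (_+ (w + w)) m+h≡H ⟩
        H + (w + w)                  ∎
        where
        open ≤-Reasoning
        lemma : ∀ x h y → suc (x + h) + y ≡ 1 + y + h + x
        lemma = solve-∀

  -- If q = 2 then L = q^(e+1) - 1 and Fermat's theorem gives γ^L = 1.
  2<q : 2 < q
  2<q = ≤∧≢⇒< 2≤q λ 2≡q → γ^L≉1 1≤r permutes (subst (λ x → γ ↑ x ≋ 1F) (s≡1 2≡q) (fermat γ≉0))
    where
    open PowerSums F order using (fermat)
    s≡1 : 2 ≡ q → s * L ≡ L
    s≡1 2≡q = trans (cong (_* L) (sym (suc-injective 2≡q))) (*-identityˡ L)

  private
    ·1≈0 : ∀ {x} → p ∣ x → x · 1F ≋ 0F
    ·1≈0 = ∣⇒·≈0 1F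

    ·1-+ : ∀ {x y} → p ∣ x → (x + y) · 1F ≋ y · 1F
    ·1-+ {x} {y} d = ≈-trans (×-homo-+ 1F x y) (≈-trans (+-congʳ (·1≈0 d)) (⊹-identityˡ _))

    p∣+ : ∀ {x y} → p ∣ x → p ∣ x + y → p ∣ y
    p∣+ d d′ = ∣m+n∣m⇒∣n d′ d

    substQuotients : ∀ {Q₀ Q₂ x y} → suc Q₀ · 1F ≋ suc Q₂ · 1F ✶ γ ↑ L → Q₀ ≡ x → Q₂ ≡ q + y →
                     suc x · 1F ≋ (q + suc y) · 1F ✶ γ ↑ L
    substQuotients {x = x} {y} eq refl refl = subst (λ v → suc x · 1F ≋ v · 1F ✶ γ ↑ L) (sym (+-suc q y)) eq

    -- The relation reads t - 1 = t γ^L. If p ∣ t, it would give p ∣ t - 1 as well; otherwise p = 2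
    -- and t is odd, so the left side is zero while the right side is not.
    noLowResidue : ∀ {t′} → let t = 2 + t′ in p ∣ t + t → ¬ (suc t′ · 1F ≋ (q + t) · 1F ✶ γ ↑ L)
    noLowResidue {t′} p∣2t eq = [ evenCase , multipleCase ]′ (prime∣2x p-prime p∣2t)
      where
      t : ℕ
      t = 2 + t′
      multipleCase : p ∣ t → ⊥
      multipleCase p∣t = p∤1 (p∣+ (·1≈0⇒∣ (suc t′) (≈-trans eq (*≈0 _ (≈-trans (·1-+ p∣q) (·1≈0 p∣t))))) (subst (p
            ∣_) (+-comm 1 (suc t′)) p∣t))
      oddCase : p ∣ suc t′ → ⊥
      oddCase p∣t-1 = ^-≉0 L γ≉0 (xy≈0⇒y≈0
        (λ z → p∤1 (p∣+ p∣t-1 (subst (p ∣_) (+-comm 1 (suc t′)) (p∣+ p∣q (·1≈0⇒∣ _ z)))))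
        (≈-trans (≈-sym eq) (·1≈0 p∣t-1)))
      evenCase : p ≡ 2 → ⊥
      evenCase p≡2 = [ oddCase ∘ subst (_∣ suc t′) (sym p≡2) , multipleCase ∘ subst (_∣ t) (sym p≡2) ]′ (2∣n∨2∣1+n
            (suc t′))

    -- The relation reads t = (t + 1) γ^L. As γ ≠ 0, p divides both of t and t + 1 or neither, hence
    -- neither; but p ∣ t, or p = 2 and one of them is even.
    noHighResidue : ∀ {t} → p ∣ t + t → ¬ (t · 1F ≋ (q + suc t) · 1F ✶ γ ↑ L)
    noHighResidue {t} p∣2t eq = [ evenCase , multipleCase ]′ (prime∣2x p-prime p∣2t)
      where
      multipleCase : p ∣ t → ⊥
      multipleCase p∣t = ^-≉0 L γ≉0 (xy≈0⇒y≈0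
        (λ z → p∤1 (p∣+ p∣t (subst (p ∣_) (+-comm 1 t) (p∣+ p∣q (·1≈0⇒∣ _ z)))))
        (≈-trans (≈-sym eq) (·1≈0 p∣t)))
      oddCase : p ∣ suc t → ⊥
      oddCase p∣t+1 = multipleCase (·1≈0⇒∣ t (≈-trans eq (*≈0 _ (≈-trans (·1-+ p∣q) (·1≈0 p∣t+1)))))
      evenCase : p ≡ 2 → ⊥
      evenCase p≡2 = [ multipleCase ∘ subst (_∣ t) (sym p≡2) , oddCase ∘ subst (_∣ suc t) (sym p≡2) ]′ (2∣n∨2∣1+n t)

    -- Here p = 2 divides t, so the equation reads 1 = γ^L.
    noHalfResidue : ∀ {t′} → let t = 2 + t′ in t + t ≡ q → ¬ (suc t′ · 1F ≋ (q + suc t) · 1F ✶ γ ↑ L)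
    noHalfResidue {t′} 2t≡q eq = γ^L≉1 1≤r permutes (≈-sym (≈-trans (≈-sym t-1≈1) (≈-trans eq (≈-trans (*-congʳ
          q+t+1≈1) (✶-identityˡ _)))))
      where
      open import Data.Nat.Primality using (prime[2])
      t : ℕ
      t = 2 + t′
      2≡p : 2 ≡ p
      2≡p = prime∣prime^⇒≡ (suc k) prime[2] p-prime (subst (2 ∣_) q≡p^k (divides t (trans (sym 2t≡q) (x+x≡x*2 t))))
        where
        x+x≡x*2 : ∀ x → x + x ≡ x * 2
        x+x≡x*2 = solve-∀
      p∣t : p ∣ t
      p∣t = go k (trans 2t≡q q≡p^k)
        where
        go : ∀ k → t + t ≡ p ^ suc k → p ∣ t
        go zero 2t≡p = contradiction (trans 2t≡p (trans (*-identityʳ p) (sym 2≡p)))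
          λ x → 1+n≢0 (trans (sym (+-suc t′ (1 + t′))) (suc-injective (suc-injective x)))
        go (suc k) 2t≡ = subst (p ∣_) (sym (*-cancelˡ-≡ t (p ^ suc k) 2 (trans (cong (t +_) (+-identityʳ t))
          (trans 2t≡ (cong (_* p ^ suc k) (sym 2≡p)))))) (m∣m*n (p ^ k))
      1·1≈1 : 1 · 1F ≋ 1F
      1·1≈1 = ⊹-identityʳ 1F
      q+t+1≈1 : (q + suc t) · 1F ≋ 1F
      q+t+1≈1 = ≈-trans (·1-+ p∣q) (≈-trans (×-congˡ (+-comm 1 t)) (≈-trans (·1-+ p∣t) 1·1≈1))
      t-1≈1 : suc t′ · 1F ≋ 1F
      t-1≈1 = ⊹-cancelʳ (1 · 1F) _ _ (≈-trans
        (≈-trans (≈-sym (×-homo-+ 1F (suc t′) 1)) (≈-trans (×-congˡ (+-comm (suc t′) 1)) (·1≈0 p∣t)))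
        (≈-sym (·1≈0 (∣-reflexive (sym 2≡p)))))

  -- `Q₀` and `Q₂` are the quotients by P of the surviving exponents n and n + L. Before carrying,
  -- these quotients are t - 2 and q + t - 1, and the base-q digits just below are 2t - 1 and 2t.
  -- Whether these digits carry depends on the position of 2t relative to q; for 2t = q only the
  -- second one does.
  noMiddleResidue : ∀ {t′ Q₀ Q₂} → let t = 2 + t′ in p ∣ t + t →
                    (t + t ≤ q → Q₀ ≡ t′) → (q < t + t → Q₀ ≡ 1 + t′) →
                    (t + t < q → Q₂ ≡ q + (1 + t′)) → (q ≤ t + t → Q₂ ≡ q + t) →
                    ¬ (suc Q₀ · 1F ≋ suc Q₂ · 1F ✶ γ ↑ L)
  noMiddleResidue {t′} p∣2t low₀ high₀ low₂ high₂ eq with <-cmp (2 + t′ + (2 + t′)) q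
  ... | tri< 2t<q _ _ = noLowResidue {t′} p∣2t (substQuotients eq (low₀ (<⇒≤ 2t<q)) (low₂ 2t<q))
  ... | tri> _ _ q<2t = noHighResidue {2 + t′} p∣2t (substQuotients eq (high₀ q<2t) (high₂ (<⇒≤ q<2t)))
  ... | tri≈ _ 2t≡q _ = noHalfResidue {t′} 2t≡q (substQuotients eq (low₀ (≤-reflexive 2t≡q)) (high₂ (≤-reflexive
        (sym 2t≡q))))

  ∈-first : ∀ {w x} → r % L ≡ 1 + q * w → w ≡ 0 → r % L ∈ 1 ∷ x
  ∈-first r% refl = here (trans r% (cong suc (*-zeroʳ q)))

  1+qw≡L∸q : ∀ {w} → suc w ≡ m → 1 + q * w ≡ L ∸ q
  1+qw≡L∸q {w} w+1≡m = sym (trans (cong (_∸ q) (begin-equality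
    L                 ≡⟨ L≡1+qm ⟩
    suc (q * m)       ≡⟨ cong (λ x → suc (q * x)) w+1≡m ⟨
    suc (q * suc w)   ≡⟨ cong suc (trans (*-suc q w) (+-comm q (q * w))) ⟩
    1 + q * w + q     ∎)) (m+n∸n≡m (1 + q * w) q))
    where open ≤-Reasoning

-- Necessity in degrees 2, 3 and 4.

module ShortNecessity {c ℓ₁ ℓ₂} (F : HeytingField c ℓ₁ ℓ₂) {p k s e} (p-prime : Prime p)
         (q≡p^k : ℕ.suc s ≡ p ℕ.^ ℕ.suc k) (1≤e : 1 ℕ.≤ e)
         (order : FieldNotions.HasOrder F (ℕ.suc (s ℕ.* ℓ (ℕ.suc s) (ℕ.suc e))))
         {a : HeytingField.Carrier F} (a≉0 : ¬ HeytingField._≈_ F a (HeytingField.0# F)) {r} (1≤r : 1 ℕ.≤ r)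
         (permutes : FieldNotions.Permutes F (FieldNotions.f F (ℕ.suc s) r a)) where
  open import Data.Nat.Base
  open import Data.Nat.Properties
  open import Data.Nat.DivMod
  open import Data.Nat.Divisibility
  open import Data.Nat.Tactic.RingSolver using (solve-∀)
  open import Data.List.Base using (_∷_; [])
  open import Data.List.Membership.Propositional using (_∈_)
  open import Data.List.Relation.Unary.Any using (here; there)
  open import Data.Product.Base using (∃; _×_; _,_)
  open import Data.Sum.Base using (_⊎_; inj₁; inj₂)
  open import Relation.Binary.PropositionalEquality
  open import Relation.Nullary using (yes; no; contradiction)
  open RepunitArithmetic
  open ResidueArithmetic
  open GeneralNecessity F {k = k} {e = e} p-prime q≡p^k 1≤e order a≉0 1≤r permutes
  open Frobenius F order {s = suc k * suc e} p-prime |F|≡ using (·1≈0⇒∣)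
  open ≤-Reasoning

  exponentTwo : e ≡ 1 → r % L ∈ 1 ∷ L ∸ q ∷ []
  exponentTwo refl with residueForm
  ... | w , _ , w<1 , _ , r% = ∈-first r% (n<1⇒n≡0 w<1)

  private
    split : ∀ {t} → t ≤ q → t ≡ 0 ⊎ t ≡ q ⊎ (t ≡ 1) ⊎ ∃ λ t′ → t ≡ 2 + t′ × ∃ λ z → 3 + t′ + z ≡ q
    split {0} _ = inj₁ refl
    split {1} _ = inj₂ (inj₂ (inj₁ refl))
    split {suc (suc t′)} t≤q with suc (suc t′) ≟ q
    ... | yes t≡q = inj₂ (inj₁ t≡q)
    ... | no t≢q = inj₂ (inj₂ (inj₂ (t′ , refl , ≤⇒+ (≤∧≢⇒< t≤q t≢q))))

  private
    -- The vanishing criteria with L, H and P replaced by explicit polynomials in q, so that every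
    -- divisibility becomes a polynomial identity with a given cofactor.
    module Residues (u v : ℕ) (u+1+v≡e : u + suc v ≡ e) (M : ℕ) (M≡ : M + ℓ q u ≡ m + m)
                    {L′ H′ P′ : ℕ} (L≡ : L ≡ L′) (H≡ : H ≡ H′) (P≡ : q ^ u ≡ P′) where
      open TwoBlocks u v u+1+v≡e M≡ public

      quotient≡ : ∀ {n} x y → n ≡ x + y * P′ → x < P′ → n / P ≡ y
      quotient≡ x y n≡ x<P′ = /-unique {P} (trans n≡ (cong (λ P → x + y * P) (sym P≡))) (subst (x <_) (sym P≡) x<P′)

      quotient-+L≡ : ∀ n x y → n + L′ ≡ x + y * P′ → x < P′ → (n + L) / P ≡ y
      quotient-+L≡ n x y n≡ = quotient≡ x y (trans (cong (n +_) L≡) n≡)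

      p∣-unique : ∀ {n} X x y → n < H′ + H′ → n < L′ → H′ + H′ ≤ n + L′ → r * M + n ≡ X * L′ →
                  n ≡ x + y * P′ → x < P′ → p ∣ suc y
      p∣-unique {n} X x y n<2H n<L 2H≤n+L eq n≡ x<P′ = subst (λ x → p ∣ suc x) (quotient≡ x y n≡ x<P′) (·1≈0⇒∣ (suc
            (n / P))
        (uniqueResidue (subst (λ H → n < H + H) (sym H≡) n<2H) (subst (n <_) (sym L≡) n<L)
                       (subst₂ (λ H L → H + H ≤ n + L) (sym H≡) (sym L≡) 2H≤n+L) (divides X (trans eq (cong (X *_)
                             (sym L≡))))))

      two : ∀ {n} X (n<H : n < H′) (n+L<2H : n + L′ < H′ + H′) (eq : r * M + n ≡ X * L′) → _
      two {n} X n<H n+L<2H eq = twoResidues {n} (subst (n <_) (sym H≡) n<H)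
        (subst₂ (λ H L → n + L < H + H) (sym H≡) (sym L≡) n+L<2H) (divides X (trans eq (cong (X *_) (sym L≡))))

    p∤1+q : ¬ p ∣ suc q
    p∤1+q d = p∤1 (∣m+n∣m⇒∣n (subst (p ∣_) (+-comm 1 q) d) p∣q)

    digits< : ∀ {d c} → d < q → c < q → c + d * q < q * q
    digits< {d} {c} d<q c<q = <-≤-trans (+-monoˡ-< (d * q) c<q) (*-monoˡ-≤ q d<q)

  module ExponentThree (e≡2 : e ≡ 2) where
    private
      L≡ : L ≡ 1 + q + q * q
      L≡ = trans (cong (λ e → ℓ q (suc e)) e≡2) (ℓ3 q)

      H≡ : H ≡ q * q
      H≡ = trans (cong (q ^_) e≡2) (cong (q *_) (*-identityʳ q))

      m≡ : m ≡ 1 + q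
      m≡ = trans (cong (ℓ q) e≡2) (ℓ2 q)

      M≡ : ∀ q → 1 + q * 2 + 1 ≡ 1 + q + (1 + q)
      M≡ = solve-∀

      open Residues 1 0 (sym e≡2) (1 + q * 2) (trans (M≡ q) (cong₂ _+_ (sym m≡) (sym m≡))) L≡ H≡ (*-identityʳ q)

      module _ {κ : ℕ} where

        -- The general exponent (2w - 1) + (w - 2) q is negative at w = 1. Its shift by L is q² + 2,
        -- whose quotient by q is q because 2 < q; the coefficient q + 1 is prime to p.
        w≢1 : ¬ r ≡ 1 + q * 1 + κ * L
        w≢1 r≡ = p∤1+q (p∣-unique {q * q + 2} (3 + κ * (1 + q * 2)) 2 q n<2H n<L 2H≤n+L eq (+-comm (q * q) 2) 2<q)
          where
          eq : r * (1 + q * 2) + (q * q + 2) ≡ (3 + κ * (1 + q * 2)) * (1 + q + q * q)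
          eq = trans (cong (λ r → r * (1 + q * 2) + (q * q + 2)) (trans r≡ (cong (λ L → 1 + q * 1 + κ * L) L≡)))
                (lemma q κ)
            where
            lemma : ∀ q κ → (1 + q * 1 + κ * (1 + q + q * q)) * (1 + q * 2) + (q * q + 2) ≡ (3 + κ * (1 + q * 2)) *
                  (1 + q + q * q)
            lemma = solve-∀
          n<2H : q * q + 2 < q * q + q * q
          n<2H = +-monoʳ-< (q * q) (<-≤-trans 2<q (m≤m*n q q))
          n<L : q * q + 2 < 1 + q + q * q
          n<L = subst (_< 1 + q + q * q) (+-comm 2 (q * q)) (+-monoˡ-< (q * q) (m<n⇒m<1+n 2<q))
          2H≤n+L : q * q + q * q ≤ q * q + 2 + (1 + q + q * q)
          2H≤n+L = +-mono-≤ (m≤m+n (q * q) 2) (m≤n+m (q * q) (1 + q))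

        w≢middle : ∀ {t′ z} → 3 + t′ + z ≡ q → p ∣ (2 + t′) + (2 + t′) → ¬ r ≡ 1 + q * (2 + t′) + κ * L
        w≢middle {t′} {z} q≡ p∣2t r≡ = noMiddleResidue {t′} p∣2t low₀ high₀ low₂ high₂
          (two {n} ((2 + t′) * 2 + κ * (1 + q * 2)) n<H n+L<2H eq)
          where
          n : ℕ
          -- In terms of t = 2 + t′ this is (2t - 1) + (t - 2) q, and n + L = 2t + (q + t - 1) q.
          n = 3 + t′ * 2 + t′ * q
          eq : r * (1 + q * 2) + n ≡ ((2 + t′) * 2 + κ * (1 + q * 2)) * (1 + q + q * q)
          eq = trans (cong (λ r → r * (1 + q * 2) + n) (trans r≡ (cong (λ L → 1 + q * (2 + t′) + κ * L) L≡)))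
                (lemma q t′ κ)
            where
            lemma : ∀ q t κ → (1 + q * (2 + t) + κ * (1 + q + q * q)) * (1 + q * 2) + (3 + t * 2 + t * q) ≡
                    ((2 + t) * 2 + κ * (1 + q * 2)) * (1 + q + q * q)
            lemma = solve-∀
          n<H : n < q * q
          -- After substituting q = 3 + t′ + z the slack is a polynomial in t′ and z with
          -- nonnegative coefficients; it serves as the witness.
          n<H = subst (λ q → 3 + t′ * 2 + t′ * q < q * q) q≡ (<-witness (5 + t′ + 6 * z + t′ * z + z * z) (lemma t′
                z))
            where
            lemma : ∀ t z → suc (3 + t * 2 + t * (3 + t + z) + (5 + t + 6 * z + t * z + z * z)) ≡ (3 + t + z) * (3
                  + t + z)
            lemma = solve-∀
          n+L<2H : n + (1 + q + q * q) < q * q + q * q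
          n+L<2H = subst (λ q → 3 + t′ * 2 + t′ * q + (1 + q + q * q) < q * q + q * q) q≡ (<-witness (1 + 5 * z +
                t′ * z + z * z) (lemma t′ z))
            where
            lemma : ∀ t z → suc (3 + t * 2 + t * (3 + t + z) + (1 + (3 + t + z) + (3 + t + z) * (3 + t + z)) + (1 +
                  5 * z + t * z + z * z)) ≡
                    (3 + t + z) * (3 + t + z) + (3 + t + z) * (3 + t + z)
            lemma = solve-∀
          4+2t<2q : 4 + t′ * 2 < q + q
          4+2t<2q = subst (λ q → 4 + t′ * 2 < q + q) q≡ (<-witness (1 + z * 2) (lemma t′ z))
            where
            lemma : ∀ t z → suc (4 + t * 2 + (1 + z * 2)) ≡ 3 + t + z + (3 + t + z)
            lemma = solve-∀
          2t≡ : ∀ t → 2 + t + (2 + t) ≡ 4 + t * 2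
          2t≡ = solve-∀
          low₀ : 2 + t′ + (2 + t′) ≤ q → n / P ≡ t′
          low₀ 2t≤q = quotient≡ (3 + t′ * 2) t′ refl (subst (_≤ q) (2t≡ t′) 2t≤q)
          high₀ : q < 2 + t′ + (2 + t′) → n / P ≡ 1 + t′
          high₀ q<2t with ≤⇒+ (s≤s⁻¹ (subst (q <_) (2t≡ t′) q<2t))
          ... | d , q+d≡ = quotient≡ d (1 + t′) (trans (cong (_+ t′ * q) (sym q+d≡)) (lemma q d t′))
            (+-cancelˡ-< q d q (subst (_< q + q) (sym q+d≡) (<-trans (n<1+n _) 4+2t<2q)))
            where
            lemma : ∀ q d t → q + d + t * q ≡ d + (1 + t) * q
            lemma = solve-∀
          low₂ : 2 + t′ + (2 + t′) < q → (n + L) / P ≡ q + (1 + t′)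
          low₂ 2t<q = quotient-+L≡ n (4 + t′ * 2) (q + (1 + t′)) (lemma q t′) (subst (_< q) (2t≡ t′) 2t<q)
            where
            lemma : ∀ q t → 3 + t * 2 + t * q + (1 + q + q * q) ≡ 4 + t * 2 + (q + (1 + t)) * q
            lemma = solve-∀
          high₂ : q ≤ 2 + t′ + (2 + t′) → (n + L) / P ≡ q + (2 + t′)
          high₂ q≤2t with ≤⇒+ (subst (q ≤_) (2t≡ t′) q≤2t)
          ... | d , q+d≡ = quotient-+L≡ n d (q + (2 + t′)) (trans (lemma q t′) (trans (cong (_+ (q + (1 + t′)) * q)
                (sym q+d≡)) (lemma′ q d t′)))
            (+-cancelˡ-< q d q (subst (_< q + q) (sym q+d≡) 4+2t<2q))
            where
            lemma : ∀ q t → 3 + t * 2 + t * q + (1 + q + q * q) ≡ 4 + t * 2 + (q + (1 + t)) * q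
            lemma = solve-∀
            lemma′ : ∀ q d t → q + d + (q + (1 + t)) * q ≡ d + (q + (2 + t)) * q
            lemma′ = solve-∀

    exponentThree : r % L ∈ 1 ∷ L ∸ q ∷ []
    exponentThree with residueForm
    ... | w , κ , w<m , r≡ , r% with split (s≤s⁻¹ (subst (w <_) m≡ w<m))
    ...   | inj₁ w≡0 = ∈-first r% w≡0
    ...   | inj₂ (inj₁ refl) = there (here (trans r% (1+qw≡L∸q (sym m≡))))
    ...   | inj₂ (inj₂ (inj₁ refl)) = contradiction r≡ (w≢1 {κ})
    ...   | inj₂ (inj₂ (inj₂ (t′ , refl , z , q≡))) = contradiction r≡ (w≢middle {κ} q≡ (p∣2w {κ = κ} w<m r≡ 0 e≡2))

  module ExponentFour (e≡3 : e ≡ 3) where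
    private
      L≡ : L ≡ (1 + q) * (1 + q * q)
      L≡ = trans (cong (λ e → ℓ q (suc e)) e≡3) (trans (ℓ-suc q 3) (trans (cong (λ x → 1 + q * x) (ℓ3 q)) (lemma q)))
        where
        lemma : ∀ q → 1 + q * (1 + q + q * q) ≡ (1 + q) * (1 + q * q)
        lemma = solve-∀

      H≡ : H ≡ q * (q * q)
      H≡ = trans (cong (q ^_) e≡3) (cong (λ x → q * (q * x)) (*-identityʳ q))

      m≡ : m ≡ 1 + q + q * q
      m≡ = trans (cong (ℓ q) e≡3) (ℓ3 q)

      q²≡ : q ^ 2 ≡ q * q
      q²≡ = cong (q *_) (*-identityʳ q)

      M≡ : ∀ q → 1 + q + 2 * (q * q) + (1 + q) ≡ 1 + q + q * q + (1 + q + q * q)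
      M≡ = solve-∀

      M : ℕ
      M = 1 + q + 2 * (q * q)

      open Residues 2 0 (sym e≡3) M (trans (cong (M +_) (ℓ2 q)) (trans (M≡ q) (cong₂ _+_ (sym m≡) (sym m≡)))) L≡ H≡
            q²≡

      1+q∣L : suc q ∣ L
      1+q∣L = divides (1 + q * q) (trans L≡ (*-comm (1 + q) (1 + q * q)))

      -- For M = 1 + q² the factorization L = (1 + q)(1 + q²) lets the factor 1 + q² cancel from the
      -- excluded divisibility.
      1+q∤r+D : ∀ {D} → D < q → ¬ suc q ∣ r + D
      1+q∤r+D {D} D<q (divides t r+D≡) = noDiagonalResidue {2} {D} z<s M<L D<q
        (subst (λ P → L ∣ r * suc P + (D + D * P)) (sym q²≡) (divides t (begin-equality
          r * suc (q * q) + (D + D * (q * q)) ≡⟨ lemma r D (q * q) ⟩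
          (r + D) * suc (q * q)               ≡⟨ cong (_* suc (q * q)) r+D≡ ⟩
          t * suc q * suc (q * q)             ≡⟨ *-assoc t (suc q) (suc (q * q)) ⟩
          t * (suc q * suc (q * q))           ≡⟨ cong (t *_) L≡ ⟨
          t * L                               ∎)))
        where
        lemma : ∀ r D x → r * suc x + (D + D * x) ≡ (r + D) * suc x
        lemma = solve-∀
        M<L : s * suc (q ^ 2) < L
        M<L = subst₂ (λ P L → s * suc P < L) (sym q²≡) (sym L≡) (*-monoˡ-< (suc (q * q)) {s} {1 + q} (m<n⇒m<1+n
              ≤-refl))

      -- The residue of -r modulo q + 1 is none of 0, ..., q - 1, so it is q ≡ -1.
      r%[1+q]≡1 : r % suc q ≡ 1
      r%[1+q]≡1 with r % suc q in eq
      ... | 0 = contradiction (subst (suc q ∣_) (sym (+-identityʳ r)) (m%n≡0⇒n∣m r (suc q) eq)) (1+q∤r+D z<s)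
      ... | 1 = refl
      ... | suc (suc y) with ≤⇒+ (s≤s⁻¹ (subst (_< suc q) eq (m%n<n r (suc q))))
      ...   | d , y+d≡q = contradiction (divides (suc (r / suc q)) (begin-equality
        r + suc d                                     ≡⟨ cong (_+ suc d) (m≡m%n+[m/n]*n r (suc q)) ⟩
        r % suc q + r / suc q * suc q + suc d         ≡⟨ cong (λ x → x + r / suc q * suc q + suc d) eq ⟩
        suc (suc y) + r / suc q * suc q + suc d       ≡⟨ lemma y (r / suc q * suc q) d ⟩
        suc (suc (suc y) + d) + r / suc q * suc q     ≡⟨ cong (λ x → suc x + r / suc q * suc q) y+d≡q ⟩
        suc q + r / suc q * suc q                     ∎)) (1+q∤r+D (<-witness y (trans (lemma′ y d) y+d≡q)))
        where
        lemma : ∀ y x d → suc (suc y) + x + suc d ≡ suc (suc (suc y) + d) + x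
        lemma = solve-∀
        lemma′ : ∀ y d → suc (suc d + y) ≡ suc (suc y) + d
        lemma′ = solve-∀

      -- Modulo 1 + q both r ≡ 1 and L ≡ 0, so q w ≡ 0, while q ≡ -1.
      1+q∣w : ∀ {w κ} → r ≡ 1 + q * w + κ * L → suc q ∣ w
      1+q∣w {w} {κ} r≡ = ∣m+n∣m⇒∣n (subst (suc q ∣_) (+-comm w (q * w)) (m∣m*n {suc q} w)) (∣m+n∣n⇒∣m
        (divides (r / suc q) (suc-injective (trans (sym r≡) (trans (m≡m%n+[m/n]*n r (suc q)) (cong (_+ r / suc q *
              suc q) r%[1+q]≡1)))))
        (∣n⇒∣m*n κ 1+q∣L))

      module _ {κ : ℕ} where

        -- As in degree 3, the general exponent is negative at t = 1. Its shift by L is 1 + 2q + q³,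
        -- with 1 + 2q < q² as q ≥ 3, so the coefficient is again q + 1.
        t≢1 : ¬ r ≡ 1 + q * (1 * suc q) + κ * L
        t≢1 r≡ = p∤1+q (p∣-unique {n} (2 + 2 * q + κ * M) (1 + 2 * q) q n<2H n<L 2H≤n+L eq (cong (1 + 2 * q +_)
              refl) 1+2q<q²)
          where
          n : ℕ
          n = 1 + 2 * q + q * (q * q)
          eq : r * M + n ≡ (2 + 2 * q + κ * M) * ((1 + q) * (1 + q * q))
          eq = trans (cong (λ r → r * M + n) (trans r≡ (cong (λ L → 1 + q * (1 * suc q) + κ * L) L≡))) (lemma q κ)
            where
            lemma : ∀ q κ → (1 + q * (1 * suc q) + κ * ((1 + q) * (1 + q * q))) * (1 + q + 2 * (q * q)) + (1 + 2 *
                  q + q * (q * q)) ≡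
                    (2 + 2 * q + κ * (1 + q + 2 * (q * q))) * ((1 + q) * (1 + q * q))
            lemma = solve-∀
          1+2q<q² : 1 + 2 * q < q * q
          1+2q<q² = <-≤-trans (+-monoˡ-< (2 * q) (<-trans (n<1+n 1) 2<q)) (*-monoˡ-≤ q 2<q)
          q²≤q³ : q * q ≤ q * (q * q)
          q²≤q³ = *-monoʳ-≤ q (m≤m*n q q)
          n<2H : n < q * (q * q) + q * (q * q)
          n<2H = +-monoˡ-< (q * (q * q)) (<-≤-trans 1+2q<q² q²≤q³)
          n<L : n < (1 + q) * (1 + q * q)
          n<L = <-≤-trans (+-monoˡ-< (q * (q * q)) 1+2q<q²) (≤-trans (m≤m+n _ (1 + q)) (≤-reflexive (lemma q)))
            where
            lemma : ∀ q → q * q + q * (q * q) + (1 + q) ≡ (1 + q) * (1 + q * q)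
            lemma = solve-∀
          2H≤n+L : q * (q * q) + q * (q * q) ≤ n + (1 + q) * (1 + q * q)
          2H≤n+L = ≤-trans (m≤m+n _ (2 + 3 * q + q * q)) (≤-reflexive (lemma q))
            where
            lemma : ∀ q → q * (q * q) + q * (q * q) + (2 + 3 * q + q * q) ≡ 1 + 2 * q + q * (q * q) + (1 + q) * (1
                  + q * q)
            lemma = solve-∀

        t≢middle : ∀ {t′ z} → 3 + t′ + z ≡ q → p ∣ (2 + t′) + (2 + t′) → ¬ r ≡ 1 + q * ((2 + t′) * suc q) + κ * L
        t≢middle {t′} {z} q≡ p∣2t r≡ = noMiddleResidue {t′} p∣2t low₀ high₀ low₂ high₂
          (two {n} ((2 + t′) * (1 + 2 * q) + κ * M) n<H n+L<2H eq)
          where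
          n : ℕ
          -- The base-q digits, before carrying, are t - 1, 2t - 1 and t - 2 with t = 2 + t′. Adding
          -- L = 1 + q + q² + q³ raises each of them by one and puts 1 in front.
          n = 1 + t′ + (3 + t′ * 2) * q + t′ * (q * q)
          eq : r * M + n ≡ ((2 + t′) * (1 + 2 * q) + κ * M) * ((1 + q) * (1 + q * q))
          eq = trans (cong (λ r → r * M + n) (trans r≡ (cong (λ L → 1 + q * ((2 + t′) * suc q) + κ * L) L≡)))
                (lemma q t′ κ)
            where
            lemma : ∀ q t κ → (1 + q * ((2 + t) * suc q) + κ * ((1 + q) * (1 + q * q))) * (1 + q + 2 * (q * q)) +
                  (1 + t + (3 + t * 2) * q + t * (q * q)) ≡
                    ((2 + t) * (1 + 2 * q) + κ * (1 + q + 2 * (q * q))) * ((1 + q) * (1 + q * q))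
            lemma = solve-∀
          n<H : n < q * (q * q)
          n<H = <-witness (5 * q + (1 + z) + t′ * q + 3 * z * q + z * (q * q)) (subst
            (λ q → suc (1 + t′ + (3 + t′ * 2) * q + t′ * (q * q) + (5 * q + (1 + z) + t′ * q + 3 * z * q + z * (q *
                  q))) ≡ q * (q * q)) q≡ (lemma t′ z))
            where
            lemma : ∀ t z → let q = 3 + t + z in suc (1 + t + (3 + t * 2) * q + t * (q * q) + (5 * q + (1 + z) + t * q + 3 * z * q + z * (q * q))) ≡ q * (q * q)
            lemma = solve-∀
          n+L<2H : n + (1 + q) * (1 + q * q) < q * (q * q) + q * (q * q)
          n+L<2H = <-witness (z * (q * q) + 2 * z * q + q + z) (subst
            (λ q → suc (1 + t′ + (3 + t′ * 2) * q + t′ * (q * q) + (1 + q) * (1 + q * q) + (z * (q * q) + 2 * z * q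
                  + q + z)) ≡ q * (q * q) + q * (q * q)) q≡ (lemma t′ z))
            where
            lemma : ∀ t z → let q = 3 + t + z in
                    suc (1 + t + (3 + t * 2) * q + t * (q * q) + (1 + q) * (1 + q * q) + (z * (q * q) + 2 * z * q +
                          q + z)) ≡ q * (q * q) + q * (q * q)
            lemma = solve-∀
          2+t<q : 2 + t′ < q
          2+t<q = <-witness z q≡
          1+t<q : 1 + t′ < q
          1+t<q = <-trans (n<1+n _) 2+t<q
          4+2t<2q : 4 + t′ * 2 < q + q
          4+2t<2q = subst (_< q + q) (2t≡ t′) (+-mono-< 2+t<q 2+t<q)
            where
            2t≡ : ∀ t → 2 + t + (2 + t) ≡ 4 + t * 2
            2t≡ = solve-∀
          2t≡ : ∀ t → 2 + t + (2 + t) ≡ 4 + t * 2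
          2t≡ = solve-∀
          low₀ : 2 + t′ + (2 + t′) ≤ q → n / P ≡ t′
          low₀ 2t≤q = quotient≡ (1 + t′ + (3 + t′ * 2) * q) t′ refl (digits< (subst (_≤ q) (2t≡ t′) 2t≤q) 1+t<q)
          high₀ : q < 2 + t′ + (2 + t′) → n / P ≡ 1 + t′
          high₀ q<2t with ≤⇒+ (s≤s⁻¹ (subst (q <_) (2t≡ t′) q<2t))
          ... | d , q+d≡ = quotient≡ (1 + t′ + d * q) (1 + t′)
            (trans (cong (λ x → 1 + t′ + x * q + t′ * (q * q)) (sym q+d≡)) (lemma q d t′))
            (digits< (+-cancelˡ-< q d q (subst (_< q + q) (sym q+d≡) (<-trans (n<1+n _) 4+2t<2q))) 1+t<q)
            where
            lemma : ∀ q d t → 1 + t + (q + d) * q + t * (q * q) ≡ 1 + t + d * q + (1 + t) * (q * q)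
            lemma = solve-∀
          n+L≡ : n + (1 + q) * (1 + q * q) ≡ 2 + t′ + (4 + t′ * 2) * q + (q + (1 + t′)) * (q * q)
          n+L≡ = lemma q t′
            where
            lemma : ∀ q t → 1 + t + (3 + t * 2) * q + t * (q * q) + (1 + q) * (1 + q * q) ≡ 2 + t + (4 + t * 2) * q
                  + (q + (1 + t)) * (q * q)
            lemma = solve-∀
          low₂ : 2 + t′ + (2 + t′) < q → (n + L) / P ≡ q + (1 + t′)
          low₂ 2t<q = quotient-+L≡ n (2 + t′ + (4 + t′ * 2) * q) (q + (1 + t′)) n+L≡ (digits< (subst (_< q) (2t≡
                t′) 2t<q) 2+t<q)
          high₂ : q ≤ 2 + t′ + (2 + t′) → (n + L) / P ≡ q + (2 + t′)
          high₂ q≤2t with ≤⇒+ (subst (q ≤_) (2t≡ t′) q≤2t)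
          ... | d , q+d≡ = quotient-+L≡ n (2 + t′ + d * q) (q + (2 + t′))
            (trans n+L≡ (trans (cong (λ x → 2 + t′ + x * q + (q + (1 + t′)) * (q * q)) (sym q+d≡)) (lemma q d t′)))
            (digits< (+-cancelˡ-< q d q (subst (_< q + q) (sym q+d≡) 4+2t<2q)) 2+t<q)
            where
            lemma : ∀ q d t → 2 + t + (q + d) * q + (q + (1 + t)) * (q * q) ≡ 2 + t + d * q + (q + (2 + t)) * (q * q)
            lemma = solve-∀

    exponentFour : r % L ∈ 1 ∷ L ∸ q ∷ []
    exponentFour with residueForm
    ... | w , κ , w<m , r≡ , r% with 1+q∣w {w} {κ} r≡
    ...   | divides t refl with split (s≤s⁻¹ (*-cancelʳ-< (suc q) t (suc q) (<-≤-trans (subst (w <_) m≡ w<m)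
          (≤-trans (m≤m+n _ q) (≤-reflexive (lemma q))))))
      where
      lemma : ∀ q → 1 + q + q * q + q ≡ suc q * suc q
      lemma = solve-∀
    ...     | inj₁ refl = ∈-first r% refl
    ...     | inj₂ (inj₁ refl) = there (here (trans r% (1+qw≡L∸q (trans (lemma q) (sym m≡)))))
      where
      lemma : ∀ q → suc (q * suc q) ≡ 1 + q + q * q
      lemma = solve-∀
    ...     | inj₂ (inj₂ (inj₁ refl)) = contradiction r≡ (t≢1 {κ})
    ...     | inj₂ (inj₂ (inj₂ (t′ , refl , z , q≡))) = contradiction r≡ (t≢middle {κ} q≡ p∣2t)
      where
      lemma : ∀ q t → t * suc q + t * suc q ≡ q * (t + t) + (t + t)
      lemma = solve-∀
      p∣2t : p ∣ 2 + t′ + (2 + t′)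
      p∣2t = ∣m+n∣m⇒∣n (subst (p ∣_) (lemma q (2 + t′)) (p∣2w {κ = κ} w<m r≡ 1 e≡3)) (∣m⇒∣m*n (2 + t′ + (2 + t′)) p∣q)

-- Necessity in degrees 5 and 6.

module LongNecessity {c ℓ₁ ℓ₂} (F : HeytingField c ℓ₁ ℓ₂) {p k s e} (p-prime : Prime p)
         (q≡p^k : ℕ.suc s ≡ p ℕ.^ ℕ.suc k) (1≤e : 1 ℕ.≤ e)
         (order : FieldNotions.HasOrder F (ℕ.suc (s ℕ.* ℓ (ℕ.suc s) (ℕ.suc e))))
         {a : HeytingField.Carrier F} (a≉0 : ¬ HeytingField._≈_ F a (HeytingField.0# F)) {r} (1≤r : 1 ℕ.≤ r)
         (permutes : FieldNotions.Permutes F (FieldNotions.f F (ℕ.suc s) r a)) where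
  open import Data.Nat.Base
  open import Data.Nat.Properties
  open import Data.Nat.Divisibility
  open import Data.Nat.Tactic.RingSolver using (solve-∀)
  open import Data.List.Base using (_∷_; [])
  open import Data.List.Membership.Propositional using (_∈_)
  open import Data.List.Relation.Unary.Any using (here; there)
  open import Data.Product.Base using (∃; ∃₂; _×_; _,_)
  open import Data.Sum.Base using (_⊎_; inj₁; inj₂; [_,_]′)
  open import Relation.Binary.PropositionalEquality
  open import Relation.Nullary using (yes; no; contradiction)
  open RepunitArithmetic
  open ResidueArithmetic
  open GeneralNecessity F {k = k} {e = e} p-prime q≡p^k 1≤e order a≉0 1≤r permutes
  open Frobenius F order {s = suc k * suc e} p-prime |F|≡ using (·1≈0⇒∣)
  open ≤-Reasoning

  module Halves (e′ : ℕ) (e≡ : e ≡ 2 + e′) where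
    m′ A h′ : ℕ
    m′ = ℓ q (suc e′)
    A  = q ^ suc e′
    h′ = A ∸ m′

    m′+h′≡A : m′ + h′ ≡ A
    m′+h′≡A = m+[n∸m]≡n (≤-trans (m≤n*m m′ s) (≤-trans (n≤1+n (s * m′)) (≤-reflexive (sym (q^e≡1+sℓ s (suc e′))))))

    m≡1+qm′ : m ≡ suc (q * m′)
    m≡1+qm′ = trans (cong (ℓ q) e≡) (ℓ-suc q (suc e′))

    m≡m′+A : m ≡ m′ + A
    m≡m′+A = trans (cong (ℓ q) e≡) (ℓ-snoc q (suc e′))

    H≡qA : H ≡ q * A
    H≡qA = cong (q ^_) e≡

    L≡′ : L ≡ suc (q * suc (q * m′))
    L≡′ = trans L≡1+qm (cong (λ x → suc (q * x)) m≡1+qm′)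

    qm′+1≡m′+A : suc (q * m′) ≡ m′ + A
    qm′+1≡m′+A = trans (sym m≡1+qm′) m≡m′+A

    L≡1+qm′+qA : L ≡ suc (q * m′ + q * A)
    L≡1+qm′+qA = trans L≡1+qm (cong suc (trans (cong (q *_) m≡m′+A) (*-distribˡ-+ q m′ A)))

    p∣A : p ∣ A
    p∣A = ∣m⇒∣m*n (q ^ e′) p∣q

    module _ {w′ κ} (w′≤m′ : w′ ≤ m′) (r≡ : r ≡ 1 + q * (q * w′) + κ * L) where

      -- From L = 1 + q + q² m′ one gets r m′ ≡ m′ - (q + 1) w′ modulo L, and `noSmallResidue`
      -- forbids (q + 1) w′ - m′ to lie in [0, A). Above this gap, t = m′ - w′ is as small as w′ is
      -- below it.
      half : w′ * suc q < m′ ⊎ ∃ λ t → w′ + t ≡ m′ × t * suc q < m′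
      half with w′ * suc q <? m′
      ... | yes lower = inj₁ lower
      ... | no ¬lower with w′ * suc q <? m′ + A
      ...   | no ¬middle = inj₂ (t , w′+t≡m′ , +-cancelˡ-< (m′ + A) (t * suc q) m′ (begin-strict
        m′ + A + t * suc q         ≤⟨ +-monoˡ-≤ (t * suc q) (≮⇒≥ ¬middle) ⟩
        w′ * suc q + t * suc q     ≡⟨ *-distribʳ-+ (suc q) w′ t ⟨
        (w′ + t) * suc q           ≡⟨ cong (_* suc q) w′+t≡m′ ⟩
        m′ * suc q                 <⟨ n<1+n _ ⟩
        suc (m′ * suc q)           ≡⟨ lemma m′ q ⟩
        suc (q * m′) + m′          ≡⟨ cong (_+ m′) qm′+1≡m′+A ⟩
        m′ + A + m′                ∎))
        where
        t : ℕ
        t = m′ ∸ w′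
        w′+t≡m′ : w′ + t ≡ m′
        w′+t≡m′ = m+[n∸m]≡n w′≤m′
        lemma : ∀ m q → suc (m * suc q) ≡ suc (q * m) + m
        lemma = solve-∀
      ...   | yes middle with ≤⇒+ (≮⇒≥ ¬lower)
      ...     | n , m′+n≡ = contradiction (divides (w′ + κ * m′) (begin-equality
        r * m′ + n                                          ≡⟨ cong (λ r → r * m′ + n) r≡ ⟩
        (1 + q * (q * w′) + κ * L) * m′ + n                 ≡⟨ lemma q w′ κ L m′ n ⟩
        m′ + n + (q * q) * (w′ * m′) + κ * m′ * L           ≡⟨ cong (λ x → x + (q * q) * (w′ * m′) + κ * m′ * L)
              m′+n≡ ⟩
        w′ * suc q + (q * q) * (w′ * m′) + κ * m′ * L       ≡⟨ lemma′ q w′ m′ (κ * m′ * L) ⟩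
        w′ * suc (q * suc (q * m′)) + κ * m′ * L            ≡⟨ cong (λ x → w′ * x + κ * m′ * L) L≡′ ⟨
        w′ * L + κ * m′ * L                                 ≡⟨ *-distribʳ-+ L w′ (κ * m′) ⟨
        (w′ + κ * m′) * L                                   ∎))
        (noSmallResidue {suc e′} {n} (s≤s z≤n) (≤-trans (n≤1+n _) (≤-reflexive (sym e≡)))
          (+-cancelˡ-< m′ n A (subst (_< m′ + A) (sym m′+n≡) middle)))
        where
        lemma : ∀ q w κ L m n → (1 + q * (q * w) + κ * L) * m + n ≡ m + n + (q * q) * (w * m) + κ * m * L
        lemma = solve-∀
        lemma′ : ∀ q w m x → w * suc q + (q * q) * (w * m) + x ≡ w * suc (q * suc (q * m)) + x
        lemma′ = solve-∀

      private
        M : ℕ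
        M = suc (q * m′ + q * m′)

        M≡ : M + ℓ q 1 ≡ m + m
        M≡ = trans (lemma (q * m′)) (sym (cong₂ _+_ m≡1+qm′ m≡1+qm′))
          where
          lemma : ∀ x → suc (x + x) + 1 ≡ suc x + suc x
          lemma = solve-∀

        open TwoBlocks 1 e′ (sym e≡) {M} M≡ using (P; P≢0; uniqueResidue)

        -- Chosen so that r M ≡ -q g modulo L. As P = q here, the exponent q g has quotient exactly
        -- g.
        g : ℕ
        g = h′ + w′ * (2 + q)

        rM+qg≡ : r * M + q * g ≡ (1 + q * (w′ + w′) + κ * M) * L
        rM+qg≡ = begin-equality
          r * M + q * g ≡⟨ cong (λ r → r * M + q * g) r≡ ⟩
          (1 + q * (q * w′) + κ * L) * M + q * g
            ≡⟨ lemma q w′ κ L m′ h′ ⟩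
          suc (q * m′ + q * (m′ + h′)) + q * (w′ + w′) * suc (q * suc (q * m′)) + κ * M * L
            ≡⟨ cong₂ (λ x y → x + q * (w′ + w′) * y + κ * M * L) (trans (cong (λ x → suc (q * m′ + q * x)) m′+h′≡A)
                  (sym L≡1+qm′+qA)) (sym L≡′) ⟩
          L + q * (w′ + w′) * L + κ * M * L ≡⟨ lemma′ L (q * (w′ + w′)) (κ * M) ⟩
          (1 + q * (w′ + w′) + κ * M) * L   ∎
          where
          lemma : ∀ q w κ L m h → (1 + q * (q * w) + κ * L) * suc (q * m + q * m) + q * (h + w * (2 + q)) ≡
                  suc (q * m + q * (m + h)) + q * (w + w) * suc (q * suc (q * m)) + κ * suc (q * m + q * m) * L
          lemma = solve-∀
          lemma′ : ∀ L x y → L + x * L + y * L ≡ (1 + x + y) * L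
          lemma′ = solve-∀

        2H≡ : H + H ≡ q * (A + A)
        2H≡ = trans (cong₂ _+_ H≡qA H≡qA) (sym (*-distribˡ-+ q A A))

        residue⇒∣ : ∀ {n x y} → n ≡ x + y * q → x < q → n < H + H → n < L → H + H ≤ n + L → L ∣ r * M + n → p ∣ suc y
        residue⇒∣ {n} {x} {y} n≡ x<q n<2H n<L 2H≤n+L L∣ = subst (λ y → p ∣ suc y)
          (/-unique {P} {n} {x} {y} (trans n≡ (cong (λ P → x + y * P) (sym (*-identityʳ q)))) (subst (x <_) (sym
                (*-identityʳ q)) x<q))
          (·1≈0⇒∣ (suc (n / P)) (uniqueResidue n<2H n<L 2H≤n+L L∣))

      -- Smallness of w′ keeps q g below L, so it is the only surviving exponent and p ∣ g + 1.
      -- Modulo p, A ≡ 0 and m′ ≡ 1 turn g + 1 into 2w′.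
      lower⇒p∣2w′ : w′ * suc q < m′ → p ∣ w′ + w′
      lower⇒p∣2w′ lower = ∣m+n∣m⇒∣n (subst (p ∣_) eq (∣m∣n⇒∣m+n
        (residue⇒∣ {q * g} {0} {g} (*-comm q g) z<s qg<2H qg<L 2H≤qg+L (divides (1 + q * (w′ + w′) + κ * M) rM+qg≡))
        (∣m⇒∣m*n (ℓ q e′) p∣q))) (∣m∣n⇒∣m+n p∣A (∣m⇒∣m*n w′ p∣q))
        where
        g<A+w′ : g < A + w′
        g<A+w′ = begin-strict
          h′ + w′ * (2 + q)         ≡⟨ lemma h′ w′ q ⟩
          h′ + w′ + w′ * suc q      <⟨ +-monoʳ-< (h′ + w′) lower ⟩
          h′ + w′ + m′              ≡⟨ lemma′ h′ w′ m′ ⟩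
          m′ + h′ + w′              ≡⟨ cong (_+ w′) m′+h′≡A ⟩
          A + w′                    ∎
          where
          lemma : ∀ h w q → h + w * (2 + q) ≡ h + w + w * suc q
          lemma = solve-∀
          lemma′ : ∀ h w m → h + w + m ≡ m + h + w
          lemma′ = solve-∀
        w′≤A : w′ ≤ A
        w′≤A = ≤-trans w′≤m′ (≤-trans (m≤m+n m′ h′) (≤-reflexive m′+h′≡A))
        qg<2H : q * g < H + H
        qg<2H = <-≤-trans (*-monoʳ-< q (<-≤-trans g<A+w′ (+-monoʳ-≤ A w′≤A))) (≤-reflexive (sym 2H≡))
        qg<L : q * g < L
        qg<L = <-≤-trans (*-monoʳ-< q g<A+w′) (≤-trans (*-monoʳ-≤ q (+-monoʳ-≤ A w′≤m′)) (≤-trans (≤-reflexive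
              (trans (*-distribˡ-+ q A m′) (+-comm (q * A) (q * m′))))
          (≤-trans (n≤1+n _) (≤-reflexive (sym L≡1+qm′+qA)))))
        2H≤qg+L : H + H ≤ q * g + L
        2H≤qg+L = begin
          H + H                                    ≡⟨ 2H≡ ⟩
          q * (A + A)                              ≡⟨ cong (λ x → q * (x + A)) m′+h′≡A ⟨
          q * (m′ + h′ + A)                        ≡⟨ lemma q m′ h′ A ⟩
          q * h′ + (q * m′ + q * A)                ≤⟨ +-mono-≤ (*-monoʳ-≤ q (m≤m+n h′ (w′ * (2 + q)))) (n≤1+n _) ⟩
          q * g + suc (q * m′ + q * A)             ≡⟨ cong (q * g +_) L≡1+qm′+qA ⟨
          q * g + L                                ∎
          where
          lemma : ∀ q m h A → q * (m + h + A) ≡ q * h + (q * m + q * A)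
          lemma = solve-∀
        eq : suc g + q * ℓ q e′ ≡ A + q * w′ + (w′ + w′)
        eq = begin-equality
          suc (h′ + w′ * (2 + q)) + q * ℓ q e′       ≡⟨ lemma h′ w′ q (q * ℓ q e′) ⟩
          suc (q * ℓ q e′) + h′ + q * w′ + (w′ + w′) ≡⟨ cong (λ x → x + h′ + q * w′ + (w′ + w′)) (ℓ-suc q e′) ⟨
          m′ + h′ + q * w′ + (w′ + w′)               ≡⟨ cong (λ x → x + q * w′ + (w′ + w′)) m′+h′≡A ⟩
          A + q * w′ + (w′ + w′)                     ∎
          where
          lemma : ∀ h w q x → suc (h + w * (2 + q)) + x ≡ suc x + h + q * w + (w + w)
          lemma = solve-∀

      -- Now q g exceeds L, and the surviving exponent is q g - L. Since L ≡ 1 modulo q, its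
      -- remainder is s = q - 1; its quotient g′ satisfies g′ + 1 = q m′ - t (2 + q) ≡ -2t modulo p.
      upper⇒p∣2t : ∀ {t} → w′ + t ≡ m′ → t * suc q < m′ → p ∣ t + t
      upper⇒p∣2t {t} w′+t≡m′ upper with ≤⇒+ bound
        where
        bound : suc (t * (2 + q)) ≤ q * m′
        bound = begin
          suc (t * (2 + q))   ≡⟨ lemma t q ⟩
          suc (t * suc q) + t ≤⟨ +-mono-≤ upper (<⇒≤ (≤-<-trans (m≤m*n t (suc q)) upper)) ⟩
          m′ + m′             ≡⟨ cong (m′ +_) (+-identityʳ m′) ⟨
          2 * m′              ≤⟨ *-monoˡ-≤ m′ 2≤q ⟩
          q * m′              ∎
          where
          lemma : ∀ t q → suc (t * (2 + q)) ≡ suc (t * suc q) + t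
          lemma = solve-∀
      ... | g′ , g′≡ = ∣m+n∣m⇒∣n (subst (p ∣_) (lemma q t) (∣m+n∣m⇒∣n (subst (p ∣_) (trans (sym g′≡) (lemma′ (t *
            (2 + q)) g′)) (∣m⇒∣m*n m′ p∣q))
          (residue⇒∣ {n} {s} {g′} n≡ ≤-refl n<2H n<L 2H≤n+L L∣))) (∣m⇒∣m*n t p∣q)
        where
        lemma : ∀ q t → t * (2 + q) ≡ q * t + (t + t)
        lemma = solve-∀
        lemma′ : ∀ x g → suc x + g ≡ suc g + x
        lemma′ = solve-∀
        n : ℕ
        n = q * g′ + s
        n≡ : n ≡ s + g′ * q
        n≡ = trans (+-comm (q * g′) s) (cong (s +_) (*-comm q g′))
        n+1≡ : suc n ≡ q * suc g′
        n+1≡ = trans (sym (+-suc (q * g′) s)) (trans (+-comm (q * g′) q) (sym (*-suc q g′)))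
        1+g′≤qm′ : suc g′ ≤ q * m′
        1+g′≤qm′ = ≤-trans (s≤s (m≤n+m g′ (t * (2 + q)))) (≤-reflexive g′≡)
        qm′≤m′+A : q * m′ ≤ m′ + A
        qm′≤m′+A = ≤-trans (n≤1+n _) (≤-reflexive qm′+1≡m′+A)
        m′≤A : m′ ≤ A
        m′≤A = ≤-trans (m≤m+n m′ h′) (≤-reflexive m′+h′≡A)
        n<q[m′+A] : n < q * (m′ + A)
        n<q[m′+A] = ≤-trans (≤-reflexive n+1≡) (*-monoʳ-≤ q (≤-trans 1+g′≤qm′ qm′≤m′+A))
        n<2H : n < H + H
        n<2H = <-≤-trans n<q[m′+A] (≤-trans (*-monoʳ-≤ q (+-monoˡ-≤ A m′≤A)) (≤-reflexive (sym 2H≡)))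
        n<L : n < L
        n<L = <-≤-trans n<q[m′+A] (≤-trans (≤-reflexive (*-distribˡ-+ q m′ A)) (≤-trans (n≤1+n _) (≤-reflexive (sym
              L≡1+qm′+qA))))
        w′[2+q]≡ : w′ * (2 + q) ≡ m′ + m′ + suc g′
        w′[2+q]≡ = +-cancelʳ-≡ (t * (2 + q)) (w′ * (2 + q)) (m′ + m′ + suc g′) (begin-equality
          w′ * (2 + q) + t * (2 + q)         ≡⟨ *-distribʳ-+ (2 + q) w′ t ⟨
          (w′ + t) * (2 + q)                 ≡⟨ cong (_* (2 + q)) w′+t≡m′ ⟩
          m′ * (2 + q)                       ≡⟨ l₁ m′ q ⟩
          m′ + m′ + q * m′                   ≡⟨ cong (m′ + m′ +_) g′≡ ⟨
          m′ + m′ + (suc (t * (2 + q)) + g′) ≡⟨ l₂ (m′ + m′) (t * (2 + q)) g′ ⟩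
          m′ + m′ + suc g′ + t * (2 + q)     ∎)
          where
          l₁ : ∀ m q → m * (2 + q) ≡ m + m + q * m
          l₁ = solve-∀
          l₂ : ∀ x y g → x + (suc y + g) ≡ x + suc g + y
          l₂ = solve-∀
        L+n≡qg : L + n ≡ q * g
        L+n≡qg = begin-equality
          L + n                                             ≡⟨ cong (_+ n) L≡1+qm′+qA ⟩
          suc (q * m′ + q * A) + n                          ≡⟨ +-suc (q * m′ + q * A) n ⟨
          q * m′ + q * A + suc n                            ≡⟨ cong₂ (λ x y → q * m′ + q * x + y) (sym m′+h′≡A) n+1≡ ⟩
          q * m′ + q * (m′ + h′) + q * suc g′               ≡⟨ l₁ q m′ h′ g′ ⟩
          q * (h′ + (m′ + m′ + suc g′))                     ≡⟨ cong (λ x → q * (h′ + x)) w′[2+q]≡ ⟨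
          q * g                                             ∎
          where
          l₁ : ∀ q m h g → q * m + q * (m + h) + q * suc g ≡ q * (h + (m + m + suc g))
          l₁ = solve-∀
        L∣ : L ∣ r * M + n
        L∣ = ∣m+n∣m⇒∣n (subst (L ∣_) (trans (cong (r * M +_) (sym L+n≡qg)) (l₁ (r * M) L n)) (divides (1 + q * (w′
              + w′) + κ * M) rM+qg≡)) ∣-refl
          where
          l₁ : ∀ x L n → x + (L + n) ≡ L + (x + n)
          l₁ = solve-∀
        2H≤n+L : H + H ≤ n + L
        2H≤n+L = begin
          H + H                        ≡⟨ 2H≡ ⟩
          q * (A + A)                  ≡⟨ cong (λ x → q * (x + A)) m′+h′≡A ⟨
          q * (m′ + h′ + A)            ≡⟨ cong (q *_) (l₁ m′ h′ A) ⟩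
          q * (h′ + (m′ + A))          ≡⟨ cong (λ x → q * (h′ + x)) qm′+1≡m′+A ⟨
          q * (h′ + suc (q * m′))      ≤⟨ *-monoʳ-≤ q (+-monoʳ-≤ h′ l₂) ⟩
          q * g                        ≡⟨ L+n≡qg ⟨
          L + n                        ≡⟨ +-comm L n ⟩
          n + L                        ∎
          where
          l₁ : ∀ m h A → m + h + A ≡ h + (m + A)
          l₁ = solve-∀
          l₂ : suc (q * m′) ≤ w′ * (2 + q)
          l₂ = +-cancelʳ-≤ (t * (2 + q)) (suc (q * m′)) (w′ * (2 + q)) (begin
            suc (q * m′) + t * (2 + q)          ≡⟨ +-suc (q * m′) (t * (2 + q)) ⟨
            q * m′ + suc (t * (2 + q))          ≡⟨ cong (q * m′ +_) (l₃ t q) ⟩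
            q * m′ + (suc (t * suc q) + t)      ≤⟨ +-monoʳ-≤ (q * m′) (+-mono-≤ upper (<⇒≤ (≤-<-trans (m≤m*n t (suc
                  q)) upper))) ⟩
            q * m′ + (m′ + m′)                  ≡⟨ l₄ q m′ ⟩
            m′ * (2 + q)                        ≡⟨ cong (_* (2 + q)) w′+t≡m′ ⟨
            (w′ + t) * (2 + q)                  ≡⟨ *-distribʳ-+ (2 + q) w′ t ⟩
            w′ * (2 + q) + t * (2 + q)          ∎)
            where
            l₃ : ∀ t q → suc (t * (2 + q)) ≡ suc (t * suc q) + t
            l₃ = solve-∀
            l₄ : ∀ q m → q * m + (m + m) ≡ m * (2 + q)
            l₄ = solve-∀

    module _ (q≡p : q ≡ p) (p≢2 : ¬ p ≡ 2) where

      -- The point where primality and oddness of q enter: a congruence modulo p determines a full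
      -- base-q digit.
      p∣2x⇒q∣x : ∀ {x} → p ∣ x + x → q ∣ x
      p∣2x⇒q∣x {x} d = [ contradiction′ , subst (_∣ x) (sym q≡p) ]′ (prime∣2x p-prime d)
        where
        contradiction′ : p ≡ 2 → q ∣ x
        contradiction′ p≡2 = contradiction p≡2 p≢2

      -- The two alternatives mirror each other under w′ ↦ m′ - w′, which exchanges the residues 1
      -- and L - q. In both, the multiple x q inherits the bound from `half`.
      LongForm : Set
      LongForm = ∃₂ λ w′ κ → r ≡ 1 + q * (q * w′) + κ * L × r % L ≡ 1 + q * (q * w′) ×
                 ((∃ λ x → w′ ≡ x * q × x * q * suc q < m′) ⊎ (∃ λ x → w′ + x * q ≡ m′ × x * q * suc q < m′))

      private
        fromHalf : ∀ {w′ κ} (w′≤m′ : w′ ≤ m′) (r≡ : r ≡ 1 + q * (q * w′) + κ * L) → r % L ≡ 1 + q * (q * w′) →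
                   w′ * suc q < m′ ⊎ (∃ λ t → w′ + t ≡ m′ × t * suc q < m′) → LongForm
        fromHalf {w′} {κ} w′≤m′ r≡ r% (inj₁ lower) = w′ , κ , r≡ , r% , inj₁ (quotient q∣w′ , w′≡ , subst (λ x → x
              * suc q < m′) w′≡ lower)
          where
          q∣w′ : q ∣ w′
          q∣w′ = p∣2x⇒q∣x (lower⇒p∣2w′ {κ = κ} w′≤m′ r≡ lower)
          w′≡ : w′ ≡ quotient q∣w′ * q
          w′≡ = m∣n⇒n≡quotient*m q∣w′
        fromHalf {w′} {κ} w′≤m′ r≡ r% (inj₂ (t , w′+t≡m′ , upper)) = w′ , κ , r≡ , r% ,
          inj₂ (quotient q∣t , trans (cong (w′ +_) (sym t≡)) w′+t≡m′ , subst (λ x → x * suc q < m′) t≡ upper)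
          where
          q∣t : q ∣ t
          q∣t = p∣2x⇒q∣x (upper⇒p∣2t {κ = κ} w′≤m′ r≡ w′+t≡m′ upper)
          t≡ : t ≡ quotient q∣t * q
          t≡ = m∣n⇒n≡quotient*m q∣t

        fromMultiple : ∀ {w κ} → w < m → r ≡ 1 + q * w + κ * L → r % L ≡ 1 + q * w → q ∣ w → LongForm
        fromMultiple {w} {κ} w<m r≡ r% q∣w = fromHalf {w′} {κ} w′≤m′ r≡′ (trans r% (cong (λ x → 1 + q * x) w≡))
              (half {κ = κ} w′≤m′ r≡′)
          where
          w′ : ℕ
          w′ = quotient q∣w
          w≡ : w ≡ q * w′
          w≡ = trans (m∣n⇒n≡quotient*m q∣w) (*-comm w′ q)
          w′≤m′ : w′ ≤ m′
          w′≤m′ = *-cancelˡ-≤ q (s≤s⁻¹ (subst₂ _<_ w≡ m≡1+qm′ w<m))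
          r≡′ : r ≡ 1 + q * (q * w′) + κ * L
          r≡′ = trans r≡ (cong (λ x → 1 + q * x + κ * L) w≡)

      longForm : LongForm
      longForm = let w , κ , w<m , r≡ , r% = residueForm in
        fromMultiple {w} {κ} w<m r≡ r% (p∣2x⇒q∣x (p∣2w {w} {κ} w<m r≡ e′ e≡))

      w′≡0⇒∈ : ∀ {w′ xs} → r % L ≡ 1 + q * (q * w′) → w′ ≡ 0 → r % L ∈ 1 ∷ xs
      w′≡0⇒∈ r% refl = ∈-first r% (*-zeroʳ q)

      w′≡m′⇒∈ : ∀ {w′ x xs} → r % L ≡ 1 + q * (q * w′) → w′ ≡ m′ → r % L ∈ x ∷ L ∸ q ∷ xs
      w′≡m′⇒∈ r% refl = there (here (trans r% (1+qw≡L∸q (sym m≡1+qm′))))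

  module ExponentFive (e≡4 : e ≡ 4) (q≡p : q ≡ p) (p≢2 : ¬ p ≡ 2) where
    open Halves 2 e≡4

    private
      tooLarge : ∀ x → ¬ (2 + x) * q * suc q < m′
      tooLarge x = ≤⇒≯ (≤-trans (≤-reflexive (ℓ3 q)) (≤-trans (m≤m+n (1 + q + q * q) (s + q * q + x * q * suc q))
            (≤-reflexive (lemma s x))))
        where
        lemma : ∀ s x → let q = suc s in 1 + q + q * q + (s + q * q + x * q * suc q) ≡ (2 + x) * q * suc q
        lemma = solve-∀

      -- As m′ = 1 + q + q² < 2q(q + 1), only x = 0 and x = 1 remain. The lower alternative gives 1
      -- and q³ + 1, the upper one L - q and q⁴ + q² + 1.
      fromLongForm : LongForm q≡p p≢2 → r % L ∈ 1 ∷ L ∸ q ∷ q ^ 3 + 1 ∷ q ^ 4 + q ^ 2 + 1 ∷ []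
      fromLongForm (w′ , κ , r≡ , r% , inj₁ (0 , w′≡0 , _)) = w′≡0⇒∈ q≡p p≢2 r% w′≡0
      fromLongForm (w′ , κ , r≡ , r% , inj₁ (1 , w′≡q , _)) = there (there (here (trans r% (trans (cong (λ x → 1 +
            q * (q * x)) w′≡q) (lemma q)))))
        where
        lemma : ∀ q → 1 + q * (q * (1 * q)) ≡ q * (q * (q * 1)) + 1
        lemma = solve-∀
      fromLongForm (w′ , κ , r≡ , r% , inj₁ (suc (suc x) , _ , bound)) = contradiction bound (tooLarge x)
      fromLongForm (w′ , κ , r≡ , r% , inj₂ (0 , w′≡m′ , _)) = w′≡m′⇒∈ q≡p p≢2 r% (trans (sym (+-identityʳ w′)) w′≡m′)
      fromLongForm (w′ , κ , r≡ , r% , inj₂ (1 , w′+q≡m′ , _)) =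
        there (there (there (here (trans r% (trans (cong (λ x → 1 + q * (q * x)) w′≡) (lemma q))))))
        where
        w′≡ : w′ ≡ 1 + q * q
        w′≡ = +-cancelʳ-≡ (1 * q) w′ (1 + q * q) (trans w′+q≡m′ (trans (ℓ3 q) (lemma′ q)))
          where
          lemma′ : ∀ q → 1 + q + q * q ≡ 1 + q * q + 1 * q
          lemma′ = solve-∀
        lemma : ∀ q → 1 + q * (q * (1 + q * q)) ≡ q * (q * (q * (q * 1))) + q * (q * 1) + 1
        lemma = solve-∀
      fromLongForm (w′ , κ , r≡ , r% , inj₂ (suc (suc x) , _ , bound)) = contradiction bound (tooLarge x)

    exponentFive : r % L ∈ 1 ∷ L ∸ q ∷ q ^ 3 + 1 ∷ q ^ 4 + q ^ 2 + 1 ∷ []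
    exponentFive = fromLongForm (longForm q≡p p≢2)

  module ExponentSix (e≡5 : e ≡ 5) (q≡p : q ≡ p) (p≢2 : ¬ p ≡ 2) where
    open Halves 3 e≡5

    private
      m₃ : ℕ
      m₃ = ℓ q 3

      m′≡ : m′ ≡ suc (q * q) * suc q
      m′≡ = trans (ℓ-suc q 3) (trans (cong (λ x → suc (q * x)) (ℓ3 q)) (lemma q))
        where
        lemma : ∀ q → suc (q * (1 + q + q * q)) ≡ suc (q * q) * suc q
        lemma = solve-∀

      L≡m₃ : L ≡ m₃ * suc (q * (q * q))
      L≡m₃ = trans L≡′ (trans (cong (λ x → suc (q * suc (q * x))) m′≡) (trans (lemma q) (cong (_* suc (q * (q *
            q))) (sym (ℓ3 q)))))
        where
        lemma : ∀ q → suc (q * suc (q * (suc (q * q) * suc q))) ≡ (1 + q + q * q) * suc (q * (q * q))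
        lemma = solve-∀

      x≤q : ∀ x → x * q * suc q < m′ → x ≤ q
      x≤q x bound = *-cancelʳ-≤ x q q (s≤s⁻¹ (*-cancelʳ-< (suc q) (x * q) (suc (q * q)) (<-≤-trans bound
            (≤-reflexive m′≡))))

      y*m₃<q³ : ∀ {y} → y < q → y * m₃ < q ^ 3
      y*m₃<q³ {y} y<q = ≤-<-trans (*-monoˡ-≤ m₃ (s≤s⁻¹ y<q)) (≤-reflexive (sym (q^e≡1+sℓ s 3)))

      3≤e : 3 ≤ e
      3≤e = subst (3 ≤_) (sym e≡5) (s≤s (s≤s (s≤s z≤n)))

      -- From L = m₃ (1 + q³) follows q³ m₃ ≡ -m₃, so r ≡ 1 + (x + 1) q³ gives r m₃ ≡ -x m₃ modulo
      -- L. This contradicts `noSmallResidue` because x m₃ ≤ (q - 1) m₃ = q³ - 1.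
      lower : ∀ {x κ} → suc x ≤ q → ¬ r ≡ 1 + q * (q * (suc x * q)) + κ * L
      lower {x} {κ} x<q r≡ = noSmallResidue {3} {x * m₃} (s≤s z≤n) 3≤e (y*m₃<q³ x<q) (divides (suc x + κ * m₃)
            (begin-equality
        r * m₃ + x * m₃                                             ≡⟨ cong (λ r → r * m₃ + x * m₃) r≡ ⟩
        (1 + q * (q * (suc x * q)) + κ * L) * m₃ + x * m₃           ≡⟨ lemma q x κ L m₃ ⟩
        suc x * (m₃ * suc (q * (q * q))) + κ * m₃ * L               ≡⟨ cong (λ y → suc x * y + κ * m₃ * L) L≡m₃ ⟨
        suc x * L + κ * m₃ * L                                      ≡⟨ *-distribʳ-+ L (suc x) (κ * m₃) ⟨
        (suc x + κ * m₃) * L                                        ∎))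
        where
        lemma : ∀ q x κ L m → (1 + q * (q * (suc x * q)) + κ * L) * m + x * m ≡ suc x * (m * suc (q * (q * q))) + κ
              * m * L
        lemma = solve-∀

      -- Here 1 + q² m′ ≡ -q, so r ≡ -q - (x + 1) q³ and r m₃ ≡ -y m₃ modulo L with y = q - 1 - x;
      -- the contradiction is that of `lower`.
      upper : ∀ {w′ x κ} → suc x ≤ q → w′ + suc x * q ≡ m′ → ¬ r ≡ 1 + q * (q * w′) + κ * L
      upper {w′} {x} {κ} x<q w′+≡m′ r≡ with ≤⇒+ x<q
      ... | y , 1+x+y≡q = noSmallResidue {3} {y * m₃} (s≤s z≤n) 3≤e (y*m₃<q³ (<-witness x (trans (cong suc (+-comm
            y x)) 1+x+y≡q)))
        (∣m+n∣n⇒∣m (divides (m₃ + κ * m₃) (begin-equality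
          r * m₃ + y * m₃ + suc x * L                                     ≡⟨ cong₂ (λ r z → r * m₃ + y * m₃ + suc x
                * z) r≡ L≡m₃ ⟩
          (1 + q * (q * w′) + κ * L) * m₃ + y * m₃ + suc x * (m₃ * suc (q * (q * q)))
                                                                          ≡⟨ lemma q w′ κ L m₃ y x ⟩
          m₃ * suc (suc x + y + q * (q * (w′ + suc x * q))) + κ * m₃ * L  ≡⟨ cong₂ (λ a b → m₃ * suc (a + q * (q *
                b)) + κ * m₃ * L) 1+x+y≡q w′+≡m′ ⟩
          m₃ * suc (q + q * (q * m′)) + κ * m₃ * L                        ≡⟨ cong (λ a → m₃ * suc a + κ * m₃ * L)
                (*-suc q (q * m′)) ⟨
          m₃ * suc (q * suc (q * m′)) + κ * m₃ * L                        ≡⟨ cong (λ a → m₃ * a + κ * m₃ * L) L≡′ ⟨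
          m₃ * L + κ * m₃ * L                                             ≡⟨ *-distribʳ-+ L m₃ (κ * m₃) ⟨
          (m₃ + κ * m₃) * L                                               ∎)) (∣n⇒∣m*n (suc x) ∣-refl))
        where
        lemma : ∀ q w κ L m y x → (1 + q * (q * w) + κ * L) * m + y * m + suc x * (m * suc (q * (q * q))) ≡
                m * suc (suc x + y + q * (q * (w + suc x * q))) + κ * m * L
        lemma = solve-∀

      fromLongForm : LongForm q≡p p≢2 → r % L ∈ 1 ∷ L ∸ q ∷ []
      fromLongForm (w′ , κ , r≡ , r% , inj₁ (0 , w′≡0 , _)) = w′≡0⇒∈ q≡p p≢2 r% w′≡0
      fromLongForm (w′ , κ , r≡ , r% , inj₁ (suc x , w′≡ , bound)) =
        contradiction (trans r≡ (cong (λ x → 1 + q * (q * x) + κ * L) w′≡)) (lower {x} {κ} (x≤q (suc x) bound))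
      fromLongForm (w′ , κ , r≡ , r% , inj₂ (0 , w′≡m′ , _)) = w′≡m′⇒∈ q≡p p≢2 r% (trans (sym (+-identityʳ w′)) w′≡m′)
      fromLongForm (w′ , κ , r≡ , r% , inj₂ (suc x , w′+≡m′ , bound)) = contradiction r≡ (upper {w′} {x} {κ} (x≤q
            (suc x) bound) w′+≡m′)

    exponentSix : r % L ∈ 1 ∷ L ∸ q ∷ []
    exponentSix = fromLongForm (longForm q≡p p≢2)

-- Sufficiency through linearized binomials.

module Sufficiency {c ℓ₁ ℓ₂} (F : HeytingField c ℓ₁ ℓ₂) {p k s e} (p-prime : Prime p)
         (q≡p^k : ℕ.suc s ≡ p ℕ.^ ℕ.suc k) (1≤e : 1 ℕ.≤ e)
         (order : FieldNotions.HasOrder F (ℕ.suc (s ℕ.* ℓ (ℕ.suc s) (ℕ.suc e))))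
         {a : HeytingField.Carrier F} (a≉0 : ¬ HeytingField._≈_ F a (HeytingField.0# F))
         (norm≉1 : ¬ HeytingField._≈_ F (FieldNotions._^_ F (HeytingField.-_ F a) (ℓ (ℕ.suc s) (ℕ.suc e))) (HeytingField.1# F)) where
  open import Data.Nat.Base as ℕ using (ℕ; suc)
  import Data.Nat.Properties as ℕ
  import Data.Nat.DivMod as ℕ
  open import Data.Nat.Divisibility using (divides)
  open import Data.Nat.GCD using (gcd; gcd-GCD; module Bézout)
  open import Data.Nat.Tactic.RingSolver using (solve-∀)
  open import Data.Product.Base using (_,_)
  open import Function.Definitions using (Injective)
  import Relation.Binary.PropositionalEquality as ≡
  open import Relation.Nullary using (yes; no; contradiction)
  open RepunitArithmetic
  open BinomialMoments F {k = k} {e = e} p-prime q≡p^k 1≤e order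
  open FieldArithmetic F
  open Decidable order
  open PowerSums F order
  open Frobenius F order {s = suc k ℕ.* suc e} p-prime |F|≡
  open Moments a≉0 using (f-cong)
  open import Relation.Binary.Reasoning.Setoid setoid

  private
    n : ℕ
    n = s ℕ.* L

    q-frobenius-sub : ∀ i x y → (x - y) ^ (q ℕ.^ i) ≈ x ^ (q ℕ.^ i) - y ^ (q ℕ.^ i)
    q-frobenius-sub i x y = ≡.subst (λ Q → (x - y) ^ Q ≈ x ^ Q - y ^ Q) (≡.sym (q^≡ i)) (frobenius-sub (suc k ℕ.*
          i) x y)

    -- Such x lie in the subfield with q elements, which the q-power map fixes; concretely, q^i - 1
    -- is a multiple of s.
    ^s≈1⇒fixed : ∀ {x} i → x ^ s ≈ 1# → x ^ (q ℕ.^ i) ≈ x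
    ^s≈1⇒fixed {x} i xˢ≈1 = begin
      x ^ (q ℕ.^ i)                ≈⟨ ^-congʳ x (q^e≡1+sℓ s i) ⟩
      x * x ^ (s ℕ.* ℓ q i)        ≈⟨ *-congˡ (^≈1-* s (ℓ q i) xˢ≈1) ⟩
      x * 1#                       ≈⟨ *-identityʳ x ⟩
      x                            ∎

    norm^s≈1 : ∀ {x} → ¬ x ≈ 0# → ∀ κ → (x ^ (κ ℕ.* L)) ^ s ≈ 1#
    norm^s≈1 {x} x≉0 κ = begin
      (x ^ (κ ℕ.* L)) ^ s         ≈⟨ ^-assocʳ x (κ ℕ.* L) s ⟩
      x ^ (κ ℕ.* L ℕ.* s)         ≈⟨ fermat-∣ x≉0 (divides κ (≡.trans (ℕ.*-assoc κ L s) (≡.cong (κ ℕ.*_) (ℕ.*-comm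
            L s)))) ⟩
      1#                          ∎

    ^-≡mod : ∀ {x} → ¬ x ≈ 0# → ∀ {b b′} u v → b ℕ.+ u ℕ.* n ≡ b′ ℕ.+ v ℕ.* n → x ^ b ≈ x ^ b′
    ^-≡mod {x} x≉0 {b} {b′} u v eq = begin
      x ^ b                       ≈⟨ *-identityʳ _ ⟨
      x ^ b * 1#                  ≈⟨ *-congˡ (fermat-∣ x≉0 (divides u ≡.refl)) ⟨
      x ^ b * x ^ (u ℕ.* n)       ≈⟨ ^-homo-* x b _ ⟨
      x ^ (b ℕ.+ u ℕ.* n)         ≈⟨ ^-congʳ x eq ⟩
      x ^ (b′ ℕ.+ v ℕ.* n)        ≈⟨ ^-homo-* x b′ _ ⟩
      x ^ b′ * x ^ (v ℕ.* n)      ≈⟨ *-congˡ (fermat-∣ x≉0 (divides v ≡.refl)) ⟩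
      x ^ b′ * 1#                 ≈⟨ *-identityʳ _ ⟩
      x ^ b′                      ∎

    x^s≉-a : ∀ {x} → ¬ x ≈ 0# → ¬ x ^ s + a ≈ 0#
    x^s≉-a {x} x≉0 e = norm≉1 (begin
      (- a) ^ L       ≈⟨ ^-congˡ L (+-inverseˡ-unique _ _ e) ⟨
      (x ^ s) ^ L     ≈⟨ ^-assocʳ x s L ⟩
      x ^ n           ≈⟨ fermat x≉0 ⟩
      1#              ∎)

    linearized : ℕ → ℕ → Carrier → Carrier
    linearized i j x = x ^ (q ℕ.^ i) + a * x ^ (q ℕ.^ j)

    -- The power x^L is the norm to the subfield with q elements and is invariant under the q-power
    -- map. Taking norms in x^(q^i) = -a x^(q^j) with x ≠ 0 would give (-a)^L = 1.
    linearized-≈0 : ∀ i j {x} → linearized i j x ≈ 0# → x ≈ 0#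
    linearized-≈0 i j {x} Ax≈0 with x ≈? 0#
    ... | yes x≈0 = x≈0
    ... | no x≉0 = contradiction (*-cancelˡ (^-≉0 L x≉0) (begin
      x ^ L * (- a) ^ L                        ≈⟨ *-comm _ _ ⟩
      (- a) ^ L * x ^ L                        ≈⟨ *-congˡ (norm-fixed j) ⟨
      (- a) ^ L * (x ^ (q ℕ.^ j)) ^ L          ≈⟨ ^-distrib-* _ _ L ⟨
      (- a * x ^ (q ℕ.^ j)) ^ L                ≈⟨ ^-congˡ L (trans (+-inverseˡ-unique _ _ Ax≈0) (-‿distribˡ-* a _)) ⟨
      (x ^ (q ℕ.^ i)) ^ L                      ≈⟨ norm-fixed i ⟩
      x ^ L                                    ≈⟨ *-identityʳ _ ⟨
      x ^ L * 1#                               ∎)) norm≉1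
      where
      norm-fixed : ∀ i → (x ^ (q ℕ.^ i)) ^ L ≈ x ^ L
      norm-fixed i = trans (^-comm x (q ℕ.^ i) L) (^s≈1⇒fixed i (trans (^-comm x L s) (trans (^-assocʳ x s L)
            (fermat x≉0))))

    linearized-injective : ∀ i j → Injective _≈_ _≈_ (linearized i j)
    linearized-injective i j {x} {y} e = x∙y⁻¹≈ε⇒x≈y x y (linearized-≈0 i j (begin
      (x - y) ^ Q + a * (x - y) ^ Q′                     ≈⟨ +-cong (q-frobenius-sub i x y) (*-congˡ
            (q-frobenius-sub j x y)) ⟩
      (x ^ Q - y ^ Q) + a * (x ^ Q′ - y ^ Q′)            ≈⟨ +-congˡ (x[y-z]≈xy-xz a _ _) ⟩
      (x ^ Q - y ^ Q) + (a * x ^ Q′ - a * y ^ Q′)        ≈⟨ interchange _ _ _ _ ⟩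
      (x ^ Q + a * x ^ Q′) + (- y ^ Q - a * y ^ Q′)      ≈⟨ +-cong e (-‿+-comm _ _) ⟩
      linearized i j y - linearized i j y                ≈⟨ -‿inverseʳ _ ⟩
      0#                                                 ∎))
      where
      open import Algebra.Properties.CommutativeSemigroup +-commutativeSemigroup using (interchange)
      Q = q ℕ.^ i
      Q′ = q ℕ.^ j

    linearized-* : ∀ i j {b} x → b ^ s ≈ 1# → linearized i j (b * x) ≈ b * linearized i j x
    linearized-* i j {b} x bˢ≈1 = begin
      (b * x) ^ (q ℕ.^ i) + a * (b * x) ^ (q ℕ.^ j)      ≈⟨ +-cong (scale i) (trans (*-congˡ (scale j)) (x∙yz≈y∙xz
            a b _)) ⟩
      b * x ^ (q ℕ.^ i) + b * (a * x ^ (q ℕ.^ j))        ≈⟨ distribˡ b _ _ ⟨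
      b * linearized i j x                               ∎
      where
      open import Algebra.Properties.CommutativeSemigroup *-commutativeSemigroup using (x∙yz≈y∙xz)
      scale : ∀ i → (b * x) ^ (q ℕ.^ i) ≈ b * x ^ (q ℕ.^ i)
      scale i = trans (^-distrib-* b x (q ℕ.^ i)) (*-congʳ (^s≈1⇒fixed i bˢ≈1))

  module _ {r} (1≤r : 1 ℕ.≤ r) (gcd≡1 : gcd r s ≡ 1) where
    private
      f≉0 : ∀ {x} → ¬ x ≈ 0# → ¬ f q r a x ≈ 0#
      f≉0 x≉0 = *-≉0 (^-≉0 r x≉0) (x^s≉-a x≉0)

      f0≈0 : ∀ {x} → x ≈ 0# → f q r a x ≈ 0#
      f0≈0 x≈0 = *≈0 _ (trans (^-congˡ r x≈0) (^-zero r {{ℕ.>-nonZero 1≤r}}))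

      -- A Bézout identity for r and s writes x, up to powers with equal values at x and y, through
      -- x^r and x^s. Its two sign patterns are kept apart because exponents are natural numbers.
      ^r-^s-injective : ∀ {x y} → ¬ x ≈ 0# → x ^ s ≈ y ^ s → x ^ r ≈ y ^ r → x ≈ y
      ^r-^s-injective {x} {y} x≉0 xˢ≈yˢ xʳ≈yʳ with ≡.subst (λ d → Bézout.Identity d r s) gcd≡1 (Bézout.identity
            (gcd-GCD r s))
      ... | Bézout.+- u v eq = *-cancelˡ (^-≉0 (s ℕ.* v) x≉0) (trans (expand x) (trans
              (trans (sym (^-assocʳ x r u)) (trans (^-congˡ u xʳ≈yʳ) (^-assocʳ y r u)))
              (trans (sym (expand y)) (*-congʳ (trans (sym (^-assocʳ y s v)) (trans (^-congˡ v (sym xˢ≈yˢ))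
                    (^-assocʳ x s v)))))))
        where
        expand : ∀ z → z ^ (s ℕ.* v) * z ≈ z ^ (r ℕ.* u)
        expand z = trans (*-comm _ _) (^-congʳ z (≡.trans (≡.cong suc (ℕ.*-comm s v)) (≡.trans eq (ℕ.*-comm u r))))
      ... | Bézout.-+ u v eq = *-cancelˡ (^-≉0 (r ℕ.* u) x≉0) (trans (expand x) (trans
              (trans (sym (^-assocʳ x s v)) (trans (^-congˡ v xˢ≈yˢ) (^-assocʳ y s v)))
              (trans (sym (expand y)) (*-congʳ (trans (sym (^-assocʳ y r u)) (trans (^-congˡ u (sym xʳ≈yʳ))
                    (^-assocʳ x r u)))))))
        where
        expand : ∀ z → z ^ (r ℕ.* u) * z ≈ z ^ (s ℕ.* v)
        expand z = trans (*-comm _ _) (^-congʳ z (≡.trans (≡.cong suc (ℕ.*-comm r u)) (≡.trans eq (ℕ.*-comm v s))))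

    -- f(x) = N(x)^κ (w^(q^i) + a w^(q^j)) with w = x^m and N(x) = x^L of order dividing q - 1,
    -- the exponents being read modulo n = q^(e+1) - 1.
    permutes : ∀ κ i j m m′ u v u′ v′ t t′ →
               r ℕ.+ s ℕ.+ u ℕ.* n ≡ κ ℕ.* L ℕ.+ m ℕ.* q ℕ.^ i ℕ.+ v ℕ.* n →
               r ℕ.+ u′ ℕ.* n ≡ κ ℕ.* L ℕ.+ m ℕ.* q ℕ.^ j ℕ.+ v′ ℕ.* n →
               m ℕ.* m′ ℕ.+ t ℕ.* L ≡ 1 ℕ.+ t′ ℕ.* L →
               Permutes (f q r a)
    permutes κ i j m m′ u v u′ v′ t t′ eq eq′ inverse = injective⇒bijective (f-cong r) injective
      where
      f≈ : ∀ {x} → ¬ x ≈ 0# → f q r a x ≈ linearized i j (x ^ (κ ℕ.* L) * x ^ m)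
      f≈ {x} x≉0 = begin
        x ^ r * (x ^ s + a)                                    ≈⟨ distribˡ _ _ _ ⟩
        x ^ r * x ^ s + x ^ r * a                              ≈⟨ +-cong (sym (^-homo-* x r s)) (*-comm _ a) ⟩
        x ^ (r ℕ.+ s) + a * x ^ r                              ≈⟨ +-cong (^-≡mod x≉0 u v eq) (*-congˡ (^-≡mod x≉0
              u′ v′ eq′)) ⟩
        x ^ (κ ℕ.* L ℕ.+ m ℕ.* q ℕ.^ i) + a * x ^ (κ ℕ.* L ℕ.+ m ℕ.* q ℕ.^ j)
          ≈⟨ +-cong (factor i) (trans (*-congˡ (factor j)) (x∙yz≈y∙xz a _ _)) ⟩
        x ^ (κ ℕ.* L) * (x ^ m) ^ (q ℕ.^ i) + x ^ (κ ℕ.* L) * (a * (x ^ m) ^ (q ℕ.^ j)) ≈⟨ distribˡ _ _ _ ⟨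
        x ^ (κ ℕ.* L) * linearized i j (x ^ m)                 ≈⟨ linearized-* i j (x ^ m) (norm^s≈1 x≉0 κ) ⟨
        linearized i j (x ^ (κ ℕ.* L) * x ^ m)                 ∎
        where
        open import Algebra.Properties.CommutativeSemigroup *-commutativeSemigroup using (x∙yz≈y∙xz)
        factor : ∀ i → x ^ (κ ℕ.* L ℕ.+ m ℕ.* q ℕ.^ i) ≈ x ^ (κ ℕ.* L) * (x ^ m) ^ (q ℕ.^ i)
        factor i = trans (^-homo-* x (κ ℕ.* L) _) (*-congˡ (sym (^-assocʳ x m (q ℕ.^ i))))

      -- The s-th power removes the norm factor. It also multiplies all exponents by s, so an
      -- inverse of m modulo L suffices to undo m modulo n = sL.
      x^s≈ : ∀ {x} → ¬ x ≈ 0# → ((x ^ (κ ℕ.* L) * x ^ m) ^ s) ^ m′ ≈ x ^ s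
      x^s≈ {x} x≉0 = begin
        ((x ^ (κ ℕ.* L) * x ^ m) ^ s) ^ m′         ≈⟨ ^-congˡ m′ (^-distrib-* _ _ s) ⟩
        ((x ^ (κ ℕ.* L)) ^ s * (x ^ m) ^ s) ^ m′   ≈⟨ ^-congˡ m′ (trans (*-congʳ (norm^s≈1 x≉0 κ)) (*-identityˡ _)) ⟩
        ((x ^ m) ^ s) ^ m′                         ≈⟨ trans (^-assocʳ (x ^ m) s m′) (^-assocʳ x m (s ℕ.* m′)) ⟩
        x ^ (m ℕ.* (s ℕ.* m′))                     ≈⟨ ^-≡mod x≉0 t t′ (≡.trans (l₁ m s m′ t L) (≡.trans (≡.cong (s
              ℕ.*_) inverse) (l₂ s t′ L))) ⟩
        x ^ s                                      ∎
        where
        l₁ : ∀ m s m′ t L → m ℕ.* (s ℕ.* m′) ℕ.+ t ℕ.* (s ℕ.* L) ≡ s ℕ.* (m ℕ.* m′ ℕ.+ t ℕ.* L)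
        l₁ = solve-∀
        l₂ : ∀ s t L → s ℕ.* (1 ℕ.+ t ℕ.* L) ≡ s ℕ.+ t ℕ.* (s ℕ.* L)
        l₂ = solve-∀

      injective : Injective _≈_ _≈_ (f q r a)
      injective {x} {y} fx≈fy with x ≈? 0# | y ≈? 0#
      ... | yes x≈0 | yes y≈0 = trans x≈0 (sym y≈0)
      ... | yes x≈0 | no  y≉0 = contradiction (trans (sym fx≈fy) (f0≈0 x≈0)) (f≉0 y≉0)
      ... | no  x≉0 | yes y≈0 = contradiction (trans fx≈fy (f0≈0 y≈0)) (f≉0 x≉0)
      ... | no  x≉0 | no  y≉0 = ^r-^s-injective x≉0 xˢ≈yˢ (*-cancelˡ (x^s≉-a x≉0) (begin
        (x ^ s + a) * x ^ r ≈⟨ *-comm _ _ ⟩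
        f q r a x           ≈⟨ fx≈fy ⟩
        f q r a y           ≈⟨ *-congˡ (+-congʳ xˢ≈yˢ) ⟨
        y ^ r * (x ^ s + a) ≈⟨ *-comm _ _ ⟩
        (x ^ s + a) * y ^ r ∎))
        where
        xˢ≈yˢ : x ^ s ≈ y ^ s
        xˢ≈yˢ = trans (sym (x^s≈ x≉0)) (trans (^-congˡ m′ (^-congˡ s
          (linearized-injective i j (trans (sym (f≈ x≉0)) (trans fx≈fy (f≈ y≉0)))))) (x^s≈ y≉0))

    private
      κ : ℕ
      κ = r ℕ./ L

      r≡r%L+κL : r ≡ r ℕ.% L ℕ.+ κ ℕ.* L
      r≡r%L+κL = ℕ.m≡m%n+[m/n]*n r L

      -- The exponent -1, represented modulo n and modulo L respectively.
      ν L₁ : ℕ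
      ν = ℕ.pred n
      L₁ = ℕ.pred L

      1+ν≡n : suc ν ≡ n
      1+ν≡n = ℕ.suc-pred n

      q≤L : q ℕ.≤ L
      q≤L = ℕ.≤-trans (ℕ.m≤m*n q (ℓ q e) {{ℕ.>-nonZero (ℓ>0 q e 1≤e)}}) (ℕ.≤-trans (ℕ.n≤1+n _) (ℕ.≤-reflexive
            (≡.sym (ℓ-suc q e))))

    permutes-1 : r ℕ.% L ≡ 1 → Permutes (f q r a)
    -- With m = 1 the form is f(x) = N(x)^κ (x^q + a x).
    permutes-1 r% = permutes κ 1 0 1 1 0 0 0 0 0 0
      (≡.trans (≡.cong (λ r → r ℕ.+ s ℕ.+ 0) r≡) (l₁ s (κ ℕ.* L)))
      (≡.trans (≡.cong (ℕ._+ 0) r≡) (l₂ (κ ℕ.* L))) ≡.refl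
      where
      r≡ : r ≡ 1 ℕ.+ κ ℕ.* L
      r≡ = ≡.trans r≡r%L+κL (≡.cong (ℕ._+ κ ℕ.* L) r%)
      l₁ : ∀ s x → 1 ℕ.+ x ℕ.+ s ℕ.+ 0 ≡ x ℕ.+ 1 ℕ.* (suc s ℕ.* 1) ℕ.+ 0
      l₁ = solve-∀
      l₂ : ∀ x → 1 ℕ.+ x ℕ.+ 0 ≡ x ℕ.+ 1 ℕ.* 1 ℕ.+ 0
      l₂ = solve-∀

    private
      inverse-mod-L : ν ℕ.* L₁ ℕ.+ suc s ℕ.* L ≡ 1 ℕ.+ n ℕ.* L
      inverse-mod-L = ≡.trans (≡.cong (λ x → ν ℕ.* L₁ ℕ.+ (L ℕ.+ x)) (≡.sym 1+ν≡n))
        (≡.trans (l₁ ν L₁) (≡.cong (λ x → 1 ℕ.+ x ℕ.* L) 1+ν≡n))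
        where
        l₁ : ∀ ν x → ν ℕ.* x ℕ.+ (suc x ℕ.+ suc ν) ≡ 1 ℕ.+ suc ν ℕ.* suc x
        l₁ = solve-∀

    -- Take m = -1: then r = (κ + 1) L - q and r + s = (κ + 1) L - 1 are the exponents with j = 1
    -- and i = 0. Modulo L, -1 is its own inverse.
    permutes-[L-q] : r ℕ.% L ≡ L ℕ.∸ q → Permutes (f q r a)
    permutes-[L-q] r% = permutes (suc κ) 0 1 ν L₁ 1 0 q 0 q n
      (≡.trans (≡.cong (λ x → r ℕ.+ s ℕ.+ 1 ℕ.* x) (≡.sym 1+ν≡n)) (≡.trans (l₁ r s ν) (≡.cong (λ x → x ℕ.+ ν ℕ.* 1
            ℕ.+ 0) r+q≡)))
      (≡.trans (≡.cong (λ x → r ℕ.+ q ℕ.* x) (≡.sym 1+ν≡n)) (≡.trans (l₂ r q ν) (≡.cong (λ x → x ℕ.+ ν ℕ.* (q ℕ.*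
            1) ℕ.+ 0) r+q≡)))
      inverse-mod-L
      where
      r+q≡ : r ℕ.+ q ≡ suc κ ℕ.* L
      r+q≡ = ≡.trans (≡.cong (ℕ._+ q) (≡.trans r≡r%L+κL (≡.cong (ℕ._+ κ ℕ.* L) r%)))
        (≡.trans (l₀ (L ℕ.∸ q) (κ ℕ.* L) q) (≡.cong (ℕ._+ κ ℕ.* L) (ℕ.m∸n+n≡m q≤L)))
        where
        l₀ : ∀ x y q → x ℕ.+ y ℕ.+ q ≡ x ℕ.+ q ℕ.+ y
        l₀ = solve-∀
      l₁ : ∀ r s ν → r ℕ.+ s ℕ.+ 1 ℕ.* suc ν ≡ r ℕ.+ suc s ℕ.+ ν ℕ.* 1 ℕ.+ 0
      l₁ = solve-∀
      l₂ : ∀ r q ν → r ℕ.+ q ℕ.* suc ν ≡ r ℕ.+ q ℕ.+ ν ℕ.* (q ℕ.* 1) ℕ.+ 0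
      l₂ = solve-∀

    module _ (e≡4 : e ≡ 4) where
      private
        q⁵≡1+n : q ℕ.^ 5 ≡ suc n
        q⁵≡1+n = ≡.trans (≡.cong (λ e → q ℕ.^ suc e) (≡.sym e≡4)) (q^e≡1+sℓ s (suc e))

        -- This makes q² + 1 invertible modulo L, with inverse -(q² + q).
        L≡ : L ≡ suc ((q ℕ.* q ℕ.+ 1) ℕ.* (q ℕ.* q ℕ.+ q))
        L≡ = ≡.trans (≡.cong (λ e → ℓ q (suc e)) e≡4) (l₁ q)
          where
          l₁ : ∀ q → suc (q ℕ.* 1 ℕ.+ (q ℕ.* (q ℕ.* 1) ℕ.+ (q ℕ.* (q ℕ.* (q ℕ.* 1)) ℕ.+ (q ℕ.* (q ℕ.* (q ℕ.* (q ℕ.*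
                1))) ℕ.+ 0)))) ≡
                     suc ((q ℕ.* q ℕ.+ 1) ℕ.* (q ℕ.* q ℕ.+ q))
          l₁ = solve-∀

        L₁≡ : (q ℕ.* q ℕ.+ 1) ℕ.* (q ℕ.* q ℕ.+ q) ≡ L₁
        L₁≡ = ℕ.suc-injective (≡.sym L≡)

      -- Take m = q² + 1. Then r + s = κL + m q, and m q³ = q⁵ + q³ ≡ 1 + q³ modulo n because q⁵ = n
      -- + 1.
      permutes-[q³+1] : r ℕ.% L ≡ q ℕ.^ 3 ℕ.+ 1 → Permutes (f q r a)
      permutes-[q³+1] r% = permutes κ 1 3 (q ℕ.* q ℕ.+ 1) ((q ℕ.* q ℕ.+ q) ℕ.* L₁) 0 0 1 0 2 L
        (≡.trans (≡.cong (λ r → r ℕ.+ s ℕ.+ 0) r≡) (l₁ s (κ ℕ.* L)))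
        (≡.trans (≡.cong (λ r → r ℕ.+ 1 ℕ.* n) r≡) (≡.trans (l₂ (q ℕ.^ 3) n (κ ℕ.* L)) (≡.trans (≡.cong (λ x → x
              ℕ.+ q ℕ.^ 3 ℕ.+ κ ℕ.* L) (≡.sym q⁵≡1+n)) (l₃ q (κ ℕ.* L)))))
        (≡.trans (≡.cong (ℕ._+ 2 ℕ.* L) (≡.trans (≡.sym (ℕ.*-assoc (q ℕ.* q ℕ.+ 1) (q ℕ.* q ℕ.+ q) L₁)) (≡.cong
              (ℕ._* L₁) L₁≡))) (l₄ L₁))
        where
        r≡ : r ≡ q ℕ.^ 3 ℕ.+ 1 ℕ.+ κ ℕ.* L
        r≡ = ≡.trans r≡r%L+κL (≡.cong (ℕ._+ κ ℕ.* L) r%)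
        l₁ : ∀ s x → let q = suc s in q ℕ.* (q ℕ.* (q ℕ.* 1)) ℕ.+ 1 ℕ.+ x ℕ.+ s ℕ.+ 0 ≡ x ℕ.+ (q ℕ.* q ℕ.+ 1) ℕ.* (q ℕ.* 1) ℕ.+ 0
        l₁ = solve-∀
        l₂ : ∀ Q n x → Q ℕ.+ 1 ℕ.+ x ℕ.+ 1 ℕ.* n ≡ suc n ℕ.+ Q ℕ.+ x
        l₂ = solve-∀
        l₃ : ∀ q x → q ℕ.* (q ℕ.* (q ℕ.* (q ℕ.* (q ℕ.* 1)))) ℕ.+ q ℕ.* (q ℕ.* (q ℕ.* 1)) ℕ.+ x ≡ x ℕ.+ (q ℕ.* q ℕ.+
              1) ℕ.* (q ℕ.* (q ℕ.* (q ℕ.* 1))) ℕ.+ 0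
        l₃ = solve-∀
        l₄ : ∀ x → x ℕ.* x ℕ.+ 2 ℕ.* suc x ≡ 1 ℕ.+ suc x ℕ.* suc x
        l₄ = solve-∀

      -- Take m = -(q² + 1). Then r = (κ + 1) L - q - q³ = (κ + 1) L + m q, and m q³ ≡ -1 - q³
      -- modulo n accounts for r + s.
      permutes-[q⁴+q²+1] : r ℕ.% L ≡ q ℕ.^ 4 ℕ.+ q ℕ.^ 2 ℕ.+ 1 → Permutes (f q r a)
      permutes-[q⁴+q²+1] r% = permutes (suc κ) 3 1 (ν ℕ.* (q ℕ.* q ℕ.+ 1)) (q ℕ.* q ℕ.+ q) (q ℕ.^ 5 ℕ.+ Q) 1 (Q ℕ.+
            q) 0 q n
        (≡.trans (≡.cong (λ x → r ℕ.+ s ℕ.+ (q ℕ.^ 5 ℕ.+ Q) ℕ.* x) (≡.sym 1+ν≡n))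
          (≡.trans (l₂ r s (q ℕ.^ 5) Q ν) (≡.trans (≡.cong (λ x → r ℕ.+ s ℕ.+ Q ℕ.+ x ℕ.+ (q ℕ.^ 5 ℕ.+ Q) ℕ.* ν)
                q⁵≡1+n)
          (≡.trans (l₃ r s Q n q ν) (≡.cong (λ x → x ℕ.+ ν ℕ.* (q ℕ.* q ℕ.+ 1) ℕ.* (q ℕ.* (q ℕ.* (q ℕ.* 1))) ℕ.+ 1
                ℕ.* n) r+q+q³≡)))))
        (≡.trans (≡.cong (λ x → r ℕ.+ (Q ℕ.+ q) ℕ.* x) (≡.sym 1+ν≡n)) (≡.trans (l₄ r q ν)
          (≡.cong (λ x → x ℕ.+ ν ℕ.* (q ℕ.* q ℕ.+ 1) ℕ.* (q ℕ.* 1) ℕ.+ 0) r+q+q³≡)))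
        (≡.trans (≡.cong (ℕ._+ suc s ℕ.* L) (≡.trans (ℕ.*-assoc ν (q ℕ.* q ℕ.+ 1) (q ℕ.* q ℕ.+ q)) (≡.cong (ν ℕ.*_)
              L₁≡))) inverse-mod-L)
        where
        Q : ℕ
        Q = q ℕ.^ 3
        r+q+q³≡ : r ℕ.+ q ℕ.+ Q ≡ suc κ ℕ.* L
        r+q+q³≡ = ≡.trans (≡.cong (λ x → x ℕ.+ q ℕ.+ Q) (≡.trans r≡r%L+κL (≡.cong (ℕ._+ κ ℕ.* L) r%)))
          (≡.trans (l₀ q (κ ℕ.* L)) (≡.cong (ℕ._+ κ ℕ.* L) (≡.sym L≡)))
          where
          l₀ : ∀ q x → q ℕ.* (q ℕ.* (q ℕ.* (q ℕ.* 1))) ℕ.+ q ℕ.* (q ℕ.* 1) ℕ.+ 1 ℕ.+ x ℕ.+ q ℕ.+ q ℕ.* (q ℕ.* (q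
                ℕ.* 1)) ≡
                       suc ((q ℕ.* q ℕ.+ 1) ℕ.* (q ℕ.* q ℕ.+ q)) ℕ.+ x
          l₀ = solve-∀
        l₂ : ∀ r s z Q ν → r ℕ.+ s ℕ.+ (z ℕ.+ Q) ℕ.* suc ν ≡ r ℕ.+ s ℕ.+ Q ℕ.+ z ℕ.+ (z ℕ.+ Q) ℕ.* ν
        l₂ = solve-∀
        l₃ : ∀ r s Q n q ν → r ℕ.+ s ℕ.+ Q ℕ.+ suc n ℕ.+ (q ℕ.* (q ℕ.* (q ℕ.* (q ℕ.* (q ℕ.* 1)))) ℕ.+ q ℕ.* (q ℕ.*
              (q ℕ.* 1))) ℕ.* ν ≡
             r ℕ.+ suc s ℕ.+ Q ℕ.+ ν ℕ.* (q ℕ.* q ℕ.+ 1) ℕ.* (q ℕ.* (q ℕ.* (q ℕ.* 1))) ℕ.+ 1 ℕ.* n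
        l₃ = solve-∀
        l₄ : ∀ r q ν → r ℕ.+ (q ℕ.* (q ℕ.* (q ℕ.* 1)) ℕ.+ q) ℕ.* suc ν ≡
             r ℕ.+ q ℕ.+ q ℕ.* (q ℕ.* (q ℕ.* 1)) ℕ.+ ν ℕ.* (q ℕ.* q ℕ.+ 1) ℕ.* (q ℕ.* 1) ℕ.+ 0
        l₄ = solve-∀

-- The equivalences, degree by degree.

module Characterization {c ℓ₁ ℓ₂} (F : HeytingField c ℓ₁ ℓ₂) {p k s e} (p-prime : Prime p)
         (q≡p^k : ℕ.suc s ≡ p ^ℕ ℕ.suc k) (1≤e : 1 ≤ e)
         (order : FieldNotions.HasOrder F (ℕ.suc (s ℕ.* ℓ (ℕ.suc s) (ℕ.suc e))))
         {a : HeytingField.Carrier F} (a≉0 : ¬ HeytingField._≈_ F a (HeytingField.0# F)) {r} (1≤r : 1 ≤ r) where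
  open FieldNotions F using (_≈_; 1#; -_; Permutes; f) renaming (_^_ to _↑_)
  open import Data.List.Relation.Unary.Any using (here; there)
  open import Data.Nat.Properties using (suc-injective)
  open import Data.Product.Base using (_,_)
  open import Function.Bundles using (mk⇔)
  open import Relation.Binary.PropositionalEquality using (refl)
  open BinomialMoments F {k = k} {e = e} p-prime q≡p^k 1≤e order using (q; L; module Moments)
  open Moments a≉0 using ([-a]^L≉1; gcd≡1)
  open Sufficiency F {k = k} {e = e} p-prime q≡p^k 1≤e order a≉0

  private
    module Short = ShortNecessity F {k = k} {e = e} p-prime q≡p^k 1≤e order a≉0 1≤r
    module Long  = LongNecessity F {k = k} {e = e} p-prime q≡p^k 1≤e order a≉0 1≤r

    characterize : ∀ {R} → (Permutes (f q r a) → r % L ∈ R) →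
                   (¬ (- a) ↑ L ≈ 1# → gcd r s ≡ 1 → r % L ∈ R → Permutes (f q r a)) →
                   Permutes (f q r a) ⇔ (¬ ((- a) ↑ L ≈ 1#) × gcd r s ≡ 1 × r % L ∈ R)
    characterize necessary sufficient =
      mk⇔ (λ perm → [-a]^L≉1 1≤r perm , gcd≡1 1≤r perm , necessary perm) (λ (norm≉1 , gcd≡1 , r%L∈) → sufficient
            norm≉1 gcd≡1 r%L∈)

    sufficientTwo : ¬ (- a) ↑ L ≈ 1# → gcd r s ≡ 1 → r % L ∈ 1 ∷ L ∸ q ∷ [] → Permutes (f q r a)
    sufficientTwo norm≉1 gcd≡1 (here r%)         = permutes-1 norm≉1 1≤r gcd≡1 r%
    sufficientTwo norm≉1 gcd≡1 (there (here r%)) = permutes-[L-q] norm≉1 1≤r gcd≡1 r%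

  degreeTwoToFour : ℕ.suc e ∈ 2 ∷ 3 ∷ 4 ∷ [] →
                    Permutes (f q r a) ⇔ (¬ ((- a) ↑ L ≈ 1#) × gcd r s ≡ 1 × r % L ∈ 1 ∷ L ∸ q ∷ [])
  degreeTwoToFour e∈ = characterize (necessary e∈) sufficientTwo
    where
    necessary : ℕ.suc e ∈ 2 ∷ 3 ∷ 4 ∷ [] → Permutes (f q r a) → r % L ∈ 1 ∷ L ∸ q ∷ []
    necessary (here e≡2)                 perm = Short.exponentTwo perm (suc-injective e≡2)
    necessary (there (here e≡3))         perm = Short.ExponentThree.exponentThree perm (suc-injective e≡3)
    necessary (there (there (here e≡4))) perm = Short.ExponentFour.exponentFour perm (suc-injective e≡4)

  module _ (q≡p : q ≡ p) (p≢2 : ¬ p ≡ 2) where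

    degreeFive : ℕ.suc e ≡ 5 →
                 Permutes (f q r a) ⇔ (¬ ((- a) ↑ L ≈ 1#) × gcd r s ≡ 1 ×
                   r % L ∈ 1 ∷ L ∸ q ∷ q ^ℕ 3 +ℕ 1 ∷ q ^ℕ 4 +ℕ q ^ℕ 2 +ℕ 1 ∷ [])
    degreeFive e≡5 = characterize (λ perm → Long.ExponentFive.exponentFive perm e≡4 q≡p p≢2) sufficient
      where
      e≡4 : e ≡ 4
      e≡4 = suc-injective e≡5
      sufficient : ¬ (- a) ↑ L ≈ 1# → gcd r s ≡ 1 → r % L ∈ 1 ∷ L ∸ q ∷ q ^ℕ 3 +ℕ 1 ∷ q ^ℕ 4 +ℕ q ^ℕ 2 +ℕ 1 ∷ [] →
            Permutes (f q r a)
      sufficient norm≉1 gcd≡1 (here r%)                         = permutes-1 norm≉1 1≤r gcd≡1 r%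
      sufficient norm≉1 gcd≡1 (there (here r%))                 = permutes-[L-q] norm≉1 1≤r gcd≡1 r%
      sufficient norm≉1 gcd≡1 (there (there (here r%)))         = permutes-[q³+1] norm≉1 1≤r gcd≡1 e≡4 r%
      sufficient norm≉1 gcd≡1 (there (there (there (here r%)))) = permutes-[q⁴+q²+1] norm≉1 1≤r gcd≡1 e≡4 r%

    degreeSix : ℕ.suc e ≡ 6 →
                Permutes (f q r a) ⇔ (¬ ((- a) ↑ L ≈ 1#) × gcd r s ≡ 1 × r % L ∈ 1 ∷ L ∸ q ∷ [])
    degreeSix e≡6 = characterize (λ perm → Long.ExponentSix.exponentSix perm (suc-injective e≡6) q≡p p≢2)
          sufficientTwo

theorem1p3 :
  ∀ {c ℓ₁ ℓ₂} (q e r : ℕ) → IsPrimePower q → (2≤e : 2 ≤ e) → e ≤ 6 → 1 ≤ r →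
  (F : HeytingField c ℓ₁ ℓ₂) → let open FieldNotions F in
  HasOrder (q ^ℕ e) → (a : Carrier) → ¬ (a ≈ 0#) →
  let L = ℓ q e
      instance L≢0 = ℓ-nonZero q 2≤e
  in
  (e ∈ 2 ∷ 3 ∷ 4 ∷ [] →
    Permutes (f q r a) ⇔
      (¬ ((- a) ^ L ≈ 1#) × gcd r (q ∸ 1) ≡ 1 ×
       r % L ∈ 1 ∷ L ∸ q ∷ []))
  ×
  (e ≡ 5 → Prime q → ¬ (2 ∣ q) →
    Permutes (f q r a) ⇔
      (¬ ((- a) ^ L ≈ 1#) × gcd r (q ∸ 1) ≡ 1 ×
       r % L ∈ 1 ∷ L ∸ q ∷ q ^ℕ 3 +ℕ 1 ∷ q ^ℕ 4 +ℕ q ^ℕ 2 +ℕ 1 ∷ []))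
  ×
  (e ≡ 6 → Prime q → ¬ (2 ∣ q) →
    Permutes (f q r a) ⇔
      (¬ ((- a) ^ L ≈ 1#) × gcd r (q ∸ 1) ≡ 1 ×
       r % L ∈ 1 ∷ L ∸ q ∷ []))
theorem1p3 ℕ.zero e r (p , k , p-prime , _ , 0≡p^k) = contradiction (m^n≡0⇒m≡0 p k (sym 0≡p^k)) (≢-nonZero⁻¹ p {{prime⇒nonZero p-prime}})
  where
  open import Data.Nat.Base using (≢-nonZero⁻¹)
  open import Data.Nat.Properties using (m^n≡0⇒m≡0)
  open import Data.Nat.Primality using (prime⇒nonZero)
  open import Relation.Binary.PropositionalEquality using (sym)
  open import Relation.Nullary using (contradiction)
theorem1p3 q@(ℕ.suc s) (ℕ.suc e) r (p , ℕ.suc k , p-prime , _ , q≡p^k) (ℕ.s≤s 1≤e) _ 1≤r F order a a≉0 =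
  degreeTwoToFour ,
  (λ e≡5 q-prime 2∤q → PrimeField.degreeFive q-prime refl (odd 2∤q) e≡5) ,
  (λ e≡6 q-prime 2∤q → PrimeField.degreeSix q-prime refl (odd 2∤q) e≡6)
  where
  open import Data.Nat.Divisibility using (∣-reflexive)
  open import Data.Nat.Properties using (^-identityʳ)
  open import Relation.Binary.PropositionalEquality using (refl; sym; subst)
  open RepunitArithmetic using (q^e≡1+sℓ)
  order′ : FieldNotions.HasOrder F (ℕ.suc (s ℕ.* ℓ q (ℕ.suc e)))
  order′ = subst (FieldNotions.HasOrder F) (q^e≡1+sℓ s (ℕ.suc e)) order
  open Characterization F {k = k} {e = e} p-prime q≡p^k 1≤e order′ a≉0 1≤r using (degreeTwoToFour)
  -- For prime q the representation q = q^1 replaces the given p^k, so that `q ≡ p` holds by `refl`.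
  module PrimeField (q-prime : Prime q) =
    Characterization F {k = 0} {e = e} q-prime (sym (^-identityʳ q)) 1≤e order′ a≉0 1≤r using (degreeFive; degreeSix)
  odd : ¬ 2 ∣ q → ¬ q ≡ 2
  odd 2∤q q≡2 = 2∤q (∣-reflexive (sym q≡2))
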